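{- Let $S$ be the set of simplex-duplex polyominoes whose last (rightmost) column is a simplex column, partitioned into the sets $S_\alpha,S_\beta,\dots,S_\mu$ defined in the context, and let $A(t)=A(q,t,w)$, $A_1$, $B_1$, $C_1$ be as defined in the context; for $X\in\{\alpha,\beta,\gamma,\delta,\epsilon,\zeta,\eta,\theta,\iota,\kappa,\lambda,\mu\}$ let $A_X(t)=\sum_{P\in S_X} q^{\mathrm{area}(P)}\, t^{h(P)}\, w^{d(P)}$, and let $A(qt)$ denote $A(q,qt,w)$. Then, as formal power series, \begin{align*} A_\alpha(t) &= \frac{qt}{1-qt}+\frac{q^5t^3w}{(1-q)^2(1-qt)^3},\\ A_\beta(t) &= \frac{qt}{(1-qt)^2}\, A_1,\\ A_\gamma(t) &= \frac{qt}{1-qt}\, B_1,\\ A_\delta(t)=A_\zeta(t) &= \frac{q^5t^3w}{(1-q)^3(1-qt)^3}\, A_1,\\ A_\epsilon(t)=A_\eta(t) &= \frac{q^5t^3w}{(1-q)^2(1-qt)^4}\, A_1-\frac{q^4t^2w}{(1-q)^2(1-qt)^4}\, A(qt),\\ A_\theta(t) &= \frac{q^5t^3w}{(1-q)^2(1-qt)^3}\, B_1-\frac{q^5t^3w}{(1-q)^2(1-qt)^4}\, A_1+\frac{q^4t^2w}{(1-q)^2(1-qt)^4}\, A(qt),\\ A_\iota(t)=A_\lambda(t) &= \frac{q^4tw}{(1-q)^3(1-qt)}\, C_1,\\ A_\kappa(t)=A_\mu(t) &= \frac{q^3tw}{(1-q)^2(1-qt)^2}\, C_1-\frac{q^5t^3w}{(1-q)^2(1-qt)^3}\,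 B_1+\frac{q^5t^3w}{(1-q)^2(1-qt)^4}\, A_1-\frac{q^4t^2w}{(1-q)^2(1-qt)^4}\, A(qt). \end{align*}
   Context: A cell is a unit square in the plane whose vertices have integer coordinates. A polyomino is a union of finitely many cells whose interior is connected; two polyominoes are considered equal iff one is a translate of the other. The columns of a polyomino $P$ are the blocks of the partition of the cells of $P$ according to their horizontal projection (cells in the same column have the same $x$-interval); a column need not be connected. A column-duplex polyomino is a polyomino each of whose columns has one or two connected components; a column with one component is a simplex column, a column with two components is a duplex column. For a duplex column, its lower and upper components are its two connected components, and its hole is the set of cells lying in the column's vertical strip strictly between the two components. A simplex-duplex polyomino is a column-duplex polyomino in which no two adjacent columns are both duplex. The area of a polyomino is its number of cells. For a simplex-duplex polyomino $P$ with at least two simplex columns, the lower (resp. upper) pivot cell of $P$ is the right neighbour of the bottom (resp. top) cell of the second-rightmost simplex column of $P$. For $P$ with at least one duplex column, the lower inner pivot cell is the right neighbour of the top cell of the lower component of the rightmost duplex column of $P$, and the upper inner pivot cell is the right neighbour of the bottom cell of the upper component of that column. These cells need not belong to $P$. Two columns "have an edge in common" if some cell of one shares an edge with some cell of the other. "Last", "second-last", "third-last" refer to the rightmost, second-rightmost, third-rightmost columns. Let $S$ be the set of simplex-duplex polyominoes whose last column is simplex. For $P\in S$ let $h(P)$ be the number of cells of its last column and $d(P)$ its number of duplex columns, and set $A(q,t,w)=\sum_{P\in S} q^{\mathrm{area}(P)} t^{h(P)} w^{d(P)}$. Let $A_1=A(q,1,w)$, $B_1=\left.\frac{\partial}{\partial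 t}\left[\frac{A(q,t,w)}{t}\right]\right|_{t=1}$, $C_1=\frac12\left.\frac{\partial^2}{\partial t^2}\left[\frac{A(q,t,w)}{t}\right]\right|_{t=1}$. The subsets of $S$: - $S_\alpha$: $P\in S$ whose only simplex column is the last column. - $S_\beta$: $P\in S\setminus S_\alpha$ whose second-last column is simplex and whose last column contains the lower pivot cell of $P$. - $S_\gamma$: $P\in S\setminus S_\alpha$ whose second-last column is simplex and whose last column does not contain the lower pivot cell of $P$. - $S_\delta$: $P\in S\setminus S_\alpha$ whose second-last column is duplex (so the third-last is simplex), such that the lower component of the second-last column and the third-last column have no edge in common, and the lower pivot cell of $P$ lies in the upper component of the second-last column. - $S_\epsilon$: as $S_\delta$ but the lower pivot cell of $P$ lies in the hole of the second-last column. - $S_\zeta$: $P\in S\setminus S_\alpha$ with duplex second-last column, such that the upper component of the second-last column and the third-last column have no edge in common, and the upper pivot cell of $P$ lies in the lower component of the second-last column. - $S_\eta$: as $S_\zeta$ but the upper pivot cell of $P$ lies in the hole of the second-last column. - $S_\theta$: $P\in S\setminus S_\alpha$ with duplex second-last column, each of whose two components has an edge in common with the third-last column, and such that the last column has an edge in common with each of the two components of the second-last column. - $S_\iota$: $P\in S\setminus S_\alpha$ with duplex second-last column, each of whose two components has an edge in common with the third-last column, such that the last column has an edge in common with the lower component but none with the upper component of the second-last column, and the last column does not contain the lower inner pivot cell of $P$. - $S_\kappa$: as $S_\iota$ but the last column contains the lower inner pivot cell of $P$. - $S_\lambda$: $P\in S\setminus S_\alpha$ with duplex second-last column, each of whose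 two components has an edge in common with the third-last column, such that the last column has an edge in common with the upper component but none with the lower component of the second-last column, and the last column does not contain the upper inner pivot cell of $P$. - $S_\mu$: as $S_\lambda$ but the last column contains the upper inner pivot cell of $P$. These sets form a partition of $S$. -}

module Defs where

open import Data.Nat as N using (ℕ; zero; suc; _∸_)
open import Data.Integer as Z using (ℤ; +_)
open import Data.List using (List; []; _∷_; reverse; length)
open import Data.List.Relation.Unary.All using (All)
open import Data.List.Relation.Unary.Unique.Propositional using (Unique)
open import Data.List.Membership.Propositional using (_∈_)
open import Data.Maybe using (Maybe; just; nothing)
open import Data.Product using (Σ; ∃; _×_; _,_; ∃-syntax)
open import Data.Sum using (_⊎_)
open import Data.Unit using (⊤)
open import Data.Empty using (⊥)
open import Data.Bool using (if_then_else_)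
open import Relation.Nullary using (¬_)
open import Relation.Nullary.Decidable using (⌊_⌋)
open import Relation.Binary.PropositionalEquality using (_≡_)
open import Function.Bundles using (_⇔_)

-- Polyominoes with at most two components per column.
--
-- A polyomino is represented (canonically, up to translation) by the
-- list of its columns, the i-th column (i = 0,1,..) occupying the
-- vertical strip [i, i+1] × ℝ.  The cell (x , y) is the unit square
-- [x, x+1] × [y, y+1].  Canonical representative of a translation
-- class: leftmost column has x = 0, and the bottom cell of the
-- leftmost column has y = 0.

-- A column with one connected component (cells b..t), or with two
-- connected components (lower: cells b₁..t₁, upper: cells b₂..t₂).
data Col : Set where
  simp : (b t : ℤ) → Col
  dup  : (b₁ t₁ b₂ t₂ : ℤ) → Col

ValidCol : Col → Set
ValidCol (simp b t) = b Z.≤ t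
ValidCol (dup b₁ t₁ b₂ t₂) = b₁ Z.≤ t₁ × (t₁ Z.+ Z.1ℤ) Z.< b₂ × b₂ Z.≤ t₂

InColY : Col → ℤ → Set
InColY (simp b t) y = b Z.≤ y × y Z.≤ t
InColY (dup b₁ t₁ b₂ t₂) y = (b₁ Z.≤ y × y Z.≤ t₁) ⊎ (b₂ Z.≤ y × y Z.≤ t₂)

InLower : Col → ℤ → Set
InLower (simp _ _) _ = ⊥
InLower (dup b₁ t₁ _ _) y = b₁ Z.≤ y × y Z.≤ t₁

InUpper : Col → ℤ → Set
InUpper (simp _ _) _ = ⊥
InUpper (dup _ _ b₂ t₂) y = b₂ Z.≤ y × y Z.≤ t₂

InHole : Col → ℤ → Set
InHole (simp _ _) _ = ⊥
InHole (dup _ t₁ b₂ _) y = t₁ Z.< y × y Z.< b₂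

size : Col → ℕ
size (simp b t) = suc Z.∣ t Z.- b ∣
size (dup b₁ t₁ b₂ t₂) = suc Z.∣ t₁ Z.- b₁ ∣ N.+ suc Z.∣ t₂ Z.- b₂ ∣

bottom : Col → ℤ
bottom (simp b _) = b
bottom (dup b₁ _ _ _) = b₁

top : Col → ℤ
top (simp _ t) = t
top (dup _ _ _ t₂) = t₂

IsDup : Col → Set
IsDup (simp _ _) = ⊥
IsDup (dup _ _ _ _) = ⊤

IsSimp : Col → Set
IsSimp (simp _ _) = ⊤
IsSimp (dup _ _ _ _) = ⊥

Cell : Set
Cell = ℕ × ℤ

colAt : List Col → ℕ → Maybe Col
colAt [] _ = nothing
colAt (c ∷ _) zero = just c
colAt (_ ∷ cs) (suc i) = colAt cs i

InP : List Col → Cell → Set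
InP cs (x , y) = ∃[ c ] (colAt cs x ≡ just c × InColY c y)

Adj : Cell → Cell → Set
Adj (x , y) (x′ , y′) =
  (x ≡ x′ × (y′ ≡ y Z.+ Z.1ℤ ⊎ y ≡ y′ Z.+ Z.1ℤ)) ⊎
  (y ≡ y′ × (x′ ≡ suc x ⊎ x ≡ suc x′))

data Path (cs : List Col) : Cell → Cell → Set where
  here : ∀ {c} → InP cs c → Path cs c c
  step : ∀ {c c′ c″} → InP cs c → Adj c c′ → Path cs c′ c″ → Path cs c c″

-- connected interior  ⇔  edge-connected cell set
Connected : List Col → Set
Connected cs = ∀ c c′ → InP cs c → InP cs c′ → Path cs c c′

NoAdjDup : List Col → Set
NoAdjDup (c ∷ c′ ∷ cs) = ¬ (IsDup c × IsDup c′) × NoAdjDup (c′ ∷ cs)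
NoAdjDup _ = ⊤

-- normalisation (also forces non-emptiness)
FirstBottomZero : List Col → Set
FirstBottomZero [] = ⊥
FirstBottomZero (c ∷ _) = bottom c ≡ Z.0ℤ

IsSimplexDuplex : List Col → Set
IsSimplexDuplex cs =
  All ValidCol cs × FirstBottomZero cs × Connected cs × NoAdjDup cs

HeadSimp : List Col → Set
HeadSimp [] = ⊥
HeadSimp (c ∷ _) = IsSimp c

InS : List Col → Set
InS cs = IsSimplexDuplex cs × HeadSimp (reverse cs)

area : List Col → ℕ
area [] = 0
area (c ∷ cs) = size c N.+ area cs

headSize : List Col → ℕ
headSize [] = 0
headSize (c ∷ _) = size c

lastHeight : List Col → ℕ
lastHeight cs = headSize (reverse cs)

isDupB : Col → ℕ
isDupB (simp _ _) = 0
isDupB (dup _ _ _ _) = 1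

numDup : List Col → ℕ
numDup [] = 0
numDup (c ∷ cs) = isDupB c N.+ numDup cs

numSimp : List Col → ℕ
numSimp cs = length cs ∸ numDup cs

Stats : List Col → ℕ → ℕ → ℕ → Set
Stats cs n h d = area cs ≡ n × lastHeight cs ≡ h × numDup cs ≡ d

-- columns counted from the right (k = 0: last, 1: second-last, ...)

colR : List Col → ℕ → Maybe Col
colR cs k = colAt (reverse cs) k

xR : List Col → ℕ → ℕ
xR cs k = length cs ∸ suc k

RSet : (Col → ℤ → Set) → List Col → ℕ → Cell → Set
RSet P cs k (x , y) = x ≡ xR cs k × ∃[ c ] (colR cs k ≡ just c × P c y)

ColumnR LowerR UpperR HoleR : List Col → ℕ → Cell → Set
ColumnR = RSet InColY
LowerR = RSet InLower
UpperR = RSet InUpper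
HoleR = RSet InHole

ShareEdge : (Cell → Set) → (Cell → Set) → Set
ShareEdge A B = ∃[ c ] ∃[ c′ ] (A c × B c′ × Adj c c′)

-- (w+1)-th simplex (resp. duplex) column in a list, with its index
nthSimp : ℕ → ℕ → List Col → Maybe (ℕ × Col)
nthSimp _ _ [] = nothing
nthSimp zero i (simp b t ∷ _) = just (i , simp b t)
nthSimp (suc w) i (simp b t ∷ r) = nthSimp w (suc i) r
nthSimp w i (dup _ _ _ _ ∷ r) = nthSimp w (suc i) r

nthDup : ℕ → ℕ → List Col → Maybe (ℕ × Col)
nthDup _ _ [] = nothing
nthDup zero i (dup b₁ t₁ b₂ t₂ ∷ _) = just (i , dup b₁ t₁ b₂ t₂)
nthDup (suc w) i (dup _ _ _ _ ∷ r) = nthDup w (suc i) r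
nthDup w i (simp _ _ ∷ r) = nthDup w (suc i) r

lowerPivot upperPivot : List Col → Maybe Cell
lowerPivot cs with nthSimp 1 0 (reverse cs)
... | nothing = nothing
... | just (k , c) = just (suc (xR cs k) , bottom c)
upperPivot cs with nthSimp 1 0 (reverse cs)
... | nothing = nothing
... | just (k , c) = just (suc (xR cs k) , top c)

topLower botUpper : Col → ℤ
topLower (simp _ t) = t
topLower (dup _ t₁ _ _) = t₁
botUpper (simp b _) = b
botUpper (dup _ _ b₂ _) = b₂

lowerInnerPivot upperInnerPivot : List Col → Maybe Cell
lowerInnerPivot cs with nthDup 0 0 (reverse cs)
... | nothing = nothing
... | just (k , c) = just (suc (xR cs k) , topLower c)
upperInnerPivot cs with nthDup 0 0 (reverse cs)
... | nothing = nothing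
... | just (k , c) = just (suc (xR cs k) , botUpper c)

CellIn : Maybe Cell → (Cell → Set) → Set
CellIn mp A = ∃[ p ] (mp ≡ just p × A p)

SecondLastSimp SecondLastDup : List Col → Set
SecondLastSimp cs = ∃[ c ] (colR cs 1 ≡ just c × IsSimp c)
SecondLastDup cs = ∃[ c ] (colR cs 1 ≡ just c × IsDup c)

OnlySimpIsLast : List Col → Set
OnlySimpIsLast cs = numSimp cs ≡ 1

BothShareThird : List Col → Set
BothShareThird cs =
  ShareEdge (LowerR cs 1) (ColumnR cs 2) × ShareEdge (UpperR cs 1) (ColumnR cs 2)

data Cls : Set where
  Sα Sβ Sγ Sδ Sε Sζ Sη Sθ Sι Sκ Sλ Sμ : Cls

ClsCond : Cls → List Col → Set
ClsCond Sα cs = OnlySimpIsLast cs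
ClsCond Sβ cs = ¬ OnlySimpIsLast cs × SecondLastSimp cs ×
  CellIn (lowerPivot cs) (ColumnR cs 0)
ClsCond Sγ cs = ¬ OnlySimpIsLast cs × SecondLastSimp cs ×
  ¬ CellIn (lowerPivot cs) (ColumnR cs 0)
ClsCond Sδ cs = ¬ OnlySimpIsLast cs × SecondLastDup cs ×
  ¬ ShareEdge (LowerR cs 1) (ColumnR cs 2) ×
  CellIn (lowerPivot cs) (UpperR cs 1)
ClsCond Sε cs = ¬ OnlySimpIsLast cs × SecondLastDup cs ×
  ¬ ShareEdge (LowerR cs 1) (ColumnR cs 2) ×
  CellIn (lowerPivot cs) (HoleR cs 1)
ClsCond Sζ cs = ¬ OnlySimpIsLast cs × SecondLastDup cs ×
  ¬ ShareEdge (UpperR cs 1) (ColumnR cs 2) ×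
  CellIn (upperPivot cs) (LowerR cs 1)
ClsCond Sη cs = ¬ OnlySimpIsLast cs × SecondLastDup cs ×
  ¬ ShareEdge (UpperR cs 1) (ColumnR cs 2) ×
  CellIn (upperPivot cs) (HoleR cs 1)
ClsCond Sθ cs = ¬ OnlySimpIsLast cs × SecondLastDup cs × BothShareThird cs ×
  ShareEdge (ColumnR cs 0) (LowerR cs 1) ×
  ShareEdge (ColumnR cs 0) (UpperR cs 1)
ClsCond Sι cs = ¬ OnlySimpIsLast cs × SecondLastDup cs × BothShareThird cs ×
  ShareEdge (ColumnR cs 0) (LowerR cs 1) ×
  ¬ ShareEdge (ColumnR cs 0) (UpperR cs 1) ×
  ¬ CellIn (lowerInnerPivot cs) (ColumnR cs 0)
ClsCond Sκ cs = ¬ OnlySimpIsLast cs × SecondLastDup cs × BothShareThird cs ×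
  ShareEdge (ColumnR cs 0) (LowerR cs 1) ×
  ¬ ShareEdge (ColumnR cs 0) (UpperR cs 1) ×
  CellIn (lowerInnerPivot cs) (ColumnR cs 0)
ClsCond Sλ cs = ¬ OnlySimpIsLast cs × SecondLastDup cs × BothShareThird cs ×
  ShareEdge (ColumnR cs 0) (UpperR cs 1) ×
  ¬ ShareEdge (ColumnR cs 0) (LowerR cs 1) ×
  ¬ CellIn (upperInnerPivot cs) (ColumnR cs 0)
ClsCond Sμ cs = ¬ OnlySimpIsLast cs × SecondLastDup cs × BothShareThird cs ×
  ShareEdge (ColumnR cs 0) (UpperR cs 1) ×
  ¬ ShareEdge (ColumnR cs 0) (LowerR cs 1) ×
  CellIn (upperInnerPivot cs) (ColumnR cs 0)

InCls : Cls → List Col → Set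
InCls X cs = InS cs × ClsCond X cs

IsCount : (List Col → Set) → ℕ → Set
IsCount Pr k = ∃[ L ] (Unique L × length L ≡ k × (∀ cs → (cs ∈ L) ⇔ Pr cs))

-- formal power series in q, t, w with integer coefficients:
-- f n h d = coefficient of q^n t^h w^d

Series : Set
Series = ℕ → ℕ → ℕ → ℤ

infixl 7 _⊛_
infixl 6 _⊕_ _⊖_
infix 4 _≐_

_≐_ : Series → Series → Set
f ≐ g = ∀ n h d → f n h d ≡ g n h d

_⊕_ _⊖_ : Series → Series → Series
(f ⊕ g) n h d = f n h d Z.+ g n h d
(f ⊖ g) n h d = f n h d Z.- g n h d

Σ≤ : ℕ → (ℕ → ℤ) → ℤ
Σ≤ zero f = f 0
Σ≤ (suc n) f = Σ≤ n f Z.+ f (suc n)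

_⊛_ : Series → Series → Series
(f ⊛ g) n h d =
  Σ≤ n λ i → Σ≤ h λ j → Σ≤ d λ k → f i j k Z.* g (n ∸ i) (h ∸ j) (d ∸ k)

one : Series
one n h d = if ⌊ n N.≟ 0 ⌋ then (if ⌊ h N.≟ 0 ⌋ then (if ⌊ d N.≟ 0 ⌋ then Z.1ℤ else Z.0ℤ) else Z.0ℤ) else Z.0ℤ

pow : Series → ℕ → Series
pow f zero = one
pow f (suc k) = f ⊛ pow f k

mono : ℕ → ℕ → ℕ → Series
mono a b c n h d =
  if ⌊ n N.≟ a ⌋ then (if ⌊ h N.≟ b ⌋ then (if ⌊ d N.≟ c ⌋ then Z.1ℤ else Z.0ℤ) else Z.0ℤ) else Z.0ℤ

invOneMinusQ : Series
invOneMinusQ n h d = if ⌊ h N.≟ 0 ⌋ then (if ⌊ d N.≟ 0 ⌋ then Z.1ℤ else Z.0ℤ) else Z.0ℤ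

invOneMinusQT : Series
invOneMinusQT n h d = if ⌊ n N.≟ h ⌋ then (if ⌊ d N.≟ 0 ⌋ then Z.1ℤ else Z.0ℤ) else Z.0ℤ

GF : (ℕ → ℕ → ℕ → ℕ) → Series
GF a n h d = + a n h d

-- A(q,qt,w):  [q^n t^h w^d] = a (n - h) h d  if h ≤ n, else 0
GFqt : (ℕ → ℕ → ℕ → ℕ) → Series
GFqt a n h d = if ⌊ h N.≤? n ⌋ then + a (n ∸ h) h d else Z.0ℤ

qwSeries : (ℕ → ℕ → ℤ) → Series
qwSeries g n h d = if ⌊ h N.≟ 0 ⌋ then g n d else Z.0ℤ

-- A_1 = A(q,1,w):  [q^n w^d] = Σ_h a n h d   (h ranges over 0..n since
-- the last column has at most area-many cells)
GF₁ : (ℕ → ℕ → ℕ → ℕ) → Series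
GF₁ a = qwSeries λ n d → Σ≤ n λ j → + a n j d

-- B_1 = ∂_t [A/t] at t = 1:  [q^n w^d] = Σ_h (h - 1) a n h d
GFB₁ : (ℕ → ℕ → ℕ → ℕ) → Series
GFB₁ a = qwSeries λ n d → Σ≤ n λ j → (+ j Z.- Z.1ℤ) Z.* + a n j d

-- C_1 = ½ ∂²_t [A/t] at t = 1:  [q^n w^d] = Σ_h ((h-1)(h-2)/2) a n h d
GFC₁ : (ℕ → ℕ → ℕ → ℕ) → Series
GFC₁ a = qwSeries λ n d →
  Σ≤ n λ j → (((+ j Z.- Z.1ℤ) Z.* (+ j Z.- + 2)) Z./ℕ 2) Z.* + a n j d

{-# OPTIONS --safe #-}

-- Each class is obtained by appending one simplex column, or a duplex and a
-- simplex column, to a smaller element of S with last column [b′, t′].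
-- Connectedness of the result depends only on which of the four parts (the
-- column [b′, t′], the two components of the duplex column, the last column)
-- meet, so each class becomes a system of inequalities between the ends of
-- these intervals.  The systems for β, γ, δ and ι are solved freely by natural
-- numbers, which gives the product formulas.  The formulas with signs come from
-- disjoint unions that are free in this sense: η together with the configurations
-- whose hole covers [b′, t′] (an A₁ term, the latter being the A(qt) term), θ ∪ η
-- (a B₁ term) and κ ∪ θ (a C₁ term).  The classes ζ, ε, λ, μ follow from
-- δ, η, ι, κ by reflecting the two new columns in the midline of [b′, t′].

module Submission where

open import Defs
open import Data.Nat as N using (ℕ; zero; suc; _∸_; z≤n; s≤s)
import Data.Nat.Properties as NP
import Data.Nat.DivMod as ND
import Data.Nat.Tactic.RingSolver as NS
open import Data.Integer as Z using (ℤ; +_)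
import Data.Integer.Properties as ZP
import Data.Integer.Tactic.RingSolver as ZS
open import Data.Bool using (Bool; true; false)
open import Data.List using (List; []; _∷_; _++_; map; length; reverse; cartesianProduct; upTo)
open import Data.List.Properties using (length-map; length-++; length-upTo; length-reverse; ++-assoc; ∷-injective; reverse-++; reverse-map; reverse-involutive; unfold-reverse)
open import Data.List.Relation.Unary.All using (All; []; _∷_)
import Data.List.Relation.Unary.All as All
import Data.List.Relation.Unary.All.Properties as AllP
open import Data.List.Relation.Unary.AllPairs using ([]; _∷_)
open import Data.List.Relation.Unary.Any using (here; there)
open import Data.List.Relation.Unary.Unique.Propositional using (Unique)
import Data.List.Relation.Unary.Unique.Propositional.Properties as Uniq
open import Data.List.Membership.Propositional using (_∈_)
open import Data.List.Membership.Propositional.Properties using (∈-map⁺; ∈-map⁻; ∈-++⁺ˡ; ∈-++⁺ʳ; ∈-++⁻; ∈-cartesianProduct⁺; ∈-cartesianProduct⁻; ∈-upTo⁺; ∈-upTo⁻)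
open import Data.List.Membership.Propositional.Properties.WithK using (unique∧set⇒bag)
open import Data.List.Relation.Binary.BagAndSetEquality using (∼bag⇒↭)
open import Data.List.Relation.Binary.Permutation.Propositional.Properties using (↭-length)
open import Data.Maybe using (just)
open import Data.Maybe.Properties using (just-injective)
open import Data.Product using (_×_; _,_; proj₁; proj₂; ∃-syntax)
open import Data.Sum using (_⊎_; inj₁; inj₂; [_,_]′)
open import Data.Unit using (⊤; tt)
open import Data.Empty using (⊥; ⊥-elim)
open import Function using (_∘_; id)
open import Function.Bundles using (_⇔_; mk⇔; Equivalence)
open import Relation.Nullary using (¬_; yes; no)
open import Relation.Binary.PropositionalEquality using (_≡_; refl; sym; trans; cong; cong₂; subst; subst₂; module ≡-Reasoning)

open Equivalence using (to; from)

-- Counting finite predicates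

-- Apart from a final subtraction no power series is manipulated: a series is the counting function
-- of a weighted class, a product of series is a product of classes, and two series agree because
-- they count the same objects. The substitutions in A become marks on the column [b′, t′], of
-- height h, to which new columns are attached. A₁ forgets h. B₁ weights by h - 1, the choice of a
-- row other than one fixed end. C₁ weights by (h - 1 choose 2), the choice of two non-adjacent
-- rows, the ends t₁ and b₂ of a hole. A(qt) adds h to area and height, since a last column spanning
-- a hole that covers [b′, t′] is longer by h. A mark carries no weight, which is the obstacle in η:
-- there t′ - t₁ is bounded by h and also enters the height of the last column. Dropping the bound
-- turns it into a free parameter. Each monomial is the smallest extension of its kind; 1/(1 - q) is
-- a parameter lengthening a component of the duplex column, 1/(1 - qt) one lengthening the last
-- column. Removing the new columns keeps connectedness because the exposed column is an interval: a
-- detour through the removed part can be replaced by a vertical walk.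

record Count {T : Set} (P : T → Set) (z : ℤ) : Set where
  constructor count
  field
    elements : List T
    unique   : Unique elements
    size≡    : + length elements ≡ z
    sound    : ∀ {x} → x ∈ elements → P x
    complete : ∀ {x} → P x → x ∈ elements

IsCount⇒Count : ∀ {P : List Col → Set} {k} → IsCount P k → Count P (+ k)
IsCount⇒Count (L , u , refl , e) =
  count L u refl (λ {x} → Equivalence.to (e x)) (λ {x} → Equivalence.from (e x))

module _ {T : Set} {P : T → Set} where

  count-≡ : ∀ {z z′} → z ≡ z′ → Count P z → Count P z′
  count-≡ refl c = c

  count-cong : ∀ {Q : T → Set} {z} → (∀ {x} → P x → Q x) → (∀ {x} → Q x → P x) → Count P z → Count Q z
  count-cong to from (count L u s so co) = count L u s (to ∘ so) (co ∘ from)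

  -- Duplicate-free lists with the same members are permutations of each other. Every identity of
  -- the theorem is reduced to this: one set counted twice.
  count-unique : ∀ {z z′} → Count P z → Count P z′ → z ≡ z′
  count-unique (count L u s so co) (count L′ u′ s′ so′ co′) =
    trans (sym s) (trans (cong +_ (↭-length (∼bag⇒↭ (unique∧set⇒bag u u′ (mk⇔ (co′ ∘ so) (co ∘ so′)))))) s′)

  count-∅ : (∀ {x} → ¬ P x) → Count P Z.0ℤ
  count-∅ e = count [] [] refl (λ ()) (λ p → ⊥-elim (e p))

  count-∅⁻ : ∀ {z} → (∀ {x} → ¬ P x) → Count P z → z ≡ Z.0ℤ
  count-∅⁻ e c = count-unique c (count-∅ e)

  count-[] : ∀ a → P a → (∀ {x} → P x → x ≡ a) → Count P Z.1ℤ
  count-[] a p only = count (a ∷ []) ([] ∷ []) refl (λ { (here refl) → p }) (here ∘ only)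

  count-⊎ : ∀ {Q : T → Set} {z z′} → (∀ {x} → P x → Q x → ⊥) →
            Count P z → Count Q z′ → Count (λ x → P x ⊎ Q x) (z Z.+ z′)
  count-⊎ disj (count L u refl so co) (count L′ u′ refl so′ co′) =
    count (L ++ L′) (Uniq.++⁺ u u′ (λ (p , q) → disj (so p) (so′ q))) (cong +_ (length-++ L))
      ([ inj₁ ∘ so , inj₂ ∘ so′ ]′ ∘ ∈-++⁻ L)
      [ ∈-++⁺ˡ ∘ co , ∈-++⁺ʳ L ∘ co′ ]′

  -- Injectivity is asked only on objects satisfying `P`, so the distinctness of the images has to
  -- carry membership along the list.
  count-map : ∀ {U : Set} {Q : U → Set} {z} (f : T → U) →
              (∀ {x} → P x → Q (f x)) →
              (∀ {x y} → P x → P y → f x ≡ f y → x ≡ y) →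
              (∀ {y} → Q y → ∃[ x ] (P x × f x ≡ y)) →
              Count P z → Count Q z
  count-map {Q = Q} f valid inj surj (count L u refl so co) =
    count (map f L) (unique-map L so u) (cong +_ (length-map f L)) sound′ complete′
    where
    unique-map : ∀ xs → (∀ {x} → x ∈ xs → P x) → Unique xs → Unique (map f xs)
    unique-map [] _ _ = []
    unique-map (x ∷ xs) ok (x∉ ∷ uxs) =
      AllP.map⁺ (All.tabulate λ {y} y∈ e → All.lookup x∉ y∈ (inj (ok (here refl)) (ok (there y∈)) e))
      ∷ unique-map xs (ok ∘ there) uxs
    sound′ : ∀ {y} → y ∈ map f L → Q y
    sound′ m with ∈-map⁻ f m
    ... | _ , x∈ , refl = valid (so x∈)
    complete′ : ∀ {y} → Q y → y ∈ map f L
    complete′ q with surj q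
    ... | _ , p , refl = ∈-map⁺ f (co p)

length-cartesianProduct : ∀ {A B : Set} (xs : List A) (ys : List B) →
                          length (cartesianProduct xs ys) ≡ length xs N.* length ys
length-cartesianProduct [] ys = refl
length-cartesianProduct (x ∷ xs) ys =
  trans (length-++ (map (x ,_) ys))
        (cong₂ N._+_ (length-map (x ,_) ys) (length-cartesianProduct xs ys))

count-× : ∀ {T U : Set} {P : T → Set} {Q : U → Set} {z z′} → Count P z → Count Q z′ →
          Count (λ ((x , y) : T × U) → P x × Q y) (z Z.* z′)
count-× (count L u refl so co) (count L′ u′ refl so′ co′) =
  count (cartesianProduct L L′) (Uniq.cartesianProduct⁺ u u′)
    (trans (cong +_ (length-cartesianProduct L L′)) (ZP.pos-* (length L) (length L′)))
    (λ m → let p , q = ∈-cartesianProduct⁻ L L′ m in so p , so′ q)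
    (λ (p , q) → ∈-cartesianProduct⁺ (co p) (co′ q))

count-< : ∀ n → Count (N._< n) (+ n)
count-< n = count (upTo n) (Uniq.upTo⁺ n) (cong +_ (length-upTo n)) ∈-upTo⁻ ∈-upTo⁺

-- The hypothesis `det` says that an object determines its index, which makes the union over the
-- indices disjoint.
count-Σ≤ : ∀ {T : Set} (P : ℕ → T → Set) (z : ℕ → ℤ) n →
           (∀ {i j x} → P i x → P j x → i ≡ j) → (∀ i → Count (P i) (z i)) →
           Count (λ x → ∃[ i ] (i N.≤ n × P i x)) (Σ≤ n z)
count-Σ≤ P z zero det c = count-cong (λ p → 0 , z≤n , p) (λ { (_ , z≤n , p) → p }) (c 0)
count-Σ≤ P z (suc n) det c =
  count-cong
    (λ { (inj₁ (i , i≤n , p)) → i , NP.m≤n⇒m≤1+n i≤n , p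
       ; (inj₂ p) → suc n , NP.≤-refl , p })
    (λ (i , i≤ , p) → split i i≤ p)
    (count-⊎ (λ (i , i≤n , p) q → NP.<⇒≢ (s≤s i≤n) (det p q)) (count-Σ≤ P z n det c) (c (suc n)))
  where
  split : ∀ {x} i → i N.≤ suc n → P i x → (∃[ i ] (i N.≤ n × P i x)) ⊎ P (suc n) x
  split i i≤ p with NP.m≤n⇒m<n∨m≡n i≤
  ... | inj₁ (s≤s i≤n) = inj₁ (i , i≤n , p)
  ... | inj₂ refl = inj₂ p

-- Weighted classes and their generating functions

record Class : Set₁ where
  field
    Obj      : Set
    Valid    : Obj → Set
    wq wt ww : Obj → ℕ

  OfWeight : ℕ → ℕ → ℕ → Obj → Set
  OfWeight n h d x = Valid x × wq x ≡ n × wt x ≡ h × ww x ≡ d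


open Class

infix 3 _⊨_
_⊨_ : Class → Series → Set
C ⊨ f = ∀ n h d → Count (OfWeight C n h d) (f n h d)

⊨-unique : ∀ {C f g} → C ⊨ f → C ⊨ g → f ≐ g
⊨-unique cf cg n h d = count-unique (cf n h d) (cg n h d)

infixl 7 _⊗_
_⊗_ : Class → Class → Class
C ⊗ D = record
  { Obj   = Obj C × Obj D
  ; Valid = λ (x , y) → Valid C x × Valid D y
  ; wq    = λ (x , y) → wq C x N.+ wq D y
  ; wt    = λ (x , y) → wt C x N.+ wt D y
  ; ww    = λ (x , y) → ww C x N.+ ww D y
  }

+-split : ∀ {a b n} → a N.+ b ≡ n → a N.≤ n × b ≡ n ∸ a
+-split {a} {b} refl = NP.m≤m+n a b , sym (NP.m+n∸m≡n a b)

+-merge : ∀ {a b n i} → i N.≤ n → a ≡ i → b ≡ n ∸ i → a N.+ b ≡ n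
+-merge i≤n refl refl = NP.m+[n∸m]≡n i≤n

-- The triple convolution sum is a disjoint union over the weights of the first component; the
-- weights of the second are then forced by subtraction.
⊗-⊨ : ∀ {C D f g} → C ⊨ f → D ⊨ g → C ⊗ D ⊨ f ⊛ g
⊗-⊨ {C} {D} cf dg n h d =
  count-cong
    (λ { (i , i≤ , j , j≤ , k , k≤ , (v , a , b , c) , (v′ , a′ , b′ , c′)) →
         (v , v′) , +-merge i≤ a a′ , +-merge j≤ b b′ , +-merge k≤ c c′ })
    (λ { ((v , v′) , a , b , c) →
         let i≤ , a′ = +-split a ; j≤ , b′ = +-split b ; k≤ , c′ = +-split c in
         _ , i≤ , _ , j≤ , _ , k≤ , (v , refl , refl , refl) , (v′ , a′ , b′ , c′) })
    (count-Σ≤ _ _ n (λ { (_ , _ , _ , _ , (_ , a , _) , _) (_ , _ , _ , _ , (_ , a′ , _) , _) → trans (sym a) a′ }) λ i →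
     count-Σ≤ _ _ h (λ { (_ , _ , (_ , _ , b , _) , _) (_ , _ , (_ , _ , b′ , _) , _) → trans (sym b) b′ }) λ j →
     count-Σ≤ _ _ d (λ { ((_ , _ , _ , c) , _) ((_ , _ , _ , c′) , _) → trans (sym c) c′ }) λ k →
     count-× (cf i j k) (dg (n ∸ i) (h ∸ j) (d ∸ k)))

monoC : ℕ → ℕ → ℕ → Class
monoC a b c = record
  { Obj = ⊤ ; Valid = λ _ → ⊤ ; wq = λ _ → a ; wt = λ _ → b ; ww = λ _ → c }

mono-⊨ : ∀ a b c → monoC a b c ⊨ mono a b c
mono-⊨ a b c n h d with n N.≟ a | h N.≟ b | d N.≟ c
... | yes refl | yes refl | yes refl = count-[] tt (tt , refl , refl , refl) (λ _ → refl)
... | yes _ | yes _ | no ne = count-∅ λ (_ , _ , _ , e) → ne (sym e)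
... | yes _ | no ne | _ = count-∅ λ (_ , _ , e , _) → ne (sym e)
... | no ne | _ | _ = count-∅ λ (_ , e , _ , _) → ne (sym e)

-- Free natural parameters: `QC` counts cells added outside the last column, `QTC` cells added to
-- the last column, which raise area and height alike.
QC QTC : Class
QC = record { Obj = ℕ ; Valid = λ _ → ⊤ ; wq = id ; wt = λ _ → 0 ; ww = λ _ → 0 }
QTC = record { Obj = ℕ ; Valid = λ _ → ⊤ ; wq = id ; wt = id ; ww = λ _ → 0 }

Q-⊨ : QC ⊨ invOneMinusQ
Q-⊨ n h d with h N.≟ 0 | d N.≟ 0
... | yes refl | yes refl = count-[] n (tt , refl , refl , refl) (λ (_ , e , _) → e)
... | yes _ | no ne = count-∅ λ (_ , _ , _ , e) → ne (sym e)
... | no ne | _ = count-∅ λ (_ , _ , e , _) → ne (sym e)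

QT-⊨ : QTC ⊨ invOneMinusQT
QT-⊨ n h d with n N.≟ h | d N.≟ 0
... | yes refl | yes refl = count-[] n (tt , refl , refl , refl) (λ (_ , e , _) → e)
... | yes _ | no ne = count-∅ λ (_ , _ , _ , e) → ne (sym e)
... | no ne | _ = count-∅ λ (_ , e , e′ , _) → ne (trans (sym e) e′)

-- Nested pairs closed by a unit, following the unfolding of `pow`. The closing unit is the trailing
-- `_` of later patterns and the `+ 0` of later sums.
powC : Class → ℕ → Class
powC C zero = monoC 0 0 0
powC C (suc k) = C ⊗ powC C k

pow-⊨ : ∀ {C f} → C ⊨ f → ∀ k → powC C k ⊨ pow f k
pow-⊨ cf zero = mono-⊨ 0 0 0
pow-⊨ cf (suc k) = ⊗-⊨ cf (pow-⊨ cf k)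

-- Area and height of the last column; the series A₁, B₁, C₁ and A(qt) as marked classes

reverse-≡⇒ : ∀ {A : Set} {cs rs : List A} {c} → reverse cs ≡ c ∷ rs → cs ≡ reverse rs ++ c ∷ []
reverse-≡⇒ {cs = cs} {rs} {c} e =
  trans (sym (reverse-involutive cs)) (trans (cong reverse e) (unfold-reverse c rs))

area-++ : ∀ xs ys → area (xs ++ ys) ≡ area xs N.+ area ys
area-++ [] ys = refl
area-++ (x ∷ xs) ys = trans (cong (size x N.+_) (area-++ xs ys)) (sym (NP.+-assoc (size x) (area xs) (area ys)))

-- This is why the sums over heights in A₁, B₁ and C₁ lose nothing by stopping at the area.
lastHeight≤area : ∀ cs → lastHeight cs N.≤ area cs
lastHeight≤area cs with reverse cs in e
... | [] = z≤n
... | c ∷ rs rewrite reverse-≡⇒ {cs = cs} e | area-++ (reverse rs) (c ∷ []) | NP.+-identityʳ (size c) =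
  NP.m≤n+m (size c) (area (reverse rs))

1≤lastHeight : ∀ {cs} → HeadSimp (reverse cs) → 1 N.≤ lastHeight cs
1≤lastHeight {cs} s with reverse cs
... | simp _ _ ∷ _ = s≤s z≤n

Σ≤-cong : ∀ {f g : ℕ → ℤ} n → (∀ i → f i ≡ g i) → Σ≤ n f ≡ Σ≤ n g
Σ≤-cong zero e = e 0
Σ≤-cong (suc n) e = cong₂ Z._+_ (Σ≤-cong n e) (e (suc n))

-- Objects of S carrying a mark w whose range depends on the height of the
-- last column; with φ = id the substitution t ↦ qt is performed, with φ = 0
-- the substitution t ↦ 1.
markedC : (W : Set) → (ℕ → W → Set) → (ℕ → ℕ) → Class
markedC W VW φ = record
  { Obj   = List Col × W
  ; Valid = λ (cs , w) → InS cs × VW (lastHeight cs) w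
  ; wq    = λ (cs , w) → area cs N.+ φ (lastHeight cs)
  ; wt    = λ (cs , w) → φ (lastHeight cs)
  ; ww    = λ (cs , w) → numDup cs
  }

Unmarked : ℕ → ⊤ → Set
Unmarked _ _ = ⊤

-- There are `k - 1` marks, the weight in B₁. The mark is an offset from b′: it places the new
-- column in γ and the top t₁ of the lower component in θ ∪ η.
Marked : ℕ → ℕ → Set
Marked k u = suc u N.< k

-- There are (k - 1 choose 2) such pairs, the weight in C₁. They stand for holes with t₁ = b′ + u
-- and b₂ = b′ + v + 1; the shift of v by one turns u < v into the condition that the hole is
-- non-empty.
MarkedPair : ℕ → ℕ × ℕ → Set
MarkedPair k (u , v) = u N.< v × suc v N.< k

-- The binomial coefficient (m choose 2), by a recursion matching the count of pairs by their larger
-- element.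
triangle : ℕ → ℕ
triangle zero = 0
triangle (suc m) = triangle m N.+ m

triangle-*2 : ∀ m → suc m N.* m ≡ triangle (suc m) N.* 2
triangle-*2 zero = refl
triangle-*2 (suc m) = begin
  suc (suc m) N.* suc m                 ≡⟨ expand m ⟩
  suc m N.* m N.+ suc m N.* 2           ≡⟨ cong (N._+ suc m N.* 2) (triangle-*2 m) ⟩
  triangle (suc m) N.* 2 N.+ suc m N.* 2 ≡⟨ NP.*-distribʳ-+ 2 (triangle (suc m)) (suc m) ⟨
  (triangle (suc m) N.+ suc m) N.* 2    ∎
  where
  open ≡-Reasoning
  expand : ∀ m → suc (suc m) N.* suc m ≡ suc m N.* m N.+ suc m N.* 2
  expand = NS.solve-∀

binomial≡triangle : ∀ m → ((+ suc m Z.- Z.1ℤ) Z.* (+ suc m Z.- + 2)) Z./ℕ 2 ≡ + triangle m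
binomial≡triangle zero = refl
binomial≡triangle (suc m) = begin
  (+ suc m Z.* + m) Z./ℕ 2       ≡⟨ cong (Z._/ℕ 2) (ZP.pos-* (suc m) m) ⟨
  + ((suc m N.* m) N./ 2)        ≡⟨ cong (λ x → + (x N./ 2)) (triangle-*2 m) ⟩
  + ((triangle (suc m) N.* 2) N./ 2) ≡⟨ cong +_ (ND.m*n/n≡m (triangle (suc m)) 2) ⟩
  + triangle (suc m)             ∎
  where open ≡-Reasoning

count-pairs : ∀ m → Count (λ ((u , v) : ℕ × ℕ) → u N.< v × v N.< m) (+ triangle m)
count-pairs zero = count-∅ λ ()
count-pairs (suc m) =
  count-cong
    (λ { {_ , _} (inj₁ (u<v , v<m)) → u<v , NP.m≤n⇒m≤1+n v<m
       ; {_ , _} (inj₂ (u<m , refl)) → u<m , NP.n<1+n m })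
    split
    (count-⊎ (λ { {_ , _} (_ , v<m) (_ , refl) → NP.n≮n _ v<m })
      (count-pairs m)
      (count-≡ (ZP.*-identityʳ (+ m)) (count-× (count-< m) (count-[] {P = _≡ m} m refl id))))
  where
  split : ∀ {p : ℕ × ℕ} → proj₁ p N.< proj₂ p × proj₂ p N.< suc m →
          (proj₁ p N.< proj₂ p × proj₂ p N.< m) ⊎ (proj₁ p N.< m × proj₂ p ≡ m)
  split {_ , _} (u<v , s≤s v≤m) with NP.m≤n⇒m<n∨m≡n v≤m
  ... | inj₁ v<m = inj₁ (u<v , v<m)
  ... | inj₂ refl = inj₂ (u<v , refl)

module _ {a : ℕ → ℕ → ℕ → ℕ} (HA : ∀ n h d → IsCount (λ cs → InS cs × Stats cs n h d) (a n h d)) where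

  a-0 : ∀ n d → + a n 0 d ≡ Z.0ℤ
  a-0 n d = count-∅⁻ (λ { {cs} ((_ , s) , _ , e , _) → NP.<⇒≢ (1≤lastHeight {cs} s) (sym e) })
              (IsCount⇒Count (HA n 0 d))

  marked-⊨ : ∀ {W VW} (c : ℕ → ℤ) → (∀ j → Count (VW (suc j)) (c (suc j))) →
             markedC W VW (λ _ → 0) ⊨ qwSeries λ n d → Σ≤ n λ j → c j Z.* + a n j d
  marked-⊨ {W} {VW} c cnt n h d with h N.≟ 0
  ... | no ne = count-∅ λ (_ , _ , e , _) → ne (sym e)
  ... | yes refl =
    count-cong
      (λ { {cs , w} (j , j≤ , (s , e , refl , e′) , v) →
           (s , v) , trans (NP.+-identityʳ (area cs)) e , refl , e′ })
      (λ { {cs , w} ((s , v) , e , _ , e′) →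
           let e″ = trans (sym (NP.+-identityʳ (area cs))) e in
           lastHeight cs , subst (lastHeight cs N.≤_) e″ (lastHeight≤area cs) , (s , e″ , refl , e′) , v })
      (count-Σ≤ (λ j (cs , w) → (InS cs × Stats cs n j d) × VW j w) _ n
        (λ { ((_ , _ , e , _) , _) ((_ , _ , e′ , _) , _) → trans (sym e) e′ }) level)
    where
    level : ∀ j → Count (λ (cs , w) → (InS cs × Stats cs n j d) × VW j w) (c j Z.* + a n j d)
    -- At height 0 the integer weight counts no marks: it is -1 in B₁ and 1 in C₁. It is harmless
    -- because no element of S has an empty last column.
    level zero =
      count-≡ (sym (trans (cong (c 0 Z.*_) (a-0 n d)) (ZP.*-zeroʳ (c 0))))
        (count-∅ λ { {cs , _} (((_ , s) , _ , e , _) , _) → NP.<⇒≢ (1≤lastHeight {cs} s) (sym e) })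
    level (suc j) =
      count-≡ (ZP.*-comm (+ a n (suc j) d) (c (suc j))) (count-× (IsCount⇒Count (HA n (suc j) d)) (cnt j))

  qwSeries-cong : ∀ {f g : ℕ → ℕ → ℤ} → (∀ n d → f n d ≡ g n d) → qwSeries f ≐ qwSeries g
  qwSeries-cong e n h d with h N.≟ 0
  ... | yes _ = e n d
  ... | no _ = refl

  GF₁-⊨ : markedC ⊤ Unmarked (λ _ → 0) ⊨ GF₁ a
  GF₁-⊨ n h d = count-≡ (qwSeries-cong (λ n d → Σ≤-cong n λ j → ZP.*-identityˡ (+ a n j d)) n h d)
    (marked-⊨ (λ _ → Z.1ℤ) (λ _ → count-[] tt tt (λ _ → refl)) n h d)

  GFB₁-⊨ : markedC ℕ Marked (λ _ → 0) ⊨ GFB₁ a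
  GFB₁-⊨ = marked-⊨ {VW = Marked} (λ j → + j Z.- Z.1ℤ)
    (λ j → count-cong s≤s (λ { (s≤s p) → p }) (count-< j))

  GFC₁-⊨ : markedC (ℕ × ℕ) MarkedPair (λ _ → 0) ⊨ GFC₁ a
  GFC₁-⊨ = marked-⊨ {VW = MarkedPair} (λ j → ((+ j Z.- Z.1ℤ) Z.* (+ j Z.- + 2)) Z./ℕ 2)
    (λ j → count-≡ (sym (binomial≡triangle j))
      (count-cong (λ (p , q) → p , s≤s q) (λ { (p , s≤s q) → p , q }) (count-pairs j)))

  -- The q-weight is area plus height, so weight n at height h means area n - h; for h > n there is
  -- no object and the guard of `GFqt` gives 0.
  GFqt-⊨ : markedC ⊤ Unmarked id ⊨ GFqt a
  GFqt-⊨ n h d with h N.≤? n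
  ... | no h≰n = count-∅ λ { {cs , _} (_ , refl , refl , _) → h≰n (NP.m≤n+m (lastHeight cs) (area cs)) }
  ... | yes h≤n = count-map (_, tt)
    (λ { {cs} (s , e , e′ , e″) → (s , tt) , trans (cong₂ N._+_ e e′) (NP.m∸n+n≡m h≤n) , e′ , e″ })
    (λ { _ _ refl → refl })
    (λ { {cs , tt} ((s , _) , refl , refl , e) →
         cs , (s , sym (NP.m+n∸n≡m (area cs) (lastHeight cs)) , refl , e) , refl })
    (IsCount⇒Count (HA (n ∸ h) h d))

-- Paths

adj-sym : ∀ {c c′} → Adj c c′ → Adj c′ c
adj-sym (inj₁ (refl , inj₁ e)) = inj₁ (refl , inj₂ e)
adj-sym (inj₁ (refl , inj₂ e)) = inj₁ (refl , inj₁ e)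
adj-sym (inj₂ (refl , inj₁ e)) = inj₂ (refl , inj₂ e)
adj-sym (inj₂ (refl , inj₂ e)) = inj₂ (refl , inj₁ e)

module _ {cs : List Col} where

  path-head : ∀ {c c′} → Path cs c c′ → InP cs c
  path-head (here i) = i
  path-head (step i _ _) = i

  path-trans : ∀ {c c′ c″} → Path cs c c′ → Path cs c′ c″ → Path cs c c″
  path-trans (here _) q = q
  path-trans (step i a p) q = step i a (path-trans p q)

  path-sym : ∀ {c c′} → Path cs c c′ → Path cs c′ c
  path-sym (here i) = here i
  path-sym (step i a p) = path-trans (path-sym p) (step (path-head p) (adj-sym a) (here i))

  connected-via : ∀ o → (∀ c → InP cs c → Path cs c o) → Connected cs
  connected-via o r c c′ i i′ = path-trans (r c i) (path-sym (r c′ i′))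

path-map : ∀ {cs cs′ c c′} → (∀ {c} → InP cs c → InP cs′ c) → Path cs c c′ → Path cs′ c c′
path-map f (here i) = here (f i)
path-map f (step i a p) = step (f i) a (path-map f p)

-- Intervals, their overlaps and vertical walks

infix 4 _∈[_,_]
_∈[_,_] : ℤ → ℤ → ℤ → Set
y ∈[ b , t ] = b Z.≤ y × y Z.≤ t

Overlap : ℤ → ℤ → ℤ → ℤ → Set
Overlap b t b′ t′ = ∃[ y ] (y ∈[ b , t ] × y ∈[ b′ , t′ ])

overlap-sym : ∀ {b t b′ t′} → Overlap b t b′ t′ → Overlap b′ t′ b t
overlap-sym (y , p , q) = y , q , p

overlap⇒ : ∀ {b t b′ t′} → Overlap b t b′ t′ → b Z.≤ t′ × b′ Z.≤ t
overlap⇒ (y , (p , q) , (p′ , q′)) = ZP.≤-trans p q′ , ZP.≤-trans p′ q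

⇒overlap : ∀ {b t b′ t′} → b Z.≤ t → b′ Z.≤ t′ → b Z.≤ t′ → b′ Z.≤ t → Overlap b t b′ t′
⇒overlap {b} {t} {b′} {t′} v v′ p q with ZP.≤-total b b′
... | inj₁ b≤b′ = b′ , (b≤b′ , q) , (ZP.≤-refl , v′)
... | inj₂ b′≤b = b , (ZP.≤-refl , v) , (b′≤b , p)

Segment : List Col → ℕ → ℤ → ℤ → Set
Segment cs x b t = ∀ {y} → y ∈[ b , t ] → InP cs (x , y)

Reaches : List Col → Cell → ℕ → ℤ → ℤ → Set
Reaches cs o x b t = ∀ {y} → y ∈[ b , t ] → Path cs (x , y) o

x≤x+n : ∀ y n → y Z.≤ y Z.+ + n
x≤x+n y n = ZP.i≤i+j y (+ n)

≤⇒∃+ : ∀ {x y} → x Z.≤ y → ∃[ n ] y ≡ x Z.+ + n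
≤⇒∃+ {x} {y} x≤y = Z.∣ y Z.- x ∣ , sym (begin
  x Z.+ + Z.∣ y Z.- x ∣ ≡⟨ cong (λ z → x Z.+ z) (ZP.0≤i⇒+∣i∣≡i (ZP.i≤j⇒0≤j-i x≤y)) ⟩
  x Z.+ (y Z.- x)       ≡⟨ cancel x y ⟩
  y                     ∎)
  where
  open ≡-Reasoning
  cancel : ∀ x y → x Z.+ (y Z.- x) ≡ y
  cancel = ZS.solve-∀

module _ {cs : List Col} {x : ℕ} {b t : ℤ} (seg : Segment cs x b t) where

  climb : ∀ n y → b Z.≤ y → y Z.+ + n Z.≤ t → Path cs (x , y) (x , y Z.+ + n)
  climb zero y b≤y y≤t rewrite ZP.+-identityʳ y = here (seg (b≤y , y≤t))
  climb (suc n) y b≤y y≤t =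
    step (seg (b≤y , ZP.≤-trans (x≤x+n y (suc n)) y≤t)) (inj₁ (refl , inj₁ refl))
      (subst (λ z → Path cs (x , y Z.+ Z.1ℤ) (x , z)) assoc
        (climb n (y Z.+ Z.1ℤ) (ZP.≤-trans b≤y (x≤x+n y 1)) (subst (Z._≤ t) (sym assoc) y≤t)))
    where
    assoc : y Z.+ Z.1ℤ Z.+ + n ≡ y Z.+ + suc n
    assoc = ZP.+-assoc y Z.1ℤ (+ n)

  vertical : ∀ {y y′} → y ∈[ b , t ] → y′ ∈[ b , t ] → Path cs (x , y) (x , y′)
  vertical {y} {y′} (b≤y , y≤t) (b≤y′ , y′≤t) with ZP.≤-total y y′
  ... | inj₁ y≤y′ with n , refl ← ≤⇒∃+ y≤y′ = climb n y b≤y y′≤t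
  ... | inj₂ y′≤y with n , refl ← ≤⇒∃+ y′≤y = path-sym (climb n y′ b≤y′ y≤t)

  reaches-adjacent : ∀ {o x′ b′ t′} → x ≡ suc x′ ⊎ x′ ≡ suc x →
                     Overlap b t b′ t′ → Reaches cs o x′ b′ t′ → Reaches cs o x b t
  reaches-adjacent {o} {x′} adj (y , i , i′) r j =
    path-trans (vertical j i) (step (seg i) (inj₂ (refl , [ inj₂ , inj₁ ]′ adj)) (r i′))

-- Columns of concatenated lists

colAt-++ˡ : ∀ xs {ys i c} → colAt xs i ≡ just c → colAt (xs ++ ys) i ≡ just c
colAt-++ˡ (x ∷ xs) {i = zero} e = e
colAt-++ˡ (x ∷ xs) {i = suc i} e = colAt-++ˡ xs e

colAt-length : ∀ xs {c ys} → colAt (xs ++ c ∷ ys) (length xs) ≡ just c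
colAt-length [] = refl
colAt-length (x ∷ xs) = colAt-length xs

colAt-suc-length : ∀ xs {c c′ ys} → colAt (xs ++ c ∷ c′ ∷ ys) (suc (length xs)) ≡ just c′
colAt-suc-length [] = refl
colAt-suc-length (x ∷ xs) = colAt-suc-length xs

colAt-< : ∀ xs {i c} → colAt xs i ≡ just c → i N.< length xs
colAt-< (x ∷ xs) {zero} e = s≤s z≤n
colAt-< (x ∷ xs) {suc i} e = s≤s (colAt-< xs e)

colAt-++⁻ : ∀ xs {ys i c} → colAt (xs ++ ys) i ≡ just c →
            colAt xs i ≡ just c ⊎ ∃[ j ] (i ≡ length xs N.+ j × colAt ys j ≡ just c)
colAt-++⁻ [] {i = i} e = inj₂ (i , refl , e)
colAt-++⁻ (x ∷ xs) {i = zero} e = inj₁ e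
colAt-++⁻ (x ∷ xs) {i = suc i} e with colAt-++⁻ xs e
... | inj₁ e′ = inj₁ e′
... | inj₂ (j , refl , e′) = inj₂ (j , refl , e′)

InP-< : ∀ {cs x y} → InP cs (x , y) → x N.< length cs
InP-< {cs} (_ , e , _) = colAt-< cs e

InP-++ˡ : ∀ cs {ys c} → InP cs c → InP (cs ++ ys) c
InP-++ˡ cs (c , e , i) = c , colAt-++ˡ cs e , i

InP-++⁻ : ∀ cs {ys c} → InP (cs ++ ys) c → InP cs c ⊎ length cs N.≤ proj₁ c
InP-++⁻ cs (c , e , i) with colAt-++⁻ cs e
... | inj₁ e′ = inj₁ (c , e′ , i)
... | inj₂ (j , refl , _) = inj₂ (NP.m≤m+n (length cs) j)

-- Stated on the reversed list because all positions in the class conditions are counted from the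
-- right. As a record it lets `pre`, `b` and `t` be inferred from the proof, which an equation about
-- `reverse` would not.
record EndsIn (pre : List Col) (b t : ℤ) : Set where
  constructor ends-in
  field
    {others} : List Col
    reverse≡ : reverse pre ≡ simp b t ∷ others

endsIn-colAt : ∀ {pre b t} → EndsIn pre b t →
               ∃[ m ] (length pre ≡ suc m × colAt pre m ≡ just (simp b t))
endsIn-colAt {pre} {b} {t} (ends-in {rs} e) =
  length rs , trans (sym (length-reverse pre)) (cong length e) , at-m
  where
  at-m : colAt pre (length rs) ≡ just (simp b t)
  at-m rewrite reverse-≡⇒ {cs = pre} e | sym (length-reverse rs) = colAt-length (reverse rs)

module _ {pre : List Col} {b′ t′ : ℤ} (ends : EndsIn pre b′ t′) where

  private
    m = proj₁ (endsIn-colAt ends)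
    len = proj₁ (proj₂ (endsIn-colAt ends))
    at-m = proj₂ (proj₂ (endsIn-colAt ends))

  endsIn-column : ∀ {x y} → suc x ≡ length pre → InP pre (x , y) → y ∈[ b′ , t′ ]
  endsIn-column {x} sx (c , e , i) with NP.suc-injective (trans sx len)
  ... | refl with just-injective (trans (sym e) at-m)
  ... | refl = i

  endsIn-segment : ∀ {x} → suc x ≡ length pre → Segment pre x b′ t′
  endsIn-segment {x} sx i with NP.suc-injective (trans sx len)
  ... | refl = _ , at-m , i

  -- A path of the larger polyomino leaves and re-enters pre only through its
  -- last column, and that column is connected.
  retract : b′ Z.≤ t′ → ∀ {e c c″} → Path (pre ++ e) c c″ → InP pre c″ →
            (InP pre c × Path pre c c″) ⊎ (length pre N.≤ proj₁ c × Path pre (m , b′) c″)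
  retract v (here _) i″ = inj₁ (i″ , here i″)
  retract v {c = x , y} (step {c′ = x′ , y′} i a p) i″ with InP-++⁻ pre i | retract v p i″
  ... | inj₁ j | inj₁ (j′ , q) = inj₁ (j , step j a q)
  ... | inj₂ out | inj₂ (_ , q) = inj₂ (out , q)
  ... | inj₁ j | inj₂ (out , q) = inj₁ (j , path-trans (to-base a) q)
    where
    x<M = InP-< {pre} j
    to-base : Adj (x , y) (x′ , y′) → Path pre (x , y) (m , b′)
    to-base (inj₁ (refl , _)) = ⊥-elim (NP.<⇒≱ x<M out)
    to-base (inj₂ (_ , inj₂ refl)) = ⊥-elim (NP.<⇒≱ x<M (NP.m≤n⇒m≤1+n out))
    to-base (inj₂ (refl , inj₁ refl)) with NP.≤-antisym x<M out
    ... | sx with NP.suc-injective (trans sx len)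
    ... | refl = vertical (endsIn-segment sx) (endsIn-column sx j) (ZP.≤-refl , v)
  ... | inj₂ out | inj₁ (j′ , q) = inj₂ (out , path-trans (from-base a) q)
    where
    x<M = InP-< {pre} j′
    from-base : Adj (x , y) (x′ , y′) → Path pre (m , b′) (x′ , y′)
    from-base (inj₁ (refl , _)) = ⊥-elim (NP.<⇒≱ x<M out)
    from-base (inj₂ (_ , inj₁ refl)) = ⊥-elim (NP.<⇒≱ x<M (NP.m≤n⇒m≤1+n out))
    from-base (inj₂ (refl , inj₂ refl)) with NP.≤-antisym x<M out
    ... | sx with NP.suc-injective (trans sx len)
    ... | refl = vertical (endsIn-segment sx) (ZP.≤-refl , v) (endsIn-column sx j′)

  connected-++⁻ : b′ Z.≤ t′ → ∀ {e} → Connected (pre ++ e) → Connected pre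
  connected-++⁻ v conn c c″ i i″ with retract v (conn c c″ (InP-++ˡ pre {c = c} i) (InP-++ˡ pre {c = c″} i″)) i″
  ... | inj₁ (_ , q) = q
  ... | inj₂ (out , _) = ⊥-elim (NP.<⇒≱ (InP-< {pre} i) out)

  module _ {b t : ℤ} where

    private
      full = pre ++ simp b t ∷ []
      last-segment : Segment full (length pre) b t
      last-segment i = _ , colAt-length pre , i

    -- The path leaves `pre` by some step. It changes column, so it is horizontal, and its row is
    -- common to the two columns.
    crossing : ∀ {c c″} → Path full c c″ → proj₁ c N.< length pre → length pre N.≤ proj₁ c″ →
               Overlap b′ t′ b t
    crossing (here _) lt ge = ⊥-elim (NP.<⇒≱ lt ge)
    crossing {x , y} (step {c′ = x′ , y′} i a p) lt ge with x′ N.<? length pre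
    ... | yes lt′ = crossing p lt′ ge
    ... | no ge′ with a
    ... | inj₁ (refl , _) = ⊥-elim (ge′ lt)
    ... | inj₂ (_ , inj₂ refl) = ⊥-elim (ge′ (NP.<-trans (NP.n<1+n x′) lt))
    ... | inj₂ (refl , inj₁ refl) with NP.≤-antisym lt (NP.≮⇒≥ ge′)
    ... | sx with InP-++⁻ pre i | path-head p
    ... | inj₂ ge″ | _ = ⊥-elim (NP.<⇒≱ lt ge″)
    ... | inj₁ j | (c , e , i′) with just-injective (trans (sym e) (trans (cong (colAt full) sx) (colAt-length pre)))
    ... | refl = y , endsIn-column sx j , i′

    connected-∷ʳ⁻ : b′ Z.≤ t′ → b Z.≤ t → Connected full → Overlap b′ t′ b t
    connected-∷ʳ⁻ v′ v conn =
      crossing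
        (conn (m , b′) (length pre , b) (InP-++ˡ pre (endsIn-segment (sym len) (ZP.≤-refl , v′)))
              (last-segment (ZP.≤-refl , v)))
        (subst (m N.<_) (sym len) (NP.n<1+n m)) NP.≤-refl

    connected-∷ʳ⁺ : b′ Z.≤ t′ → Connected pre → Overlap b′ t′ b t → Connected full
    connected-∷ʳ⁺ v′ conn ov = connected-via (m , b′) reach
      where
      o∈ : InP pre (m , b′)
      o∈ = endsIn-segment (sym len) (ZP.≤-refl , v′)
      reach-pre : ∀ {c} → InP pre c → Path full c (m , b′)
      reach-pre i = path-map {pre} (λ {c} → InP-++ˡ pre {c = c}) (conn _ _ i o∈)
      reach : ∀ c → InP full c → Path full c (m , b′)
      reach c (col , e , i) with colAt-++⁻ pre e
      ... | inj₁ e′ = reach-pre (col , e′ , i)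
      ... | inj₂ (zero , refl , refl) rewrite NP.+-identityʳ (length pre) =
        reaches-adjacent last-segment (inj₁ len) (overlap-sym ov) (reach-pre ∘ endsIn-segment (sym len)) i

-- Appending a duplex column and a simplex column

data Part : Set where
  before lower upper last : Part

module _ (pre : List Col) (b₁ t₁ b₂ t₂ b t : ℤ) where

  private
    M = length pre
    full = pre ++ dup b₁ t₁ b₂ t₂ ∷ simp b t ∷ []

  OfPart : Part → Cell → Set
  OfPart before c = InP pre c
  OfPart lower (x , y) = x ≡ M × y ∈[ b₁ , t₁ ]
  OfPart upper (x , y) = x ≡ M × y ∈[ b₂ , t₂ ]
  OfPart last (x , y) = x ≡ suc M × y ∈[ b , t ]

  -- Phrased through cells of `pre` instead of the ends of its last column, so that it also covers
  -- an empty `pre`, the case of the duplex column in S_α.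
  Touches : ℤ → ℤ → Set
  Touches b t = ∃[ x ] ∃[ y ] (suc x ≡ M × InP pre (x , y) × y ∈[ b , t ])

  -- The two impossible pairs are the components of the duplex column, separated by the gap, and
  -- `before` with `last`, which are not in neighbouring columns. What remains is a 4-cycle.
  Link : Part → Part → Set
  Link before before = ⊤
  Link before lower = Touches b₁ t₁
  Link before upper = Touches b₂ t₂
  Link before last = ⊥
  Link lower before = Touches b₁ t₁
  Link lower lower = ⊤
  Link lower upper = ⊥
  Link lower last = Overlap b₁ t₁ b t
  Link upper before = Touches b₂ t₂
  Link upper lower = ⊥
  Link upper upper = ⊤
  Link upper last = Overlap b₂ t₂ b t
  Link last before = ⊥
  Link last lower = Overlap b₁ t₁ b t
  Link last upper = Overlap b₂ t₂ b t
  Link last last = ⊤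

  part : ∀ {c} → InP full c → ∃[ l ] OfPart l c
  part (col , e , i) with colAt-++⁻ pre e
  ... | inj₁ e′ = before , col , e′ , i
  ... | inj₂ (suc zero , refl , refl) = last , NP.+-comm M 1 , i
  part (col , e , inj₁ i) | inj₂ (zero , refl , refl) = lower , NP.+-identityʳ M , i
  part (col , e , inj₂ i) | inj₂ (zero , refl , refl) = upper , NP.+-identityʳ M , i

  lower-segment : Segment full M b₁ t₁
  lower-segment i = _ , colAt-length pre , inj₁ i

  upper-segment : Segment full M b₂ t₂
  upper-segment i = _ , colAt-length pre , inj₂ i

  last-segment : Segment full (suc M) b t
  last-segment i = _ , colAt-suc-length pre , i

  connected-⁺ : ∀ o → (∀ {c} → InP pre c → Path full c o) → Reaches full o M b₁ t₁ →
                Reaches full o M b₂ t₂ → Reaches full o (suc M) b t → Connected full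
  connected-⁺ o rb rl ru rs = connected-via o λ c i → reach (part i)
    where
    reach : ∀ {c} → ∃[ l ] OfPart l c → Path full c o
    reach (before , i) = rb i
    reach (lower , refl , i) = rl i
    reach (upper , refl , i) = ru i
    reach (last , refl , i) = rs i

  module _ (gap : t₁ Z.+ Z.1ℤ Z.< b₂) where

    t₁<b₂ : t₁ Z.< b₂
    t₁<b₂ = ZP.≤-<-trans (x≤x+n t₁ 1) gap

    private
      before-lower : ∀ {x y x′ y′ b t} → InP pre (x , y) → x′ ≡ M × y′ ∈[ b , t ] →
                     Adj (x , y) (x′ , y′) → Touches b t
      before-lower i (refl , i′) (inj₁ (refl , _)) = ⊥-elim (NP.n≮n _ (InP-< {pre} i))
      before-lower i (refl , i′) (inj₂ (refl , inj₁ e)) = _ , _ , sym e , i , i′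
      before-lower i (refl , i′) (inj₂ (refl , inj₂ refl)) =
        ⊥-elim (NP.<⇒≱ (InP-< {pre} i) (NP.n≤1+n _))

      column-last : ∀ {x y x′ y′ b′ t′} → x ≡ M × y ∈[ b′ , t′ ] → x′ ≡ suc M × y′ ∈[ b , t ] →
                    Adj (x , y) (x′ , y′) → Overlap b′ t′ b t
      column-last (refl , i) (_ , i′) (inj₂ (refl , _)) = _ , i , i′
      column-last (refl , i) (e , i′) (inj₁ (e′ , _)) = ⊥-elim (NP.1+n≢n (sym (trans e′ e)))

      before-last : ∀ {x y x′ y′} → InP pre (x , y) → x′ ≡ suc M × y′ ∈[ b , t ] →
                    ¬ Adj (x , y) (x′ , y′)
      before-last i (refl , _) (inj₁ (refl , _)) = NP.<⇒≱ (InP-< {pre} i) (NP.n≤1+n _)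
      before-last i (refl , _) (inj₂ (_ , inj₁ refl)) = NP.n≮n _ (InP-< {pre} i)
      before-last i (refl , _) (inj₂ (_ , inj₂ refl)) =
        NP.<⇒≱ (InP-< {pre} i) (NP.≤-trans (NP.n≤1+n _) (NP.n≤1+n _))

      lower-upper : ∀ {x y x′ y′} → x ≡ M × y ∈[ b₁ , t₁ ] → x′ ≡ M × y′ ∈[ b₂ , t₂ ] →
                    ¬ Adj (x , y) (x′ , y′)
      lower-upper (refl , _ , y≤t₁) (_ , b₂≤y , _) (inj₁ (_ , inj₁ refl)) =
        ZP.<⇒≱ gap (ZP.≤-trans b₂≤y (ZP.+-monoˡ-≤ Z.1ℤ y≤t₁))
      lower-upper (refl , _ , y≤t₁) (_ , b₂≤y , _) (inj₁ (_ , inj₂ refl)) =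
        ZP.<⇒≱ t₁<b₂ (ZP.≤-trans b₂≤y (ZP.≤-trans (x≤x+n _ 1) y≤t₁))
      lower-upper (refl , _) (refl , _) (inj₂ (_ , inj₁ e)) = NP.1+n≢n (sym e)
      lower-upper (refl , _) (refl , _) (inj₂ (_ , inj₂ e)) = NP.1+n≢n (sym e)

    part-adj : ∀ l l′ {c c′} → OfPart l c → OfPart l′ c′ → Adj c c′ → Link l l′
    part-adj before before i i′ a = tt
    part-adj before lower i i′ a = before-lower i i′ a
    part-adj before upper i i′ a = before-lower i i′ a
    part-adj before last i i′ a = before-last i i′ a
    part-adj lower before i i′ a = before-lower i′ i (adj-sym a)
    part-adj lower lower i i′ a = tt
    part-adj lower upper i i′ a = lower-upper i i′ a
    part-adj lower last i i′ a = column-last i i′ a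
    part-adj upper before i i′ a = before-lower i′ i (adj-sym a)
    part-adj upper lower i i′ a = lower-upper i′ i (adj-sym a)
    part-adj upper upper i i′ a = tt
    part-adj upper last i i′ a = column-last i i′ a
    part-adj last before i i′ a = before-last i′ i (adj-sym a)
    part-adj last lower i i′ a = column-last i′ i (adj-sym a)
    part-adj last upper i i′ a = column-last i′ i (adj-sym a)
    part-adj last last i i′ a = tt

    part-unique : ∀ l l′ {c} → OfPart l c → OfPart l′ c → l ≡ l′
    part-unique before before _ _ = refl
    part-unique lower lower _ _ = refl
    part-unique upper upper _ _ = refl
    part-unique last last _ _ = refl
    part-unique before lower i (refl , _) = ⊥-elim (NP.n≮n _ (InP-< {pre} i))
    part-unique before upper i (refl , _) = ⊥-elim (NP.n≮n _ (InP-< {pre} i))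
    part-unique before last i (refl , _) = ⊥-elim (NP.<⇒≱ (InP-< {pre} i) (NP.n≤1+n _))
    part-unique lower before (refl , _) i = ⊥-elim (NP.n≮n _ (InP-< {pre} i))
    part-unique upper before (refl , _) i = ⊥-elim (NP.n≮n _ (InP-< {pre} i))
    part-unique last before (refl , _) i = ⊥-elim (NP.<⇒≱ (InP-< {pre} i) (NP.n≤1+n _))
    part-unique lower upper (_ , _ , p) (_ , q , _) = ⊥-elim (ZP.<⇒≱ t₁<b₂ (ZP.≤-trans q p))
    part-unique upper lower (_ , q , _) (_ , _ , p) = ⊥-elim (ZP.<⇒≱ t₁<b₂ (ZP.≤-trans q p))
    part-unique lower last (refl , _) (e , _) = ⊥-elim (NP.1+n≢n (sym e))
    part-unique upper last (refl , _) (e , _) = ⊥-elim (NP.1+n≢n (sym e))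
    part-unique last lower (e , _) (refl , _) = ⊥-elim (NP.1+n≢n (sym e))
    part-unique last upper (e , _) (refl , _) = ⊥-elim (NP.1+n≢n (sym e))

    Crossing : (Part → Bool) → Set
    Crossing A = ∃[ l ] ∃[ l′ ] (A l ≡ true × A l′ ≡ false × Link l l′)

    -- A path whose ends lie on different sides of `A` has a step that changes side, and a step
    -- between parts yields a link. Connectedness is used only through such cuts.
    cut : ∀ (A : Part → Bool) {c c″ l l″} → Path full c c″ → OfPart l c → OfPart l″ c″ →
          A l ≡ true → A l″ ≡ false → Crossing A
    cut A (here _) i i″ al al″ with refl ← part-unique _ _ i i″ with () ← trans (sym al) al″
    cut A (step _ a p) i i″ al al″ with part (path-head p)
    ... | l′ , i′ with A l′ in al′
    ... | true = cut A p i′ i″ al′ al″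
    ... | false = _ , l′ , al , al′ , part-adj _ l′ i i′ a

    module _ (v₁ : b₁ Z.≤ t₁) (v₂ : b₂ Z.≤ t₂) (v : b Z.≤ t) (conn : Connected full) where

      private
        i-lower : InP full (M , b₁)
        i-lower = lower-segment (ZP.≤-refl , v₁)
        i-upper : InP full (M , b₂)
        i-upper = upper-segment (ZP.≤-refl , v₂)
        i-last : InP full (suc M , b)
        i-last = last-segment (ZP.≤-refl , v)
        p-lower : OfPart lower (M , b₁)
        p-lower = refl , ZP.≤-refl , v₁
        p-upper : OfPart upper (M , b₂)
        p-upper = refl , ZP.≤-refl , v₂
        p-last : OfPart last (suc M , b)
        p-last = refl , ZP.≤-refl , v

        ⟨lower⟩ ⟨upper⟩ ⟨lower,last⟩ ⟨upper,last⟩ ⟨before⟩ : Part → Bool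
        ⟨lower⟩ = λ { lower → true ; _ → false }
        ⟨upper⟩ = λ { upper → true ; _ → false }
        ⟨lower,last⟩ = λ { lower → true ; last → true ; _ → false }
        ⟨upper,last⟩ = λ { upper → true ; last → true ; _ → false }
        ⟨before⟩ = λ { before → true ; _ → false }

      -- The cut isolates the lower component, whose only links lead to `before` and `last`.
      lower-meets-last : ¬ Touches b₁ t₁ → Overlap b₁ t₁ b t
      lower-meets-last ¬T with cut ⟨lower⟩ {l = lower} {last} (conn _ _ i-lower i-last) p-lower p-last refl refl
      ... | lower , before , _ , _ , T = ⊥-elim (¬T T)
      ... | lower , last , _ , _ , o = o

      upper-meets-last : ¬ Touches b₂ t₂ → Overlap b₂ t₂ b t
      upper-meets-last ¬T with cut ⟨upper⟩ {l = upper} {last} (conn _ _ i-upper i-last) p-upper p-last refl refl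
      ... | upper , before , _ , _ , T = ⊥-elim (¬T T)
      ... | upper , last , _ , _ , o = o

      -- With the lower component and the last column on one side, the links across the cut are
      -- lower to before and last to upper.
      upper-meets-last′ : ¬ Touches b₁ t₁ → Overlap b₂ t₂ b t
      upper-meets-last′ ¬T with cut ⟨lower,last⟩ {l = last} {upper} (conn _ _ i-last i-upper) p-last p-upper refl refl
      ... | lower , before , _ , _ , T = ⊥-elim (¬T T)
      ... | last , upper , _ , _ , o = o

      lower-meets-last′ : ¬ Touches b₂ t₂ → Overlap b₁ t₁ b t
      lower-meets-last′ ¬T with cut ⟨upper,last⟩ {l = last} {lower} (conn _ _ i-last i-lower) p-last p-lower refl refl
      ... | upper , before , _ , _ , T = ⊥-elim (¬T T)
      ... | last , lower , _ , _ , o = o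

      -- The cut isolates `before`, which has no direct link to the last column.
      touches : ∀ {c} → InP pre c → Touches b₁ t₁ ⊎ Touches b₂ t₂
      touches {c} i with cut ⟨before⟩ {l = before} {last} (conn c _ (InP-++ˡ pre {c = c} i) i-last) i p-last refl refl
      ... | before , lower , _ , _ , T = inj₁ T
      ... | before , upper , _ , _ , T = inj₂ T

-- Membership in S under concatenation, and unique decomposition

numDup-++ : ∀ xs ys → numDup (xs ++ ys) ≡ numDup xs N.+ numDup ys
numDup-++ [] ys = refl
numDup-++ (x ∷ xs) ys =
  trans (cong (isDupB x N.+_) (numDup-++ xs ys)) (sym (NP.+-assoc (isDupB x) (numDup xs) (numDup ys)))

numDup≤length : ∀ xs → numDup xs N.≤ length xs
numDup≤length [] = z≤n
numDup≤length (simp _ _ ∷ xs) = NP.m≤n⇒m≤1+n (numDup≤length xs)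
numDup≤length (dup _ _ _ _ ∷ xs) = s≤s (numDup≤length xs)

-- One unit of slack comes from the last column of pre, the other from e.
twoSimplex : ∀ {pre b′ t′} e → EndsIn pre b′ t′ → suc (numDup e) N.≤ length e →
             ¬ OnlySimpIsLast (pre ++ e)
twoSimplex {pre} {b′} {t′} e (ends-in {rs} eq) e-slack only = NP.1+n≰n {1} (begin
  2                                  ≡⟨ NP.m+n∸n≡m 2 (numDup (pre ++ e)) ⟨
  (2 N.+ numDup (pre ++ e)) ∸ numDup (pre ++ e) ≤⟨ NP.∸-monoˡ-≤ (numDup (pre ++ e)) slack ⟩
  length (pre ++ e) ∸ numDup (pre ++ e) ≡⟨ only ⟩
  1                                  ∎)
  where
  open NP.≤-Reasoning
  pre-slack : suc (numDup pre) N.≤ length pre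
  pre-slack rewrite reverse-≡⇒ {cs = pre} eq | numDup-++ (reverse rs) (simp b′ t′ ∷ [])
    | length-++ (reverse rs) {simp b′ t′ ∷ []}
    | NP.+-identityʳ (numDup (reverse rs)) | NP.+-comm (length (reverse rs)) 1 =
    s≤s (numDup≤length (reverse rs))
  slack : 2 N.+ numDup (pre ++ e) N.≤ length (pre ++ e)
  slack = begin
    2 N.+ numDup (pre ++ e)           ≡⟨ cong (2 N.+_) (numDup-++ pre e) ⟩
    2 N.+ (numDup pre N.+ numDup e)   ≡⟨ cong suc (NP.+-suc (numDup pre) (numDup e)) ⟨
    suc (numDup pre) N.+ suc (numDup e) ≤⟨ NP.+-mono-≤ pre-slack e-slack ⟩
    length pre N.+ length e           ≡⟨ length-++ pre ⟨
    length (pre ++ e)                 ∎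

noAdjDup-++⁻ˡ : ∀ xs {ys} → NoAdjDup (xs ++ ys) → NoAdjDup xs
noAdjDup-++⁻ˡ [] _ = tt
noAdjDup-++⁻ˡ (x ∷ []) _ = tt
noAdjDup-++⁻ˡ (x ∷ y ∷ xs) (p , q) = p , noAdjDup-++⁻ˡ (y ∷ xs) q

noAdjDup-++⁻ʳ : ∀ xs {ys} → NoAdjDup (xs ++ ys) → NoAdjDup ys
noAdjDup-++⁻ʳ [] n = n
noAdjDup-++⁻ʳ (x ∷ []) {[]} n = tt
noAdjDup-++⁻ʳ (x ∷ []) {y ∷ ys} (_ , n) = n
noAdjDup-++⁻ʳ (x ∷ y ∷ xs) (_ , n) = noAdjDup-++⁻ʳ (y ∷ xs) n

noAdjDup-glue : ∀ xs {c e} → NoAdjDup (xs ++ c ∷ []) → NoAdjDup (c ∷ e) → NoAdjDup (xs ++ c ∷ e)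
noAdjDup-glue [] _ n = n
noAdjDup-glue (x ∷ []) (p , _) n = p , n
noAdjDup-glue (x ∷ y ∷ xs) (p , q) n = p , noAdjDup-glue (y ∷ xs) q n

InS-ends : ∀ {pre} → InS pre → ∃[ b ] ∃[ t ] (EndsIn pre b t × b Z.≤ t)
InS-ends {pre} ((valid , _) , head) with reverse pre in eq
... | simp b t ∷ rs with All.head (AllP.++⁻ʳ (reverse rs) (subst (All ValidCol) (reverse-≡⇒ {cs = pre} eq) valid))
... | v = b , t , ends-in eq , v

InS-++⁺ : ∀ {pre b′ t′} e → EndsIn pre b′ t′ → InS pre → All ValidCol e → Connected (pre ++ e) →
          NoAdjDup (simp b′ t′ ∷ e) → HeadSimp (reverse (pre ++ e)) → InS (pre ++ e)
InS-++⁺ {pre@(c ∷ _)} {b′} {t′} e (ends-in {rs} eq) ((valid , fbz , _ , nad) , _) valid-e conn nad-e head =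
  (AllP.++⁺ valid valid-e , fbz , conn , nad-full) , head
  where
  nad-full : NoAdjDup (pre ++ e)
  nad-full = subst NoAdjDup
    (trans (sym (++-assoc (reverse rs) (simp b′ t′ ∷ []) e)) (cong (_++ e) (sym (reverse-≡⇒ {cs = pre} eq))))
    (noAdjDup-glue (reverse rs) (subst NoAdjDup (reverse-≡⇒ {cs = pre} eq) nad) nad-e)

InS-++⁻ : ∀ {pre b′ t′ e} → EndsIn pre b′ t′ → InS (pre ++ e) → InS pre × b′ Z.≤ t′ × All ValidCol e
InS-++⁻ {pre@(c ∷ _)} {b′} {t′} ends@(ends-in {rs} eq) ((valid , fbz , conn , nad) , _) =
  ((AllP.++⁻ˡ pre valid , fbz , connected-++⁻ ends v conn , noAdjDup-++⁻ˡ pre nad)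
    , subst HeadSimp (sym eq) tt)
  , v , AllP.++⁻ʳ pre valid
  where
  v : b′ Z.≤ t′
  v = All.head (AllP.++⁻ʳ (reverse rs) (subst (All ValidCol) (reverse-≡⇒ {cs = pre} eq) (AllP.++⁻ˡ pre valid)))

++-injective : ∀ {A : Set} (xs xs′ : List A) {ys ys′} → length ys ≡ length ys′ →
               xs ++ ys ≡ xs′ ++ ys′ → xs ≡ xs′ × ys ≡ ys′
++-injective [] [] _ e = refl , e
++-injective (x ∷ xs) (x′ ∷ xs′) l e with refl , e′ ← ∷-injective e with refl , e″ ← ++-injective xs xs′ l e′ =
  refl , e″
++-injective [] (x′ ∷ xs′) {ys′ = ys′} l refl =
  ⊥-elim (NP.m≢1+n+m (length ys′) (trans (sym l) (cong suc (length-++ xs′))))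
++-injective (x ∷ xs) [] {ys} l refl =
  ⊥-elim (NP.m≢1+n+m (length ys) (trans l (cong suc (length-++ xs))))

endsIn-unique : ∀ {pre b t b′ t′} → EndsIn pre b t → EndsIn pre b′ t′ → b ≡ b′ × t ≡ t′
endsIn-unique (ends-in e) (ends-in e′) with refl ← trans (sym e) e′ = refl , refl

-- The condition on `ext` sees `pre` only through the ends of its last column. Hence the number of
-- extensions depends on `pre` only through the height of that column.
record Fam (K : ℤ → ℤ → List Col → Set) (cs : List Col) : Set where
  constructor fam
  field
    {pre}   : List Col
    {b′ t′} : ℤ
    ends    : EndsIn pre b′ t′
    pre∈S   : InS pre
    valid   : b′ Z.≤ t′
    {ext}   : List Col
    ext∈K   : K b′ t′ ext
    cs≡     : cs ≡ pre ++ ext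

fam-map : ∀ {K K′ cs} → (∀ {b t e} → b Z.≤ t → K b t e → K′ b t e) → Fam K cs → Fam K′ cs
fam-map f (fam en s v k e) = fam en s v (f v k) e

-- Reading the class conditions off the reversed list

module _ (cs : List Col) (P P′ : Col → ℤ → Set) (k k′ : ℕ) {c c′ : Col} where

  -- The columns have different abscissae, so cells that share an edge are horizontal neighbours: an
  -- edge in common is a common row.
  share : colR cs k ≡ just c → colR cs k′ ≡ just c′ → xR cs k ≡ suc (xR cs k′) →
          ShareEdge (RSet P cs k) (RSet P′ cs k′) ⇔ (∃[ y ] (P c y × P′ c′ y))
  share e e′ x = mk⇔
    (λ { (_ , _ , (refl , d , q , p) , (refl , d′ , q′ , p′) , a) →
         adjacent (just-injective (trans (sym q) e)) (just-injective (trans (sym q′) e′)) p p′ a })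
    (λ (y , p , p′) → (xR cs k , y) , (xR cs k′ , y) ,
       (refl , c , e , p) , (refl , c′ , e′ , p′) , inj₂ (refl , inj₂ x))
    where
    adjacent : ∀ {d d′ y y′} → d ≡ c → d′ ≡ c′ → P d y → P′ d′ y′ → Adj (xR cs k , y) (xR cs k′ , y′) →
               ∃[ y ] (P c y × P′ c′ y)
    adjacent refl refl p p′ (inj₂ (refl , _)) = _ , p , p′
    adjacent refl refl p p′ (inj₁ (same , _)) = ⊥-elim (NP.1+n≢n (trans (sym x) same))

cellIn : ∀ (cs : List Col) (P : Col → ℤ → Set) k {c mp x y} →
         mp ≡ just (x , y) → colR cs k ≡ just c → x ≡ xR cs k → CellIn mp (RSet P cs k) ⇔ P c y
cellIn cs P k {c} {x = x₀} {y} e q x = mk⇔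
  (λ { (z , e′ , _ , d , q′ , p) → back z (just-injective (trans (sym e′) e)) (just-injective (trans (sym q′) q)) p })
  (λ p → (x₀ , y) , e , x , c , q , p)
  where
  back : ∀ z {d} → z ≡ (x₀ , y) → d ≡ c → P d (proj₂ z) → P c y
  back _ refl refl p = p

-- The wrapper makes `cs` inferable; from an equation about `reverse cs` unification could not
-- recover it.
record Reverse (cs rs : List Col) : Set where
  constructor reversed
  field
    reverse≡ : reverse cs ≡ rs

module _ {b′ t′ b₁ t₁ b₂ t₂ b t : ℤ} {cs rs : List Col}
         (reversed-cs : Reverse cs (simp b t ∷ dup b₁ t₁ b₂ t₂ ∷ simp b′ t′ ∷ rs)) where

  private
    rev = Reverse.reverse≡ reversed-cs

    len : length cs ≡ suc (suc (suc (length rs)))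
    len = trans (sym (length-reverse cs)) (cong length rev)

    col : ∀ k → colR cs k ≡ colAt (simp b t ∷ dup b₁ t₁ b₂ t₂ ∷ simp b′ t′ ∷ rs) k
    col k = cong (λ r → colAt r k) rev

    x : ∀ k → xR cs k ≡ suc (suc (suc (length rs))) ∸ suc k
    x k = cong (_∸ suc k) len

    lower-pivot : lowerPivot cs ≡ just (suc (length rs) , b′)
    lower-pivot rewrite rev | len = refl

    upper-pivot : upperPivot cs ≡ just (suc (length rs) , t′)
    upper-pivot rewrite rev | len = refl

    lower-inner : lowerInnerPivot cs ≡ just (suc (suc (length rs)) , t₁)
    lower-inner rewrite rev | len = refl

    upper-inner : upperInnerPivot cs ≡ just (suc (suc (length rs)) , b₂)
    upper-inner rewrite rev | len = refl

  lower~third : ShareEdge (LowerR cs 1) (ColumnR cs 2) ⇔ Overlap b₁ t₁ b′ t′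
  lower~third = share cs InLower InColY 1 2 (col 1) (col 2) (trans (x 1) (cong suc (sym (x 2))))

  upper~third : ShareEdge (UpperR cs 1) (ColumnR cs 2) ⇔ Overlap b₂ t₂ b′ t′
  upper~third = share cs InUpper InColY 1 2 (col 1) (col 2) (trans (x 1) (cong suc (sym (x 2))))

  last~lower : ShareEdge (ColumnR cs 0) (LowerR cs 1) ⇔ Overlap b t b₁ t₁
  last~lower = share cs InColY InLower 0 1 (col 0) (col 1) (trans (x 0) (cong suc (sym (x 1))))

  last~upper : ShareEdge (ColumnR cs 0) (UpperR cs 1) ⇔ Overlap b t b₂ t₂
  last~upper = share cs InColY InUpper 0 1 (col 0) (col 1) (trans (x 0) (cong suc (sym (x 1))))

  lowerPivot∈upper : CellIn (lowerPivot cs) (UpperR cs 1) ⇔ b′ ∈[ b₂ , t₂ ]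
  lowerPivot∈upper = cellIn cs InUpper 1 lower-pivot (col 1) (sym (x 1))

  lowerPivot∈hole : CellIn (lowerPivot cs) (HoleR cs 1) ⇔ (t₁ Z.< b′ × b′ Z.< b₂)
  lowerPivot∈hole = cellIn cs InHole 1 lower-pivot (col 1) (sym (x 1))

  upperPivot∈lower : CellIn (upperPivot cs) (LowerR cs 1) ⇔ t′ ∈[ b₁ , t₁ ]
  upperPivot∈lower = cellIn cs InLower 1 upper-pivot (col 1) (sym (x 1))

  upperPivot∈hole : CellIn (upperPivot cs) (HoleR cs 1) ⇔ (t₁ Z.< t′ × t′ Z.< b₂)
  upperPivot∈hole = cellIn cs InHole 1 upper-pivot (col 1) (sym (x 1))

  lowerInnerPivot∈last : CellIn (lowerInnerPivot cs) (ColumnR cs 0) ⇔ t₁ ∈[ b , t ]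
  lowerInnerPivot∈last = cellIn cs InColY 0 lower-inner (col 0) (sym (x 0))

  upperInnerPivot∈last : CellIn (upperInnerPivot cs) (ColumnR cs 0) ⇔ b₂ ∈[ b , t ]
  upperInnerPivot∈last = cellIn cs InColY 0 upper-inner (col 0) (sym (x 0))

module _ {b′ t′ b t : ℤ} {cs rs : List Col} (reversed-cs : Reverse cs (simp b t ∷ simp b′ t′ ∷ rs)) where

  private
    rev = Reverse.reverse≡ reversed-cs

    len : length cs ≡ suc (suc (length rs))
    len = trans (sym (length-reverse cs)) (cong length rev)

    lower-pivot : lowerPivot cs ≡ just (suc (length rs) , b′)
    lower-pivot rewrite rev | len = refl

  lowerPivot∈last : CellIn (lowerPivot cs) (ColumnR cs 0) ⇔ b′ ∈[ b , t ]
  lowerPivot∈last = cellIn cs InColY 0 lower-pivot (cong (λ r → colAt r 0) rev) (sym (cong (_∸ 1) len))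

-- Possible endings of an element of S

data Shape : List Col → Set where
  single : ∀ {b t} → Shape (simp b t ∷ [])
  double : ∀ {b₁ t₁ b₂ t₂ b t} → Shape (dup b₁ t₁ b₂ t₂ ∷ simp b t ∷ [])
  snoc₁  : ∀ {pre b′ t′ b t} → EndsIn pre b′ t′ → Shape (pre ++ simp b t ∷ [])
  snoc₂  : ∀ {pre b′ t′ b₁ t₁ b₂ t₂ b t} → EndsIn pre b′ t′ →
           Shape (pre ++ dup b₁ t₁ b₂ t₂ ∷ simp b t ∷ [])

-- The last column is simplex, so a duplex second-last column is preceded by a simplex column or by
-- nothing. The endings `single` and `double` make up S_α.
shape : ∀ {cs} → InS cs → Shape cs
shape {cs} ((_ , _ , _ , nad) , head) =
  subst Shape (reverse-involutive cs)
    (go (reverse cs) head (subst NoAdjDup (sym (reverse-involutive cs)) nad))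
  where
  go : ∀ rs → HeadSimp rs → NoAdjDup (reverse rs) → Shape (reverse rs)
  go (simp _ _ ∷ []) _ _ = single
  go (simp _ _ ∷ dup _ _ _ _ ∷ []) _ _ = double
  go (s@(simp _ _) ∷ T@(simp _ _) ∷ rs) _ _
    rewrite reverse-++ (s ∷ []) (T ∷ rs) = snoc₁ (ends-in (reverse-involutive (T ∷ rs)))
  go (s@(simp _ _) ∷ D@(dup _ _ _ _) ∷ T@(simp _ _) ∷ rs) _ _
    rewrite reverse-++ (s ∷ D ∷ []) (T ∷ rs) = snoc₂ (ends-in (reverse-involutive (T ∷ rs)))
  go (s@(simp _ _) ∷ D@(dup _ _ _ _) ∷ D′@(dup _ _ _ _) ∷ rs) _ nad
    rewrite reverse-++ (s ∷ D ∷ D′ ∷ []) rs =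
    ⊥-elim (proj₁ (noAdjDup-++⁻ʳ (reverse rs) nad) (tt , tt))

module _ {pre : List Col} {b′ t′ : ℤ} where

  reverse-snoc₁ : ∀ {b t} (ends : EndsIn pre b′ t′) →
                  reverse (pre ++ simp b t ∷ []) ≡ simp b t ∷ simp b′ t′ ∷ EndsIn.others ends
  reverse-snoc₁ {b} {t} (ends-in e) = trans (reverse-++ pre (simp b t ∷ [])) (cong (simp b t ∷_) e)

  reverse-snoc₂ : ∀ {b₁ t₁ b₂ t₂ b t} (ends : EndsIn pre b′ t′) →
                  reverse (pre ++ dup b₁ t₁ b₂ t₂ ∷ simp b t ∷ [])
                  ≡ simp b t ∷ dup b₁ t₁ b₂ t₂ ∷ simp b′ t′ ∷ EndsIn.others ends
  reverse-snoc₂ {b₁} {t₁} {b₂} {t₂} {b} {t} (ends-in e) =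
    trans (reverse-++ pre (dup b₁ t₁ b₂ t₂ ∷ simp b t ∷ [])) (cong (λ r → simp b t ∷ dup b₁ t₁ b₂ t₂ ∷ r) e)

-- Extension by one simplex column

OneCol : (ℤ → ℤ → ℤ → ℤ → Set) → ℤ → ℤ → List Col → Set
OneCol R b′ t′ (simp b t ∷ []) = b Z.≤ t × R b′ t′ b t
OneCol R b′ t′ _ = ⊥

-- Isolates what β and γ share. What is left to check for each is a statement about two overlapping
-- intervals.
oneCol-class :
  ∀ X (Rest : List Col → Set) R →
  (∀ cs → ClsCond X cs ≡ (¬ OnlySimpIsLast cs × SecondLastSimp cs × Rest cs)) →
  (∀ {b′ t′ b t cs rs} → Reverse cs (simp b t ∷ simp b′ t′ ∷ rs) → b′ Z.≤ t′ → b Z.≤ t →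
     (b′ Z.≤ t × b Z.≤ t′ × Rest cs) ⇔ R b′ t′ b t) →
  ∀ {cs} → InCls X cs ⇔ Fam (OneCol R) cs
oneCol-class X Rest R cond char {cs} = mk⇔
  (λ (s , p) → to′ s (shape s) (subst id (cond cs) p))
  from′
  where
  to′ : ∀ {cs} → InS cs → Shape cs → ¬ OnlySimpIsLast cs × SecondLastSimp cs × Rest cs → Fam (OneCol R) cs
  to′ s single (_ , (_ , () , _) , _)
  to′ s double (_ , (_ , refl , ()) , _)
  to′ s (snoc₂ ends) (_ , (_ , e , i) , _)
    with refl ← trans (sym e) (cong (λ r → colAt r 1) (reverse-snoc₂ ends)) with () ← i
  to′ s@((_ , _ , conn , _) , _) (snoc₁ ends) (_ , _ , rest)
    with pre∈S , v′ , (v ∷ []) ← InS-++⁻ ends s =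
    let p , q = overlap⇒ (connected-∷ʳ⁻ ends v′ v conn) in
    fam ends pre∈S v′ (v , to (char (reversed (reverse-snoc₁ ends)) v′ v) (p , q , rest)) refl
  from′ : ∀ {cs} → Fam (OneCol R) cs → InCls X cs
  from′ {cs} (fam {pre} ends pre∈S v′ {simp b t ∷ []} (v , r) refl) =
    InS-++⁺ (simp b t ∷ []) ends pre∈S (v ∷ [])
      (connected-∷ʳ⁺ ends v′ (proj₁ (proj₂ (proj₂ (proj₁ pre∈S)))) (⇒overlap v′ v p q))
      ((λ ()) , tt) (subst HeadSimp (sym rev) tt)
    , subst id (sym (cond cs))
        (twoSimplex (simp b t ∷ []) ends (s≤s z≤n) , (_ , cong (λ r → colAt r 1) rev , tt) , rest)
    where
    rev = reverse-snoc₁ ends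
    back = from (char (reversed rev) v′ v) r
    p = proj₁ back
    q = proj₁ (proj₂ back)
    rest = proj₂ (proj₂ back)

Rβ Rγ : ℤ → ℤ → ℤ → ℤ → Set
Rβ b′ t′ b t = b Z.≤ b′ × b′ Z.≤ t
Rγ b′ t′ b t = b′ Z.< b × b Z.≤ t′

class-β : ∀ {cs} → InCls Sβ cs ⇔ Fam (OneCol Rβ) cs
class-β = oneCol-class Sβ _ Rβ (λ _ → refl) λ rev v′ v → mk⇔
  (λ (p , q , r) → to (lowerPivot∈last rev) r)
  (λ (p , q) → q , ZP.≤-trans p v′ , from (lowerPivot∈last rev) (p , q))

-- Meeting [b′, t′] already gives b′ ≤ t, so missing the pivot row b′ can only mean b′ < b.
class-γ : ∀ {cs} → InCls Sγ cs ⇔ Fam (OneCol Rγ) cs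
class-γ = oneCol-class Sγ _ Rγ (λ _ → refl) λ rev v′ v → mk⇔
  (λ (p , q , ¬r) → ZP.≰⇒> (λ le → ¬r (from (lowerPivot∈last rev) (le , p))) , q)
  (λ (p , q) → ZP.≤-trans (ZP.<⇒≤ p) v , q , λ r → ZP.<⇒≱ p (proj₁ (to (lowerPivot∈last rev) r)))

-- Extension by a duplex and a simplex column

TwoColRel : Set₁
TwoColRel = (b′ t′ b₁ t₁ b₂ t₂ b t : ℤ) → Set

TwoCol : TwoColRel → ℤ → ℤ → List Col → Set
TwoCol R b′ t′ (dup b₁ t₁ b₂ t₂ ∷ simp b t ∷ []) =
  ValidCol (dup b₁ t₁ b₂ t₂) × b Z.≤ t × R b′ t′ b₁ t₁ b₂ t₂ b t
TwoCol R b′ t′ _ = ⊥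

-- The four parts (third-last column, two components, last column) can only
-- be linked along a 4-cycle, so connectedness means that at most one link is missing.
data Linked (b′ t′ b₁ t₁ b₂ t₂ b t : ℤ) : Set where
  not-lower-third : Overlap b₂ t₂ b′ t′ → Overlap b t b₁ t₁ → Overlap b t b₂ t₂ →
                    Linked b′ t′ b₁ t₁ b₂ t₂ b t
  not-upper-third : Overlap b₁ t₁ b′ t′ → Overlap b t b₁ t₁ → Overlap b t b₂ t₂ →
                    Linked b′ t′ b₁ t₁ b₂ t₂ b t
  not-last-upper  : Overlap b₁ t₁ b′ t′ → Overlap b₂ t₂ b′ t′ → Overlap b t b₁ t₁ →
                    Linked b′ t′ b₁ t₁ b₂ t₂ b t
  not-last-lower  : Overlap b₁ t₁ b′ t′ → Overlap b₂ t₂ b′ t′ → Overlap b t b₂ t₂ →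
                    Linked b′ t′ b₁ t₁ b₂ t₂ b t

linked⇒connected : ∀ {pre b′ t′ b₁ t₁ b₂ t₂ b t} → EndsIn pre b′ t′ → b′ Z.≤ t′ → Connected pre →
                   Linked b′ t′ b₁ t₁ b₂ t₂ b t → Connected (pre ++ dup b₁ t₁ b₂ t₂ ∷ simp b t ∷ [])
linked⇒connected {pre} {b′} {t′} {b₁} {t₁} {b₂} {t₂} {b} {t} ends v conn = go
  where
  full = pre ++ dup b₁ t₁ b₂ t₂ ∷ simp b t ∷ []
  m = proj₁ (endsIn-colAt ends)
  len = proj₁ (proj₂ (endsIn-colAt ends))
  o : Cell
  o = m , b′
  reach-pre : ∀ {c} → InP pre c → Path full c o
  reach-pre {c} i = path-map {pre} (λ {c} → InP-++ˡ pre {c = c})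
    (conn c o i (endsIn-segment ends (sym len) (ZP.≤-refl , v)))
  reach-third : Reaches full o m b′ t′
  reach-third i = reach-pre (endsIn-segment ends (sym len) i)
  lower-seg = lower-segment pre b₁ t₁ b₂ t₂ b t
  upper-seg = upper-segment pre b₁ t₁ b₂ t₂ b t
  last-seg = last-segment pre b₁ t₁ b₂ t₂ b t
  via-third : ∀ {b t} → Segment full (length pre) b t → Overlap b t b′ t′ → Reaches full o (length pre) b t
  via-third seg ov = reaches-adjacent seg (inj₁ len) ov reach-third
  via-last : ∀ {b″ t″} → Segment full (length pre) b″ t″ → Overlap b t b″ t″ →
             Reaches full o (suc (length pre)) b t → Reaches full o (length pre) b″ t″
  via-last seg ov = reaches-adjacent seg (inj₂ refl) (overlap-sym ov)
  last-via : ∀ {b″ t″} → Overlap b t b″ t″ → Reaches full o (length pre) b″ t″ →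
             Reaches full o (suc (length pre)) b t
  last-via ov = reaches-adjacent last-seg (inj₁ refl) ov
  conclude = connected-⁺ pre b₁ t₁ b₂ t₂ b t o (λ {c} → reach-pre {c})
  go : Linked b′ t′ b₁ t₁ b₂ t₂ b t → Connected full
  go (not-lower-third UT SL SU) =
    let u = via-third upper-seg UT ; s = last-via SU u in conclude (via-last lower-seg SL s) u s
  go (not-upper-third LT SL SU) =
    let l = via-third lower-seg LT ; s = last-via SL l in conclude l (via-last upper-seg SU s) s
  go (not-last-upper LT UT SL) =
    let l = via-third lower-seg LT in conclude l (via-third upper-seg UT) (last-via SL l)
  go (not-last-lower LT UT SU) =
    let u = via-third upper-seg UT in conclude (via-third lower-seg LT) u (last-via SU u)

-- Of each of the three overlaps that must be present, only one inequality is kept. The other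
-- follows from the order of the components or from the pivot condition of the class.
record Forced (b′ t′ b₁ t₁ b₂ t₂ b t : ℤ) : Set where
  field
    without-lower : ¬ Overlap b₁ t₁ b′ t′ → b₂ Z.≤ t′ × b Z.≤ t₁ × b₂ Z.≤ t
    without-upper : ¬ Overlap b₂ t₂ b′ t′ → b′ Z.≤ t₁ × b Z.≤ t₁ × b₂ Z.≤ t

open Forced

connected⇒forced : ∀ {pre b′ t′ b₁ t₁ b₂ t₂ b t} → EndsIn pre b′ t′ → b′ Z.≤ t′ →
                   ValidCol (dup b₁ t₁ b₂ t₂) → b Z.≤ t →
                   Connected (pre ++ dup b₁ t₁ b₂ t₂ ∷ simp b t ∷ []) → Forced b′ t′ b₁ t₁ b₂ t₂ b t
connected⇒forced {pre} {b′} {t′} {b₁} {t₁} {b₂} {t₂} {b} {t} ends v′ (v₁ , gap , v₂) v conn = record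
  { without-lower = λ ¬LT →
      let ¬T = ¬LT ∘ touches⇒overlap in
      proj₁ (overlap⇒ (touches⇒overlap ([ ⊥-elim ∘ ¬T , id ]′ touching)))
      , proj₂ (overlap⇒ (lower-meets-last pre b₁ t₁ b₂ t₂ b t gap v₁ v₂ v conn ¬T))
      , proj₁ (overlap⇒ (upper-meets-last′ pre b₁ t₁ b₂ t₂ b t gap v₁ v₂ v conn ¬T))
  ; without-upper = λ ¬UT →
      let ¬T = ¬UT ∘ touches⇒overlap in
      proj₂ (overlap⇒ (touches⇒overlap ([ id , ⊥-elim ∘ ¬T ]′ touching)))
      , proj₂ (overlap⇒ (lower-meets-last′ pre b₁ t₁ b₂ t₂ b t gap v₁ v₂ v conn ¬T))
      , proj₁ (overlap⇒ (upper-meets-last pre b₁ t₁ b₂ t₂ b t gap v₁ v₂ v conn ¬T))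
  }
  where
  touches⇒overlap : ∀ {b″ t″} → Touches pre b₁ t₁ b₂ t₂ b t b″ t″ → Overlap b″ t″ b′ t′
  touches⇒overlap (_ , y , sx , i , i′) = y , i′ , endsIn-column ends sx i
  touching : Touches pre b₁ t₁ b₂ t₂ b t b₁ t₁ ⊎ Touches pre b₁ t₁ b₂ t₂ b t b₂ t₂
  touching = let m , len , _ = endsIn-colAt ends in
    touches pre b₁ t₁ b₂ t₂ b t gap v₁ v₂ v conn {m , b′} (endsIn-segment ends (sym len) (ZP.≤-refl , v′))

module _ {b₁ t₁ b₂ t₂ : ℤ} where

  lower<upper : ValidCol (dup b₁ t₁ b₂ t₂) → t₁ Z.< b₂
  lower<upper (_ , gap , _) = ZP.≤-<-trans (x≤x+n t₁ 1) gap

  -- A column reaching from t₁ or lower up to b₂ or higher spans the hole; the remaining two overlap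
  -- inequalities come from t₁ < b₂.
  bridge : ∀ {b t} → ValidCol (dup b₁ t₁ b₂ t₂) → b Z.≤ t → b Z.≤ t₁ → b₂ Z.≤ t →
           Overlap b t b₁ t₁ × Overlap b t b₂ t₂
  bridge vD@(v₁ , _ , v₂) v p q =
    let lt = ZP.<⇒≤ (lower<upper vD) in
    ⇒overlap v v₁ p (ZP.≤-trans v₁ (ZP.≤-trans lt q))
    , ⇒overlap v v₂ (ZP.≤-trans p (ZP.≤-trans lt v₂)) q

  both-third : ∀ {b′ t′} → ValidCol (dup b₁ t₁ b₂ t₂) → b′ Z.≤ t′ → b′ Z.≤ t₁ → b₂ Z.≤ t′ →
               Overlap b₁ t₁ b′ t′ × Overlap b₂ t₂ b′ t′
  both-third vD v p q = let o , o′ = bridge vD v p q in overlap-sym o , overlap-sym o′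

-- The two directions are separate hypotheses because connectedness enters them differently: as
-- `Forced` when it is given, as `Linked` when it has to be produced.
twoCol-class :
  ∀ X (Rest : List Col → Set) (R : TwoColRel) →
  (∀ cs → ClsCond X cs ≡ (¬ OnlySimpIsLast cs × SecondLastDup cs × Rest cs)) →
  (∀ {b′ t′ b₁ t₁ b₂ t₂ b t cs rs} →
     Reverse cs (simp b t ∷ dup b₁ t₁ b₂ t₂ ∷ simp b′ t′ ∷ rs) →
     b′ Z.≤ t′ → ValidCol (dup b₁ t₁ b₂ t₂) → b Z.≤ t →
     Forced b′ t′ b₁ t₁ b₂ t₂ b t → Rest cs → R b′ t′ b₁ t₁ b₂ t₂ b t) →
  (∀ {b′ t′ b₁ t₁ b₂ t₂ b t cs rs} →
     Reverse cs (simp b t ∷ dup b₁ t₁ b₂ t₂ ∷ simp b′ t′ ∷ rs) →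
     b′ Z.≤ t′ → ValidCol (dup b₁ t₁ b₂ t₂) → b Z.≤ t →
     R b′ t′ b₁ t₁ b₂ t₂ b t → Rest cs × Linked b′ t′ b₁ t₁ b₂ t₂ b t) →
  ∀ {cs} → InCls X cs ⇔ Fam (TwoCol R) cs
twoCol-class X Rest R cond char⇒ char⇐ {cs} = mk⇔
  (λ (s , p) → to′ s (shape s) (subst id (cond cs) p))
  from′
  where
  to′ : ∀ {cs} → InS cs → Shape cs → ¬ OnlySimpIsLast cs × SecondLastDup cs × Rest cs → Fam (TwoCol R) cs
  to′ s single (_ , (_ , () , _) , _)
  to′ s double (only , _) = ⊥-elim (only refl)
  to′ s (snoc₁ ends) (_ , (_ , e , i) , _)
    with refl ← trans (sym e) (cong (λ r → colAt r 1) (reverse-snoc₁ ends)) with () ← i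
  to′ s@((_ , _ , conn , _) , _) (snoc₂ ends) (_ , _ , rest)
    with pre∈S , v′ , (vD ∷ v ∷ []) ← InS-++⁻ ends s =
    fam ends pre∈S v′
      (vD , v , char⇒ (reversed (reverse-snoc₂ ends)) v′ vD v (connected⇒forced ends v′ vD v conn) rest) refl
  from′ : ∀ {cs} → Fam (TwoCol R) cs → InCls X cs
  from′ {cs} (fam {pre} ends pre∈S v′ {e@(dup b₁ t₁ b₂ t₂ ∷ simp b t ∷ [])} (vD , v , r) refl) =
    InS-++⁺ e ends pre∈S (vD ∷ v ∷ [])
      (linked⇒connected ends v′ (proj₁ (proj₂ (proj₂ (proj₁ pre∈S)))) (proj₂ back))
      ((λ ()) , (λ ()) , tt) (subst HeadSimp (sym rev) tt)
    , subst id (sym (cond cs))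
        (twoSimplex e ends (s≤s (s≤s z≤n)) , (_ , cong (λ r → colAt r 1) rev , tt) , proj₁ back)
    where
    rev = reverse-snoc₂ ends
    back = char⇐ (reversed rev) v′ vD v r

-- Reduced inequalities: the hole against [b′, t′], then the last column against the hole. In ε, η,
-- κ and μ the last conjunct is the one to be dropped to obtain a freely parametrised superset.
Rδ Rε Rζ Rη Rθ Rι Rκ Rλ Rμ : TwoColRel
Rδ b′ t′ b₁ t₁ b₂ t₂ b t = (b₂ Z.≤ b′ × b′ Z.≤ t₂) × b Z.≤ t₁ × b₂ Z.≤ t
Rε b′ t′ b₁ t₁ b₂ t₂ b t = ((t₁ Z.< b′ × b′ Z.< b₂) × b Z.≤ t₁ × b₂ Z.≤ t) × b₂ Z.≤ t′
Rζ b′ t′ b₁ t₁ b₂ t₂ b t = (b₁ Z.≤ t′ × t′ Z.≤ t₁) × b Z.≤ t₁ × b₂ Z.≤ t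
Rη b′ t′ b₁ t₁ b₂ t₂ b t = ((t₁ Z.< t′ × t′ Z.< b₂) × b Z.≤ t₁ × b₂ Z.≤ t) × b′ Z.≤ t₁
Rθ b′ t′ b₁ t₁ b₂ t₂ b t = (b′ Z.≤ t₁ × b₂ Z.≤ t′) × b Z.≤ t₁ × b₂ Z.≤ t
Rι b′ t′ b₁ t₁ b₂ t₂ b t = (b′ Z.≤ t₁ × b₂ Z.≤ t′) × b₁ Z.≤ t × t Z.< t₁
Rκ b′ t′ b₁ t₁ b₂ t₂ b t = ((b′ Z.≤ t₁ × b₂ Z.≤ t′) × b Z.≤ t₁ × t₁ Z.≤ t) × t Z.< b₂
Rλ b′ t′ b₁ t₁ b₂ t₂ b t = (b′ Z.≤ t₁ × b₂ Z.≤ t′) × b₂ Z.< b × b Z.≤ t₂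
Rμ b′ t′ b₁ t₁ b₂ t₂ b t = ((b′ Z.≤ t₁ × b₂ Z.≤ t′) × b Z.≤ b₂ × b₂ Z.≤ t) × t₁ Z.< b

-- With the pivot in the upper component, t₁ < b₂ ≤ b′, so the lower component misses the third-last
-- column of itself. Only the upper component and the last column can then hold it.
class-δ : ∀ {cs} → InCls Sδ cs ⇔ Fam (TwoCol Rδ) cs
class-δ = twoCol-class Sδ _ Rδ (λ _ → refl)
  (λ rev v′ vD v f (¬LT , piv) →
    to (lowerPivot∈upper rev) piv , proj₂ (without-lower f (¬LT ∘ from (lower~third rev))))
  (λ { rev v′ vD@(_ , _ , v₂) v ((p , q) , r , r′) →
    ((λ LT → ZP.<⇒≱ (lower<upper vD) (ZP.≤-trans p (proj₂ (overlap⇒ (to (lower~third rev) LT)))))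
     , from (lowerPivot∈upper rev) (p , q))
    , let SL , SU = bridge vD v r r′ in
      not-lower-third (⇒overlap v₂ v′ (ZP.≤-trans p v′) q) SL SU })

class-ε : ∀ {cs} → InCls Sε cs ⇔ Fam (TwoCol Rε) cs
class-ε = twoCol-class Sε _ Rε (λ _ → refl)
  (λ rev v′ vD v f (¬LT , piv) →
    let ut , br = without-lower f (¬LT ∘ from (lower~third rev)) in
    (to (lowerPivot∈hole rev) piv , br) , ut)
  (λ { rev v′ vD@(_ , _ , v₂) v (((p , q) , r , r′) , ut) →
    ((λ LT → ZP.<⇒≱ p (proj₂ (overlap⇒ (to (lower~third rev) LT))))
     , from (lowerPivot∈hole rev) (p , q))
    , let SL , SU = bridge vD v r r′ in
      not-lower-third (⇒overlap v₂ v′ ut (ZP.≤-trans (ZP.<⇒≤ q) v₂)) SL SU })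

class-ζ : ∀ {cs} → InCls Sζ cs ⇔ Fam (TwoCol Rζ) cs
class-ζ = twoCol-class Sζ _ Rζ (λ _ → refl)
  (λ rev v′ vD v f (¬UT , piv) →
    to (upperPivot∈lower rev) piv , proj₂ (without-upper f (¬UT ∘ from (upper~third rev))))
  (λ { rev v′ vD@(v₁ , _ , _) v ((p , q) , r , r′) →
    ((λ UT → ZP.<⇒≱ (lower<upper vD) (ZP.≤-trans (proj₁ (overlap⇒ (to (upper~third rev) UT))) q))
     , from (upperPivot∈lower rev) (p , q))
    , let SL , SU = bridge vD v r r′ in
      not-upper-third (⇒overlap v₁ v′ p (ZP.≤-trans v′ q)) SL SU })

class-η : ∀ {cs} → InCls Sη cs ⇔ Fam (TwoCol Rη) cs
class-η = twoCol-class Sη _ Rη (λ _ → refl)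
  (λ rev v′ vD v f (¬UT , piv) →
    let lt , br = without-upper f (¬UT ∘ from (upper~third rev)) in
    (to (upperPivot∈hole rev) piv , br) , lt)
  (λ { rev v′ vD@(v₁ , _ , _) v (((p , q) , r , r′) , lt) →
    ((λ UT → ZP.<⇒≱ q (proj₁ (overlap⇒ (to (upper~third rev) UT))))
     , from (upperPivot∈hole rev) (p , q))
    , let SL , SU = bridge vD v r r′ in
      not-upper-third (⇒overlap v₁ v′ (ZP.≤-trans v₁ (ZP.<⇒≤ p)) lt) SL SU })

private
  inner : ∀ {b′ t′ b₁ t₁ b₂ t₂ b t cs rs} →
          Reverse cs (simp b t ∷ dup b₁ t₁ b₂ t₂ ∷ simp b′ t′ ∷ rs) →
          BothShareThird cs → b′ Z.≤ t₁ × b₂ Z.≤ t′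
  inner rev (LT , UT) =
    proj₂ (overlap⇒ (to (lower~third rev) LT)) , proj₁ (overlap⇒ (to (upper~third rev) UT))

class-θ : ∀ {cs} → InCls Sθ cs ⇔ Fam (TwoCol Rθ) cs
class-θ = twoCol-class Sθ _ Rθ (λ _ → refl)
  (λ rev v′ vD v f (third , SL , SU) →
    inner rev third
    , proj₁ (overlap⇒ (to (last~lower rev) SL)) , proj₂ (overlap⇒ (to (last~upper rev) SU)))
  (λ rev v′ vD v ((p , q) , r , r′) →
    let LT , UT = both-third vD v′ p q ; SL , SU = bridge vD v r r′ in
    ((from (lower~third rev) LT , from (upper~third rev) UT)
      , from (last~lower rev) SL , from (last~upper rev) SU)
    , not-last-upper LT UT SL)

-- A last column that meets the lower component but not its top row ends below t₁, and so misses the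
-- upper component as well.
class-ι : ∀ {cs} → InCls Sι cs ⇔ Fam (TwoCol Rι) cs
class-ι = twoCol-class Sι _ Rι (λ _ → refl)
  (λ rev v′ vD v f (third , SL , ¬SU , ¬piv) →
    let p , q = overlap⇒ (to (last~lower rev) SL) in
    inner rev third , q , ZP.≰⇒> (λ le → ¬piv (from (lowerInnerPivot∈last rev) (p , le))))
  (λ { rev v′ vD@(v₁ , _ , _) v ((p , q) , r , r′) →
    let LT , UT = both-third vD v′ p q
        SL = ⇒overlap v v₁ (ZP.≤-trans v (ZP.<⇒≤ r′)) r in
    ((from (lower~third rev) LT , from (upper~third rev) UT)
      , from (last~lower rev) SL
      , (λ SU → ZP.<⇒≱ (ZP.<-trans r′ (lower<upper vD)) (proj₂ (overlap⇒ (to (last~upper rev) SU))))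
      , (λ piv → ZP.<⇒≱ r′ (proj₂ (to (lowerInnerPivot∈last rev) piv))))
    , not-last-upper LT UT SL })

class-κ : ∀ {cs} → InCls Sκ cs ⇔ Fam (TwoCol Rκ) cs
class-κ = twoCol-class Sκ _ Rκ (λ _ → refl)
  (λ { rev v′ vD@(_ , _ , v₂) v f (third , SL , ¬SU , piv) →
    let p , q = to (lowerInnerPivot∈last rev) piv
        p′ = ZP.≤-trans p (ZP.≤-trans (ZP.<⇒≤ (lower<upper vD)) v₂) in
    (inner rev third , p , q) , ZP.≰⇒> (λ le → ¬SU (from (last~upper rev) (⇒overlap v v₂ p′ le))) })
  (λ { rev v′ vD@(v₁ , _ , _) v (((p , q) , r , r′) , lt) →
    let LT , UT = both-third vD v′ p q
        SL = ⇒overlap v v₁ r (ZP.≤-trans v₁ r′) in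
    ((from (lower~third rev) LT , from (upper~third rev) UT)
      , from (last~lower rev) SL
      , (λ SU → ZP.<⇒≱ lt (proj₂ (overlap⇒ (to (last~upper rev) SU))))
      , from (lowerInnerPivot∈last rev) (r , r′))
    , not-last-upper LT UT SL })

class-λ : ∀ {cs} → InCls Sλ cs ⇔ Fam (TwoCol Rλ) cs
class-λ = twoCol-class Sλ _ Rλ (λ _ → refl)
  (λ rev v′ vD v f (third , SU , ¬SL , ¬piv) →
    let p , q = overlap⇒ (to (last~upper rev) SU) in
    inner rev third , ZP.≰⇒> (λ le → ¬piv (from (upperInnerPivot∈last rev) (le , q))) , p)
  (λ { rev v′ vD@(_ , _ , v₂) v ((p , q) , r , r′) →
    let LT , UT = both-third vD v′ p q
        SU = ⇒overlap v v₂ r′ (ZP.≤-trans (ZP.<⇒≤ r) v) in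
    ((from (lower~third rev) LT , from (upper~third rev) UT)
      , from (last~upper rev) SU
      , (λ SL → ZP.<⇒≱ (ZP.<-trans (lower<upper vD) r) (proj₁ (overlap⇒ (to (last~lower rev) SL))))
      , (λ piv → ZP.<⇒≱ r (proj₁ (to (upperInnerPivot∈last rev) piv))))
    , not-last-lower LT UT SU })

class-μ : ∀ {cs} → InCls Sμ cs ⇔ Fam (TwoCol Rμ) cs
class-μ = twoCol-class Sμ _ Rμ (λ _ → refl)
  (λ { rev v′ vD@(v₁ , _ , _) v f (third , SU , ¬SL , piv) →
    let p , q = to (upperInnerPivot∈last rev) piv
        q′ = ZP.≤-trans v₁ (ZP.≤-trans (ZP.<⇒≤ (lower<upper vD)) q) in
    (inner rev third , p , q) , ZP.≰⇒> (λ le → ¬SL (from (last~lower rev) (⇒overlap v v₁ le q′))) })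
  (λ { rev v′ vD@(_ , _ , v₂) v (((p , q) , r , r′) , lt) →
    let LT , UT = both-third vD v′ p q
        SU = ⇒overlap v v₂ (ZP.≤-trans r v₂) r′ in
    ((from (lower~third rev) LT , from (upper~third rev) UT)
      , from (last~upper rev) SU
      , (λ SL → ZP.<⇒≱ lt (proj₁ (overlap⇒ (to (last~lower rev) SL))))
      , from (upperInnerPivot∈last rev) (r , r′))
    , not-last-lower LT UT SU })

-- Placing an extension relative to the last column

polyC : (List Col → Set) → Class
polyC P = record { Obj = List Col ; Valid = P ; wq = area ; wt = lastHeight ; ww = numDup }

distance : ∀ {b t} n → t ≡ b Z.+ + n → Z.∣ t Z.- b ∣ ≡ n
distance {b} n refl = cong Z.∣_∣ (cancel b (+ n))
  where
  cancel : ∀ b n → b Z.+ n Z.- b ≡ n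
  cancel = ZS.solve-∀

headBottom headTop : List Col → ℤ
headBottom [] = Z.0ℤ
headBottom (c ∷ _) = bottom c
headTop [] = Z.0ℤ
headTop (c ∷ _) = top c

lastBottom lastTop : List Col → ℤ
lastBottom cs = headBottom (reverse cs)
lastTop cs = headTop (reverse cs)

lastHeight-++ : ∀ pre e {l} → length e ≡ suc l → lastHeight (pre ++ e) ≡ lastHeight e
lastHeight-++ pre e len rewrite reverse-++ pre e with reverse e | length-reverse e
... | [] | len′ with () ← trans len′ len
... | c ∷ rs | _ = refl

-- Parameters `U` are unconstrained and marks `W` are bounded by the height `suc n` of the attaching
-- column; that height itself enters the weights only through `φ`. The constant length of `place`
-- allows the concatenation to be undone.
record Family (U : Class) (W : Set) (VW : ℕ → W → Set) (φ : ℕ → ℕ) (K : ℤ → ℤ → List Col → Set) : Set where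
  field
    place      : ℤ → ℤ → Obj U → W → List Col
    {columns}  : ℕ
    length≡    : ∀ b t u w → length (place b t u w) ≡ suc columns
    trivial    : ∀ u → Valid U u
    sound      : ∀ b n u w → VW (suc n) w → K b (b Z.+ + n) (place b (b Z.+ + n) u w)
    injective  : ∀ b n u u′ w w′ → place b (b Z.+ + n) u w ≡ place b (b Z.+ + n) u′ w′ → (u , w) ≡ (u′ , w′)
    surjective : ∀ b n e → K b (b Z.+ + n) e → ∃[ u ] ∃[ w ] (VW (suc n) w × place b (b Z.+ + n) u w ≡ e)
    area≡      : ∀ b n u w → area (place b (b Z.+ + n) u w) ≡ wq U u N.+ φ (suc n)
    height≡    : ∀ b n u w → lastHeight (place b (b Z.+ + n) u w) ≡ wt U u N.+ φ (suc n)
    duplex≡    : ∀ b n u w → numDup (place b (b Z.+ + n) u w) ≡ ww U u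

record Bounds (cs : List Col) : Set where
  constructor bounds
  field
    b       : ℤ
    n       : ℕ
    ends    : EndsIn cs b (b Z.+ + n)
    bottom≡ : lastBottom cs ≡ b
    top≡    : lastTop cs ≡ b Z.+ + n
    height≡ : lastHeight cs ≡ suc n

endsIn⇒bounds : ∀ {cs b t} → EndsIn cs b t → b Z.≤ t → Bounds cs
endsIn⇒bounds {cs} {b} ends@(ends-in e) v with n , refl ← ≤⇒∃+ v =
  bounds b n ends (cong headBottom e) (cong headTop e)
    (trans (cong headSize e) (cong suc (distance {b} n refl)))

InS⇒bounds : ∀ {cs} → InS cs → Bounds cs
InS⇒bounds s = let _ , _ , ends , v = InS-ends s in endsIn⇒bounds ends v

module _ {U W VW φ K} (F : Family U W VW φ K) where
  open Family F

  extend : Obj U × (List Col × W) → List Col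
  extend (u , cs , w) = cs ++ place (lastBottom cs) (lastTop cs) u w

  private
    C = U ⊗ markedC W VW φ

  extend-valid : ∀ {x n h d} → OfWeight C n h d x → OfWeight (polyC (Fam K)) n h d (extend x)
  extend-valid {u , cs , w} ((_ , s , vw) , refl , refl , refl) with InS⇒bounds s
  ... | bounds b k ends eb et eh rewrite eb | et | eh =
    fam ends s (x≤x+n b k) (sound b k u w vw) refl
    , (begin
        area (cs ++ e)                        ≡⟨ area-++ cs e ⟩
        area cs N.+ area e                    ≡⟨ cong (area cs N.+_) (area≡ b k u w) ⟩
        area cs N.+ (wq U u N.+ φ (suc k))    ≡⟨ swap (area cs) (wq U u) (φ (suc k)) ⟩
        wq U u N.+ (area cs N.+ φ (suc k))    ∎)
    , trans (lastHeight-++ cs e (length≡ b (b Z.+ + k) u w)) (height≡ b k u w)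
    , trans (numDup-++ cs e) (trans (cong (numDup cs N.+_) (duplex≡ b k u w)) (NP.+-comm (numDup cs) (ww U u)))
    where
    open ≡-Reasoning
    e = place b (b Z.+ + k) u w
    swap : ∀ x y z → x N.+ (y N.+ z) ≡ y N.+ (x N.+ z)
    swap = NS.solve-∀

  extend-injective : ∀ {x y} → Valid C x → Valid C y → extend x ≡ extend y → x ≡ y
  extend-injective {u , cs , w} {u′ , cs′ , w′} (_ , s , _) _ eq
    with refl , eq′ ← ++-injective cs cs′ (trans (length≡ _ _ u w) (sym (length≡ _ _ u′ w′))) eq
    with InS⇒bounds s
  ... | bounds b n _ eb et _ rewrite eb | et with refl ← injective b n u u′ w w′ eq′ = refl

  extend-surjective : ∀ {cs n h d} → OfWeight (polyC (Fam K)) n h d cs →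
                      ∃[ x ] (OfWeight C n h d x × extend x ≡ cs)
  extend-surjective {cs} (fam {pre} ends s v {e} k refl , refl , refl , refl) with endsIn⇒bounds ends v
  ... | bounds b n ends′ eb et eh with endsIn-unique ends ends′
  ... | refl , refl with surjective b n e k
  ... | u , w , vw , refl = (u , pre , w) , (valid-x , a , h , d) , ext≡
    where
    ext≡ : extend (u , pre , w) ≡ pre ++ place b (b Z.+ + n) u w
    ext≡ rewrite eb | et = refl
    valid-x : Valid C (u , pre , w)
    valid-x = trivial u , s , subst (λ k → VW k w) (sym eh) vw
    -- The weights of the preimage are not recomputed: `extend-valid` at its own weights is read
    -- backwards along `ext≡`.
    weights = extend-valid {u , pre , w} (valid-x , refl , refl , refl)
    a = trans (sym (proj₁ (proj₂ weights))) (cong area ext≡)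
    h = trans (sym (proj₁ (proj₂ (proj₂ weights)))) (cong lastHeight ext≡)
    d = trans (sym (proj₂ (proj₂ (proj₂ weights)))) (cong numDup ext≡)

  -- `extend` is a weight-preserving bijection from the product class onto the family, so an
  -- unconstrained parametrisation becomes a product of series.
  family-⊨ : ∀ {f g} → U ⊨ f → markedC W VW φ ⊨ g → polyC (Fam K) ⊨ f ⊛ g
  family-⊨ Uf g n h d =
    count-map extend extend-valid (λ (vx , _) (vy , _) → extend-injective vx vy) extend-surjective
      (⊗-⊨ Uf g n h d)

-- Reflection of an extension in the midline of the last column

flipCol : ℤ → Col → Col
flipCol σ (simp b t) = simp (σ Z.- t) (σ Z.- b)
flipCol σ (dup b₁ t₁ b₂ t₂) = dup (σ Z.- t₂) (σ Z.- b₂) (σ Z.- t₁) (σ Z.- b₁)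

flip² : ∀ σ x → σ Z.- (σ Z.- x) ≡ x
flip² = ZS.solve-∀

flipCol-involutive : ∀ σ c → flipCol σ (flipCol σ c) ≡ c
flipCol-involutive σ (simp b t) = cong₂ simp (flip² σ b) (flip² σ t)
flipCol-involutive σ (dup b₁ t₁ b₂ t₂)
  rewrite flip² σ b₁ | flip² σ t₁ | flip² σ b₂ | flip² σ t₂ = refl

flip-size : ∀ σ b t → suc Z.∣ (σ Z.- b) Z.- (σ Z.- t) ∣ ≡ suc Z.∣ t Z.- b ∣
flip-size σ b t = cong (λ z → suc Z.∣ z ∣) (cancel σ b t)
  where
  cancel : ∀ σ b t → (σ Z.- b) Z.- (σ Z.- t) ≡ t Z.- b
  cancel = ZS.solve-∀

size-flipCol : ∀ σ c → size (flipCol σ c) ≡ size c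
size-flipCol σ (simp b t) = flip-size σ b t
size-flipCol σ (dup b₁ t₁ b₂ t₂) =
  trans (cong₂ N._+_ (flip-size σ b₂ t₂) (flip-size σ b₁ t₁)) (NP.+-comm (suc Z.∣ t₂ Z.- b₂ ∣) _)

mirror : ℤ → List Col → List Col
mirror σ = map (flipCol σ)

mirror-involutive : ∀ σ e → mirror σ (mirror σ e) ≡ e
mirror-involutive σ [] = refl
mirror-involutive σ (c ∷ e) = cong₂ _∷_ (flipCol-involutive σ c) (mirror-involutive σ e)

area-mirror : ∀ σ e → area (mirror σ e) ≡ area e
area-mirror σ [] = refl
area-mirror σ (c ∷ e) = cong₂ N._+_ (size-flipCol σ c) (area-mirror σ e)

lastHeight-mirror : ∀ σ e → lastHeight (mirror σ e) ≡ lastHeight e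
lastHeight-mirror σ e rewrite sym (reverse-map (flipCol σ) e) with reverse e
... | [] = refl
... | c ∷ _ = size-flipCol σ c

numDup-mirror : ∀ σ e → numDup (mirror σ e) ≡ numDup e
numDup-mirror σ [] = refl
numDup-mirror σ (simp _ _ ∷ e) = numDup-mirror σ e
numDup-mirror σ (dup _ _ _ _ ∷ e) = cong suc (numDup-mirror σ e)

flip-≤ : ∀ σ {x y} → x Z.≤ y → σ Z.- y Z.≤ σ Z.- x
flip-≤ σ p = ZP.+-monoʳ-≤ σ (ZP.neg-mono-≤ p)

flip-< : ∀ σ {x y} → x Z.< y → σ Z.- y Z.< σ Z.- x
flip-< σ p = ZP.+-monoʳ-< σ (ZP.neg-mono-< p)

-- Demanded for every `σ`, because the relations are systems of inequalities and any reflection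
-- reverses these.
Reflects : TwoColRel → TwoColRel → Set
Reflects R R′ = ∀ σ {b′ t′ b₁ t₁ b₂ t₂ b t} → R b′ t′ b₁ t₁ b₂ t₂ b t →
  R′ (σ Z.- t′) (σ Z.- b′) (σ Z.- t₂) (σ Z.- b₂) (σ Z.- t₁) (σ Z.- b₁) (σ Z.- t) (σ Z.- b)

-- The reflection y ↦ b′ + t′ - y fixes the interval [b′, t′]. Hence the new columns can be
-- reflected while `pre` stays as it is.
mirror-TwoCol : ∀ {R R′} → Reflects R R′ → ∀ {b′ t′} e →
                TwoCol R b′ t′ e → TwoCol R′ b′ t′ (mirror (b′ Z.+ t′) e)
mirror-TwoCol {R} {R′} refl-R {b′} {t′} (dup b₁ t₁ b₂ t₂ ∷ simp b t ∷ []) ((v₁ , gap , v₂) , v , r) =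
  (flip-≤ σ v₂ , subst (Z._< σ Z.- t₁) (shift σ b₂) (below t₁ b₂ gap) , flip-≤ σ v₁)
  , flip-≤ σ v
  , subst₂ (λ x y → R′ x y (σ Z.- t₂) (σ Z.- b₂) (σ Z.- t₁) (σ Z.- b₁) (σ Z.- t) (σ Z.- b))
      (σ-t b′ t′) (σ-b b′ t′) (refl-R σ r)
  where
  σ = b′ Z.+ t′
  σ-t : ∀ b t → b Z.+ t Z.- t ≡ b
  σ-t = ZS.solve-∀
  σ-b : ∀ b t → b Z.+ t Z.- b ≡ t
  σ-b = ZS.solve-∀
  shift : ∀ σ x → σ Z.- (x Z.- Z.1ℤ) ≡ σ Z.- x Z.+ Z.1ℤ
  shift = ZS.solve-∀
  drop-1 : ∀ x → x Z.+ Z.1ℤ Z.- Z.1ℤ ≡ x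
  drop-1 = ZS.solve-∀
  below : ∀ x y → x Z.+ Z.1ℤ Z.< y → σ Z.- (y Z.- Z.1ℤ) Z.< σ Z.- x
  below x y p = flip-< σ (subst (Z._< y Z.- Z.1ℤ) (drop-1 x) (ZP.+-monoˡ-< (Z.- Z.1ℤ) p))

family-mirror : ∀ {U W VW φ R R′} → Reflects R R′ → Reflects R′ R →
                Family U W VW φ (TwoCol R) → Family U W VW φ (TwoCol R′)
family-mirror {U} {W} {VW} {φ} {R} {R′} R⇒R′ R′⇒R F = record
  { place      = λ b t u w → mirror (b Z.+ t) (place b t u w)
  ; length≡    = λ b t u w → trans (length-map (flipCol (b Z.+ t)) (place b t u w)) (length≡ b t u w)
  ; trivial    = trivial
  ; sound      = λ b n u w vw → mirror-TwoCol {R} {R′} R⇒R′ _ (sound b n u w vw)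
  ; injective  = λ b n u u′ w w′ e → injective b n u u′ w w′
      (trans (sym (mirror-involutive _ _)) (trans (cong (mirror (b Z.+ (b Z.+ + n))) e) (mirror-involutive _ _)))
  ; surjective = λ b n e k →
      let u , w , vw , eq = surjective b n (mirror (b Z.+ (b Z.+ + n)) e) (mirror-TwoCol {R′} {R} R′⇒R e k) in
      u , w , vw , trans (cong (mirror (b Z.+ (b Z.+ + n))) eq) (mirror-involutive _ e)
  ; area≡      = λ b n u w → trans (area-mirror _ (place b (b Z.+ + n) u w)) (area≡ b n u w)
  ; height≡    = λ b n u w → trans (lastHeight-mirror _ (place b (b Z.+ + n) u w)) (height≡ b n u w)
  ; duplex≡    = λ b n u w → trans (numDup-mirror _ (place b (b Z.+ + n) u w)) (duplex≡ b n u w)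
  }
  where open Family F

-- Integer offsets

i+n-n : ∀ i n → i Z.+ n Z.- n ≡ i
i+n-n = ZS.solve-∀

i-n+n : ∀ i n → i Z.- n Z.+ n ≡ i
i-n+n = ZS.solve-∀

+-offset-injective : ∀ x {m n} → x Z.+ + m ≡ x Z.+ + n → m ≡ n
+-offset-injective x {m} {n} e = ZP.+-injective (trans (sym (drop x (+ m))) (trans (cong (Z._- x) e) (drop x (+ n))))
  where
  drop : ∀ x m → x Z.+ m Z.- x ≡ m
  drop = ZS.solve-∀

-‿offset-injective : ∀ x {m n} → x Z.- + m ≡ x Z.- + n → m ≡ n
-‿offset-injective x {m} {n} e = ZP.+-injective (trans (sym (drop x (+ m))) (trans (cong (λ z → x Z.- z) e) (drop x (+ n))))
  where
  drop : ∀ x m → x Z.- (x Z.- m) ≡ m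
  drop = ZS.solve-∀

x-n≤x : ∀ x n → x Z.- + n Z.≤ x
x-n≤x x n = ZP.i≤j⇒i-k≤j (+ n) ZP.≤-refl

x<x+1+n : ∀ x n → x Z.< x Z.+ + suc n
x<x+1+n x n = subst (Z._< x Z.+ + suc n) (ZP.+-identityʳ x) (ZP.+-monoʳ-< x (Z.+<+ (s≤s z≤n)))

x-1-n<x : ∀ x n → x Z.- + suc n Z.< x
x-1-n<x x n = subst (x Z.- + suc n Z.<_) (i-n+n x (+ suc n)) (x<x+1+n (x Z.- + suc n) n)

+-offset-≤ : ∀ x {m n} → m N.≤ n → x Z.+ + m Z.≤ x Z.+ + n
+-offset-≤ x p = ZP.+-monoʳ-≤ x (Z.+≤+ p)

+-offset-< : ∀ x {m n} → m N.< n → x Z.+ + m Z.< x Z.+ + n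
+-offset-< x p = ZP.+-monoʳ-< x (Z.+<+ p)

+-offset-≤⁻ : ∀ x {m n} → x Z.+ + m Z.≤ x Z.+ + n → m N.≤ n
+-offset-≤⁻ x p = NP.≮⇒≥ λ lt → ZP.<⇒≱ (+-offset-< x lt) p

+-offset-<⁻ : ∀ x {m n} → x Z.+ + m Z.< x Z.+ + n → m N.< n
+-offset-<⁻ x p = NP.≰⇒> λ le → ZP.<⇒≱ p (+-offset-≤ x le)

≤⇒∃- : ∀ {x y} → x Z.≤ y → ∃[ n ] x ≡ y Z.- + n
≤⇒∃- {x} p with n , refl ← ≤⇒∃+ p = n , sym (i+n-n x (+ n))

<⇒∃+ : ∀ {x y} → x Z.< y → ∃[ n ] y ≡ x Z.+ + suc n
<⇒∃+ {x} p with ≤⇒∃+ (ZP.<⇒≤ p)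
... | zero , refl = ⊥-elim (ZP.<-irrefl (sym (ZP.+-identityʳ x)) p)
... | suc n , refl = n , refl

<⇒∃- : ∀ {x y} → x Z.< y → ∃[ n ] x ≡ y Z.- + suc n
<⇒∃- {x} p with n , refl ← <⇒∃+ p = n , sym (i+n-n x (+ suc n))

gap⇒∃+ : ∀ {x y} → x Z.+ Z.1ℤ Z.< y → ∃[ n ] y ≡ x Z.+ + suc (suc n)
gap⇒∃+ {x} p with n , refl ← <⇒∃+ p = n , ZP.+-assoc x Z.1ℤ (+ suc n)

gap⇒∃- : ∀ {x y} → x Z.+ Z.1ℤ Z.< y → ∃[ n ] x ≡ y Z.- + suc (suc n)
gap⇒∃- {x} p with n , refl ← gap⇒∃+ {x} p = n , sym (i+n-n x (+ suc (suc n)))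

gap-+ : ∀ x n → x Z.+ Z.1ℤ Z.< x Z.+ + suc (suc n)
gap-+ x n = ZP.+-monoʳ-< x (Z.+<+ (s≤s (s≤s z≤n)))

gap-between : ∀ {x y z} → x Z.< y → y Z.< z → x Z.+ Z.1ℤ Z.< z
gap-between {x} {y} p q = ZP.≤-<-trans (subst (Z._≤ y) (ZP.+-comm Z.1ℤ x) (ZP.i<j⇒suc[i]≤j p)) q

gap⇒< : ∀ {x y} → x Z.+ Z.1ℤ Z.< y → x Z.< y
gap⇒< {x} = ZP.≤-<-trans (x≤x+n x 1)

-- Last columns covering the hole of a duplex column

cols-injective : ∀ {b₁ t₁ b₂ t₂ b t b₁′ t₁′ b₂′ t₂′ b′ t′} →
  _≡_ {A = List Col} (dup b₁ t₁ b₂ t₂ ∷ simp b t ∷ []) (dup b₁′ t₁′ b₂′ t₂′ ∷ simp b′ t′ ∷ []) →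
  b₁ ≡ b₁′ × t₁ ≡ t₁′ × b₂ ≡ b₂′ × t₂ ≡ t₂′ × b ≡ b′ × t ≡ t′
cols-injective refl = refl , refl , refl , refl , refl , refl

-- The hole lies strictly between `t₁` and `b₂`. The other parameters are outward lengths from its
-- ends: `l`, `r` for the components, `i`, `j` for the last column.
bridgeCols : ℤ → ℤ → ℕ → ℕ → ℕ → ℕ → List Col
bridgeCols t₁ b₂ l r i j =
  dup (t₁ Z.- + l) t₁ b₂ (b₂ Z.+ + r) ∷ simp (t₁ Z.- + i) (b₂ Z.+ + j) ∷ []

Bridging : ℤ → ℤ → ℤ → ℤ → Set
Bridging t₁ b₂ b t = b Z.≤ t₁ × b₂ Z.≤ t

bridge-sound : ∀ (R : TwoColRel) b′ t′ t₁ b₂ l r i j → t₁ Z.+ Z.1ℤ Z.< b₂ →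
  (Bridging t₁ b₂ (t₁ Z.- + i) (b₂ Z.+ + j) →
   R b′ t′ (t₁ Z.- + l) t₁ b₂ (b₂ Z.+ + r) (t₁ Z.- + i) (b₂ Z.+ + j)) →
  TwoCol R b′ t′ (bridgeCols t₁ b₂ l r i j)
bridge-sound R b′ t′ t₁ b₂ l r i j gap k =
  (x-n≤x t₁ l , gap , x≤x+n b₂ r)
  , ZP.≤-trans (x-n≤x t₁ i) (ZP.≤-trans (ZP.<⇒≤ (gap⇒< {t₁} gap)) (x≤x+n b₂ j))
  , k (x-n≤x t₁ i , x≤x+n b₂ j)

bridge-injective : ∀ {t₁ b₂ l r i j t₁′ b₂′ l′ r′ i′ j′} →
  bridgeCols t₁ b₂ l r i j ≡ bridgeCols t₁′ b₂′ l′ r′ i′ j′ →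
  t₁ ≡ t₁′ × b₂ ≡ b₂′ × (l , r , i , j) ≡ (l′ , r′ , i′ , j′)
bridge-injective {t₁} {b₂} e with cols-injective e
... | e₁ , refl , refl , e₂ , e₃ , e₄
  with refl ← -‿offset-injective t₁ e₁ | refl ← +-offset-injective b₂ e₂
     | refl ← -‿offset-injective t₁ e₃ | refl ← +-offset-injective b₂ e₄ = refl , refl , refl

bridge-surjective : ∀ {b₁ t₁ b₂ t₂ b t} → b₁ Z.≤ t₁ → b₂ Z.≤ t₂ → Bridging t₁ b₂ b t →
  ∃[ l ] ∃[ r ] ∃[ i ] ∃[ j ] bridgeCols t₁ b₂ l r i j ≡ dup b₁ t₁ b₂ t₂ ∷ simp b t ∷ []
bridge-surjective v₁ v₂ (p , q)
  with l , refl ← ≤⇒∃- v₁ | r , refl ← ≤⇒∃+ v₂ | i , refl ← ≤⇒∃- p | j , refl ← ≤⇒∃+ q =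
  l , r , i , j , refl

module _ (t₁ b₂ : ℤ) (g l r i j : ℕ) (hole : b₂ ≡ t₁ Z.+ + g) where

  -- `g` is b₂ - t₁, one more than the number of cells of the hole. Widening the hole lengthens the
  -- last column but neither component.
  bridge-height : lastHeight (bridgeCols t₁ b₂ l r i j) ≡ suc (i N.+ g N.+ j)
  bridge-height = cong suc (distance (i N.+ g N.+ j)
    (trans (cong (λ z → z Z.+ + j) hole) (rearrange t₁ (+ g) (+ i) (+ j))))
    where
    rearrange : ∀ t g i j → t Z.+ g Z.+ j ≡ t Z.- i Z.+ (i Z.+ g Z.+ j)
    rearrange = ZS.solve-∀

  bridge-area : area (bridgeCols t₁ b₂ l r i j) ≡ suc l N.+ suc r N.+ (suc (i N.+ g N.+ j) N.+ 0)
  bridge-area = cong₂ N._+_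
    (cong₂ (λ x y → suc x N.+ suc y) (distance {t₁ Z.- + l} l (sym (i-n+n t₁ (+ l)))) (distance {b₂} r refl))
    (cong (N._+ 0) bridge-height)

coefficientC : ℕ → ℕ → ℕ → ℕ → ℕ → Class
coefficientC a b c k k′ = monoC a b c ⊗ powC QC k ⊗ powC QTC k′

-- The smallest extension has two one-cell components, a one-cell hole and a last column of three
-- cells, whence q⁵t³. The upper component reaches `p` below and `r` above the pivot row. As `p`
-- grows the hole moves down with b₂, so `p` adds nothing to the last column; this is the third
-- factor 1/(1 - q).
family-δ : Family (coefficientC 5 3 1 3 3) ⊤ Unmarked (λ _ → 0) (TwoCol Rδ)
family-δ = record
  { place      = place
  ; length≡    = λ _ _ _ _ → refl
  ; trivial    = λ _ → _
  ; sound      = λ { b n ((_ , l , r , p , _) , (i , g , j , _)) _ _ →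
      bridge-sound Rδ b (b Z.+ + n) (t₁ b p g) (b₂ b p) l (p N.+ r) i j (subst (t₁ b p g Z.+ Z.1ℤ Z.<_) (i-n+n (b₂ b p) (+ suc (suc g))) (gap-+ (t₁ b p g) g))
        ((x-n≤x b p , subst (b Z.≤_) (sym (rejoin b (+ p) (+ r))) (x≤x+n b r)) ,_) }
  ; injective  = λ { b n ((_ , l , r , p , _) , (i , g , j , _)) ((_ , l′ , r′ , p′ , _) , (i′ , g′ , j′ , _)) _ _ e →
      injective b l r p i g j l′ r′ p′ i′ g′ j′ e }
  ; surjective = λ { b n (dup _ t₁ b₂ t₂ ∷ simp _ _ ∷ []) ((v₁ , gap , v₂) , _ , (p , q) , br) →
      surjective b v₁ gap v₂ p q br }
  ; area≡      = λ { b n ((_ , l , r , p , _) , (i , g , j , _)) _ →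
      trans (bridge-area (t₁ b p g) (b₂ b p) (suc (suc g)) l (p N.+ r) i j (sym (i-n+n (b₂ b p) (+ suc (suc g))))) (area-δ l r p i g j) }
  ; height≡    = λ { b n ((_ , l , r , p , _) , (i , g , j , _)) _ →
      trans (bridge-height (t₁ b p g) (b₂ b p) (suc (suc g)) l (p N.+ r) i j (sym (i-n+n (b₂ b p) (+ suc (suc g))))) (height-δ i g j) }
  ; duplex≡    = λ _ _ _ _ → refl
  }
  where
  b₂ : ℤ → ℕ → ℤ
  b₂ b p = b Z.- + p
  t₁ : ℤ → ℕ → ℕ → ℤ
  t₁ b p g = b₂ b p Z.- + suc (suc g)
  place : ℤ → ℤ → Obj (coefficientC 5 3 1 3 3) → ⊤ → List Col
  place b t ((_ , l , r , p , _) , (i , g , j , _)) _ = bridgeCols (t₁ b p g) (b₂ b p) l (p N.+ r) i j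
  rejoin : ∀ b p r → b Z.- p Z.+ (p Z.+ r) ≡ b Z.+ r
  rejoin = ZS.solve-∀
  injective : ∀ b l r p i g j l′ r′ p′ i′ g′ j′ →
    bridgeCols (t₁ b p g) (b₂ b p) l (p N.+ r) i j ≡ bridgeCols (t₁ b p′ g′) (b₂ b p′) l′ (p′ N.+ r′) i′ j′ →
    (((tt , l , r , p , tt) , (i , g , j , tt)) , tt) ≡ (((tt , l′ , r′ , p′ , tt) , (i′ , g′ , j′ , tt)) , tt)
  injective b l r p i g j l′ r′ p′ i′ g′ j′ e with bridge-injective e
  ... | e₁ , e₂ , e₃ with refl ← -‿offset-injective b {p} {p′} e₂
    with refl ← -‿offset-injective (b₂ b p) {suc (suc g)} {suc (suc g′)} e₁
    with refl ← cong proj₁ e₃ | refl ← NP.+-cancelˡ-≡ p r r′ (cong (proj₁ ∘ proj₂) e₃)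
    with refl ← cong (proj₂ ∘ proj₂) e₃ = refl
  surjective : ∀ b′ {b₁ t₁ b₂ t₂ b t} → b₁ Z.≤ t₁ → t₁ Z.+ Z.1ℤ Z.< b₂ → b₂ Z.≤ t₂ → b₂ Z.≤ b′ → b′ Z.≤ t₂ →
    Bridging t₁ b₂ b t →
    ∃[ u ] ∃[ w ] (⊤ × place b′ b′ u w ≡ dup b₁ t₁ b₂ t₂ ∷ simp b t ∷ [])
  surjective b′ {t₁ = t₁} v₁ gap v₂ p≤ q≤ (b≤ , ≤t)
    with p , refl ← ≤⇒∃- p≤ | r , refl ← ≤⇒∃+ q≤ | l , refl ← ≤⇒∃- v₁ | i , refl ← ≤⇒∃- b≤ | j , refl ← ≤⇒∃+ ≤t
    with g , refl ← gap⇒∃- {t₁} gap =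
    ((tt , l , r , p , tt) , (i , g , j , tt)) , tt , tt ,
    cong (λ z → dup _ _ _ z ∷ _) (rejoin b′ (+ p) (+ r))
  area-δ : ∀ l r p i g j → suc l N.+ suc (p N.+ r) N.+ (suc (i N.+ suc (suc g) N.+ j) N.+ 0)
           ≡ 5 N.+ (l N.+ (r N.+ (p N.+ 0))) N.+ (i N.+ (g N.+ (j N.+ 0))) N.+ 0
  area-δ = NS.solve-∀
  height-δ : ∀ i g j → suc (i N.+ suc (suc g) N.+ j) ≡ 3 N.+ (i N.+ (g N.+ (j N.+ 0))) N.+ 0
  height-δ = NS.solve-∀

-- Bridged holes: last columns meeting both components

powC-trivial : ∀ {C} → (∀ x → Valid C x) → ∀ k x → Valid (powC C k) x
powC-trivial v zero _ = tt
powC-trivial v (suc k) (x , xs) = v x , powC-trivial v k xs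

powC-QTC-wq≡wt : ∀ k ρ → wq (powC QTC k) ρ ≡ wt (powC QTC k) ρ
powC-QTC-wq≡wt zero _ = refl
powC-QTC-wq≡wt (suc k) (x , ρ) = cong (x N.+_) (powC-QTC-wq≡wt k ρ)

BridgeOver : (ℤ → ℤ → ℤ → ℤ → Set) → TwoColRel
BridgeOver P b′ t′ b₁ t₁ b₂ t₂ b t = P b′ t′ t₁ b₂ × b Z.≤ t₁ × b₂ Z.≤ t

-- Parametrisations of the hole ]t₁, b₂[ alone; the remaining four parameters
-- of a bridge over it are free.
record Holes (k a : ℕ) (W : Set) (VW : ℕ → W → Set) (φ : ℕ → ℕ) (P : ℤ → ℤ → ℤ → ℤ → Set) : Set where
  field
    low high   : ℤ → ℤ → Obj (powC QTC k) → W → ℤ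
    width      : ∀ b n ρ w → high b (b Z.+ + n) ρ w
                   ≡ low b (b Z.+ + n) ρ w Z.+ + (a N.+ wq (powC QTC k) ρ N.+ φ (suc n))
    gap        : ∀ b n ρ w → VW (suc n) w → low b (b Z.+ + n) ρ w Z.+ Z.1ℤ Z.< high b (b Z.+ + n) ρ w
    sound      : ∀ b n ρ w → VW (suc n) w → P b (b Z.+ + n) (low b (b Z.+ + n) ρ w) (high b (b Z.+ + n) ρ w)
    injective  : ∀ b n ρ ρ′ w w′ → low b (b Z.+ + n) ρ w ≡ low b (b Z.+ + n) ρ′ w′ →
                 high b (b Z.+ + n) ρ w ≡ high b (b Z.+ + n) ρ′ w′ → (ρ , w) ≡ (ρ′ , w′)
    surjective : ∀ b n t₁ b₂ → t₁ Z.+ Z.1ℤ Z.< b₂ → P b (b Z.+ + n) t₁ b₂ →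
                 ∃[ ρ ] ∃[ w ] (VW (suc n) w × low b (b Z.+ + n) ρ w ≡ t₁ × high b (b Z.+ + n) ρ w ≡ b₂)

-- The distance b₂ - t₁ enters area and height equally, hence `a` in both exponents and `k` factors
-- 1/(1 - qt). Besides it there are the first cells of the two components and of the last column,
-- and the free lengths `l`, `r` and `i`, `j`.
family-bridge : ∀ {k a W VW φ P} → Holes k a W VW φ P →
                Family (coefficientC (3 N.+ a) (1 N.+ a) 1 2 (2 N.+ k)) W VW φ (TwoCol (BridgeOver P))
family-bridge {k} {a} {W} {VW} {φ} {P} H = record
  { place      = place
  ; length≡    = λ _ _ _ _ → refl
  ; trivial    = λ { (_ , (_ , _ , ρ)) → (_ , _) , (_ , _ , powC-trivial (λ _ → tt) k ρ) }
  ; sound      = λ { b n ((_ , l , r , _) , (i , j , ρ)) w vw →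
      bridge-sound (BridgeOver P) b (b Z.+ + n) _ _ l r i j (H.gap b n ρ w vw) (H.sound b n ρ w vw ,_) }
  ; injective  = λ { b n ((_ , l , r , _) , (i , j , ρ)) ((_ , l′ , r′ , _) , (i′ , j′ , ρ′)) w w′ e →
      injective b n l r i j ρ w l′ r′ i′ j′ ρ′ w′ e }
  ; surjective = λ { b n (dup _ _ _ _ ∷ simp _ _ ∷ []) ((v₁ , gap , v₂) , _ , p , br) →
      surjective b n v₁ gap v₂ p br }
  ; area≡      = λ { b n ((_ , l , r , _) , (i , j , ρ)) w →
      trans (bridge-area (H.low b (b Z.+ + n) ρ w) (H.high b (b Z.+ + n) ρ w) _ l r i j (H.width b n ρ w)) (areas a l r i j (wq (powC QTC k) ρ) (φ (suc n))) }
  ; height≡    = λ { b n ((_ , l , r , _) , (i , j , ρ)) w →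
      trans (bridge-height (H.low b (b Z.+ + n) ρ w) (H.high b (b Z.+ + n) ρ w) _ l r i j (H.width b n ρ w))
        (trans (heights a i j (wq (powC QTC k) ρ) (φ (suc n)))
               (cong (λ z → suc a N.+ 0 N.+ (i N.+ (j N.+ z)) N.+ φ (suc n)) (powC-QTC-wq≡wt k ρ))) }
  ; duplex≡    = λ { _ _ (_ , (_ , _ , ρ)) _ → sym (cong suc (no-duplex k ρ)) }
  }
  where
  module H = Holes H
  place : ℤ → ℤ → Obj (coefficientC (3 N.+ a) (1 N.+ a) 1 2 (2 N.+ k)) → W → List Col
  place b t ((_ , l , r , _) , (i , j , ρ)) w = bridgeCols (H.low b t ρ w) (H.high b t ρ w) l r i j
  injective : ∀ b n l r i j ρ w l′ r′ i′ j′ ρ′ w′ →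
    place b (b Z.+ + n) ((tt , l , r , tt) , (i , j , ρ)) w ≡ place b (b Z.+ + n) ((tt , l′ , r′ , tt) , (i′ , j′ , ρ′)) w′ →
    (((tt , l , r , tt) , (i , j , ρ)) , w) ≡ (((tt , l′ , r′ , tt) , (i′ , j′ , ρ′)) , w′)
  injective b n l r i j ρ w l′ r′ i′ j′ ρ′ w′ e with bridge-injective e
  ... | e₁ , e₂ , refl with refl ← H.injective b n ρ ρ′ w w′ e₁ e₂ = refl
  surjective : ∀ b′ n {b₁ t₁ b₂ t₂ b t} → b₁ Z.≤ t₁ → t₁ Z.+ Z.1ℤ Z.< b₂ → b₂ Z.≤ t₂ → P b′ (b′ Z.+ + n) t₁ b₂ →
    Bridging t₁ b₂ b t →
    ∃[ u ] ∃[ w ] (VW (suc n) w × place b′ (b′ Z.+ + n) u w ≡ dup b₁ t₁ b₂ t₂ ∷ simp b t ∷ [])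
  surjective b′ n v₁ gap v₂ p br with bridge-surjective v₁ v₂ br | H.surjective b′ n _ _ gap p
  ... | l , r , i , j , e | ρ , w , vw , refl , refl = ((tt , l , r , tt) , (i , j , ρ)) , w , vw , e
  areas : ∀ a l r i j x y → suc l N.+ suc r N.+ (suc (i N.+ (a N.+ x N.+ y) N.+ j) N.+ 0)
          ≡ 3 N.+ a N.+ (l N.+ (r N.+ 0)) N.+ (i N.+ (j N.+ x)) N.+ y
  areas = NS.solve-∀
  heights : ∀ a i j x y → suc (i N.+ (a N.+ x N.+ y) N.+ j) ≡ suc a N.+ 0 N.+ (i N.+ (j N.+ x)) N.+ y
  heights = NS.solve-∀
  no-duplex : ∀ k ρ → ww (powC QTC k) ρ ≡ 0
  no-duplex zero _ = refl
  no-duplex (suc k) (_ , ρ) = no-duplex k ρ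

Pη : ℤ → ℤ → ℤ → ℤ → Set
Pη b′ t′ t₁ b₂ = t₁ Z.< t′ × t′ Z.< b₂

-- Both ends of the hole are measured from the pivot row t′, at distance at least one each. Letting
-- t₁ pass below b′ is what frees the second distance.
holes-η : Holes 2 2 ⊤ Unmarked (λ _ → 0) Pη
holes-η = record
  { low        = λ { b t (x , y , _) _ → t Z.- + suc y }
  ; high       = λ { b t (x , y , _) _ → t Z.+ + suc x }
  ; width      = λ { b n (x , y , _) _ →
      trans (width (b Z.+ + n) (+ suc x) (+ suc y)) (cong (λ z → b Z.+ + n Z.- + suc y Z.+ + z) (sum x y)) }
  ; gap        = λ { b n (x , y , _) _ _ → gap-between (x-1-n<x (b Z.+ + n) y) (x<x+1+n (b Z.+ + n) x) }
  ; sound      = λ { b n (x , y , _) _ _ → x-1-n<x (b Z.+ + n) y , x<x+1+n (b Z.+ + n) x }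
  ; injective  = λ { b n (x , y , _) (x′ , y′ , _) _ _ e e′ → injective b n x y x′ y′ e e′ }
  ; surjective = λ { b n t₁ b₂ _ (p , q) → surjective p q }
  }
  where
  width : ∀ t x y → t Z.+ x ≡ t Z.- y Z.+ (x Z.+ y)
  width = ZS.solve-∀
  sum : ∀ x y → suc x N.+ suc y ≡ 2 N.+ (x N.+ (y N.+ 0)) N.+ 0
  sum = NS.solve-∀
  injective : ∀ b n x y x′ y′ → b Z.+ + n Z.- + suc y ≡ b Z.+ + n Z.- + suc y′ →
              b Z.+ + n Z.+ + suc x ≡ b Z.+ + n Z.+ + suc x′ → ((x , y , tt) , tt) ≡ ((x′ , y′ , tt) , tt)
  injective b n x y x′ y′ e e′
    with refl ← -‿offset-injective (b Z.+ + n) {suc y} {suc y′} e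
       | refl ← +-offset-injective (b Z.+ + n) {suc x} {suc x′} e′ = refl
  surjective : ∀ {t t₁ b₂} → t₁ Z.< t → t Z.< b₂ →
               ∃[ ρ ] ∃[ w ] (⊤ × t Z.- + suc (proj₁ (proj₂ ρ)) ≡ t₁ × t Z.+ + suc (proj₁ ρ) ≡ b₂)
  surjective p q with y , refl ← <⇒∃- p | x , refl ← <⇒∃+ q = (x , y , tt) , tt , tt , refl , refl

Pouter : ℤ → ℤ → ℤ → ℤ → Set
Pouter b′ t′ t₁ b₂ = t₁ Z.< b′ × t′ Z.< b₂

-- Here b₂ - t₁ equals (suc n) + 1 + x + y: the height of the covered column adds to the new area
-- and height, which is the substitution t ↦ qt and the reason for `φ = id`.
holes-outer : Holes 2 1 ⊤ Unmarked id Pouter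
holes-outer = record
  { low        = λ { b t (x , y , _) _ → b Z.- + suc y }
  ; high       = λ { b t (x , y , _) _ → t Z.+ + suc x }
  ; width      = λ { b n (x , y , _) _ →
      trans (width b (+ n) (+ suc x) (+ suc y)) (cong (λ z → b Z.- + suc y Z.+ + z) (sum n x y)) }
  ; gap        = λ { b n (x , y , _) _ _ → gap-between (x-1-n<x b y) (above b n x) }
  ; sound      = λ { b n (x , y , _) _ _ → x-1-n<x b y , x<x+1+n (b Z.+ + n) x }
  ; injective  = λ { b n (x , y , _) (x′ , y′ , _) _ _ e e′ → injective b n x y x′ y′ e e′ }
  ; surjective = λ { b n t₁ b₂ _ (p , q) → surjective p q }
  }
  where
  width : ∀ b n x y → b Z.+ n Z.+ x ≡ b Z.- y Z.+ (n Z.+ x Z.+ y)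
  width = ZS.solve-∀
  sum : ∀ n x y → n N.+ suc x N.+ suc y ≡ 1 N.+ (x N.+ (y N.+ 0)) N.+ suc n
  sum = NS.solve-∀
  above : ∀ b n x → b Z.< b Z.+ + n Z.+ + suc x
  above b n x = ZP.≤-<-trans (x≤x+n b n) (x<x+1+n (b Z.+ + n) x)
  injective : ∀ b n x y x′ y′ → b Z.- + suc y ≡ b Z.- + suc y′ →
              b Z.+ + n Z.+ + suc x ≡ b Z.+ + n Z.+ + suc x′ → ((x , y , tt) , tt) ≡ ((x′ , y′ , tt) , tt)
  injective b n x y x′ y′ e e′
    with refl ← -‿offset-injective b {suc y} {suc y′} e
       | refl ← +-offset-injective (b Z.+ + n) {suc x} {suc x′} e′ = refl
  surjective : ∀ {b t t₁ b₂} → t₁ Z.< b → t Z.< b₂ →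
               ∃[ ρ ] ∃[ w ] (⊤ × b Z.- + suc (proj₁ (proj₂ ρ)) ≡ t₁ × t Z.+ + suc (proj₁ ρ) ≡ b₂)
  surjective p q with y , refl ← <⇒∃- p | x , refl ← <⇒∃+ q = (x , y , tt) , tt , tt , refl , refl

Pθη : ℤ → ℤ → ℤ → ℤ → Set
Pθη b′ t′ t₁ b₂ = b′ Z.≤ t₁ × t₁ Z.< t′

-- The mark fixes t₁ among the rows of [b′, t′] below the top, and b₂ is free above it. Whether b₂
-- stays within the column is left open, so the width is independent of n.
holes-θη : Holes 1 2 ℕ Marked (λ _ → 0) Pθη
holes-θη = record
  { low        = λ b t _ u → b Z.+ + u
  ; high       = λ { b t (g , _) u → b Z.+ + u Z.+ + suc (suc g) }
  ; width      = λ { b n (g , _) u → cong (λ z → b Z.+ + u Z.+ + z) (sum g) }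
  ; gap        = λ { b n (g , _) u _ → gap-+ (b Z.+ + u) g }
  ; sound      = λ { b n (g , _) u (s≤s u<n) → x≤x+n b u , +-offset-< b u<n }
  ; injective  = λ { b n (g , _) (g′ , _) u u′ e e′ → injective b g g′ u u′ e e′ }
  ; surjective = λ { b n t₁ b₂ gap (p , q) → surjective b n gap p q }
  }
  where
  sum : ∀ g → suc (suc g) ≡ 2 N.+ (g N.+ 0) N.+ 0
  sum = NS.solve-∀
  injective : ∀ b g g′ u u′ → b Z.+ + u ≡ b Z.+ + u′ →
              b Z.+ + u Z.+ + suc (suc g) ≡ b Z.+ + u′ Z.+ + suc (suc g′) → ((g , tt) , u) ≡ ((g′ , tt) , u′)
  injective b g g′ u u′ e e′ with refl ← +-offset-injective b {u} {u′} e
    with refl ← +-offset-injective (b Z.+ + u) {suc (suc g)} {suc (suc g′)} e′ = refl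
  surjective : ∀ b n {t₁ b₂} → t₁ Z.+ Z.1ℤ Z.< b₂ → b Z.≤ t₁ → t₁ Z.< b Z.+ + n →
               ∃[ ρ ] ∃[ u ] (Marked (suc n) u × b Z.+ + u ≡ t₁ × b Z.+ + u Z.+ + suc (suc (proj₁ ρ)) ≡ b₂)
  surjective b n {t₁} gap p q with g , refl ← gap⇒∃+ {t₁} gap | u , refl ← ≤⇒∃+ p =
    (g , tt) , u , s≤s (+-offset-<⁻ b q) , refl , refl

-- Holes whose two ends lie in the attaching column

inner-gap : ∀ b {u v} → u N.< v → b Z.+ + u Z.+ Z.1ℤ Z.< b Z.+ + suc v
inner-gap b {u} {v} p =
  subst (Z._< b Z.+ + suc v) (sym (ZP.+-assoc b (+ u) Z.1ℤ))
    (+-offset-< b (subst (N._< suc v) (NP.+-comm 1 u) (s≤s p)))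

inner-surjective : ∀ b n {t₁ b₂} → t₁ Z.+ Z.1ℤ Z.< b₂ → b Z.≤ t₁ → b₂ Z.≤ b Z.+ + n →
  ∃[ u ] ∃[ v ] (MarkedPair (suc n) (u , v) × b Z.+ + u ≡ t₁ × b Z.+ + suc v ≡ b₂)
inner-surjective b n {t₁} gap p q with <⇒∃+ (ZP.≤-<-trans p (gap⇒< {t₁} gap)) | ≤⇒∃+ p
... | v , refl | u , refl =
  u , v , (N.s≤s⁻¹ (subst (N._< suc v) (NP.+-comm u 1) (+-offset-<⁻ b (subst (Z._< b Z.+ + suc v) (ZP.+-assoc b (+ u) Z.1ℤ) gap)))
          , s≤s (+-offset-≤⁻ b q))
  , refl , refl

Rκθ : TwoColRel
Rκθ b′ t′ b₁ t₁ b₂ t₂ b t = (b′ Z.≤ t₁ × b₂ Z.≤ t′) × b Z.≤ t₁ × t₁ Z.≤ t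

-- The last column is anchored at row t₁, reaching `i` below and `j` above. Since it need not span
-- the hole, the two ends of the hole are pure marks, and the smallest case is two one-cell
-- components and one last cell, q³t.
family-κθ : Family (coefficientC 3 1 1 2 2) (ℕ × ℕ) MarkedPair (λ _ → 0) (TwoCol Rκθ)
family-κθ = record
  { place      = place
  ; length≡    = λ _ _ _ _ → refl
  ; trivial    = λ _ → _
  ; sound      = λ { b n ((_ , l , r , _) , (i , j , _)) (u , v) (u<v , s≤s v<n) →
      (x-n≤x (b Z.+ + u) l , inner-gap b u<v , x≤x+n (b Z.+ + suc v) r)
      , ZP.≤-trans (x-n≤x (b Z.+ + u) i) (x≤x+n (b Z.+ + u) j)
      , (x≤x+n b u , +-offset-≤ b v<n)
      , x-n≤x (b Z.+ + u) i , x≤x+n (b Z.+ + u) j }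
  ; injective  = λ { b n ((_ , l , r , _) , (i , j , _)) ((_ , l′ , r′ , _) , (i′ , j′ , _)) (u , v) (u′ , v′) e →
      injective b l r i j u v l′ r′ i′ j′ u′ v′ (cols-injective e) }
  ; surjective = λ { b n (dup _ _ _ _ ∷ simp _ _ ∷ []) ((v₁ , gap , v₂) , _ , (p , q) , p′ , q′) →
      surjective b n v₁ gap v₂ p q p′ q′ }
  ; area≡      = λ { b n ((_ , l , r , _) , (i , j , _)) (u , v) →
      trans (cong₂ N._+_
               (cong₂ (λ x y → suc x N.+ suc y) (distance {b Z.+ + u Z.- + l} l (sym (i-n+n (b Z.+ + u) (+ l))))
                                                (distance {b Z.+ + suc v} r refl))
               (cong (λ x → suc x N.+ 0) (spread (b Z.+ + u) i j)))
            (areas l r i j) }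
  ; height≡    = λ { b n ((_ , l , r , _) , (i , j , _)) (u , v) →
      trans (cong suc (spread (b Z.+ + u) i j)) (heights i j) }
  ; duplex≡    = λ _ _ _ _ → refl
  }
  where
  place : ℤ → ℤ → Obj (coefficientC 3 1 1 2 2) → ℕ × ℕ → List Col
  place b t ((_ , l , r , _) , (i , j , _)) (u , v) =
    dup (b Z.+ + u Z.- + l) (b Z.+ + u) (b Z.+ + suc v) (b Z.+ + suc v Z.+ + r)
    ∷ simp (b Z.+ + u Z.- + i) (b Z.+ + u Z.+ + j) ∷ []
  spread : ∀ x i j → Z.∣ x Z.+ + j Z.- (x Z.- + i) ∣ ≡ i N.+ j
  spread x i j = distance {x Z.- + i} (i N.+ j) (rearrange x (+ i) (+ j))
    where
    rearrange : ∀ x i j → x Z.+ j ≡ x Z.- i Z.+ (i Z.+ j)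
    rearrange = ZS.solve-∀
  injective : ∀ b l r i j u v l′ r′ i′ j′ u′ v′ → let t₁ = b Z.+ + u ; t₁′ = b Z.+ + u′ in
    t₁ Z.- + l ≡ t₁′ Z.- + l′ × t₁ ≡ t₁′ × b Z.+ + suc v ≡ b Z.+ + suc v′ ×
    b Z.+ + suc v Z.+ + r ≡ b Z.+ + suc v′ Z.+ + r′ × t₁ Z.- + i ≡ t₁′ Z.- + i′ × t₁ Z.+ + j ≡ t₁′ Z.+ + j′ →
    (((tt , l , r , tt) , (i , j , tt)) , (u , v)) ≡ (((tt , l′ , r′ , tt) , (i′ , j′ , tt)) , (u′ , v′))
  injective b l r i j u v l′ r′ i′ j′ u′ v′ (e₁ , e₂ , e₃ , e₄ , e₅ , e₆)
    with refl ← +-offset-injective b {u} {u′} e₂ | refl ← +-offset-injective b {suc v} {suc v′} e₃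
    with refl ← -‿offset-injective (b Z.+ + u) {l} {l′} e₁ | refl ← +-offset-injective (b Z.+ + suc v) {r} {r′} e₄
       | refl ← -‿offset-injective (b Z.+ + u) {i} {i′} e₅ | refl ← +-offset-injective (b Z.+ + u) {j} {j′} e₆ = refl
  surjective : ∀ b′ n {b₁ t₁ b₂ t₂ b t} → b₁ Z.≤ t₁ → t₁ Z.+ Z.1ℤ Z.< b₂ → b₂ Z.≤ t₂ →
    b′ Z.≤ t₁ → b₂ Z.≤ b′ Z.+ + n → b Z.≤ t₁ → t₁ Z.≤ t →
    ∃[ u ] ∃[ w ] (MarkedPair (suc n) w × place b′ (b′ Z.+ + n) u w ≡ dup b₁ t₁ b₂ t₂ ∷ simp b t ∷ [])
  surjective b′ n v₁ gap v₂ p q p′ q′ with inner-surjective b′ n gap p q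
  ... | u , v , m , refl , refl
    with l , refl ← ≤⇒∃- v₁ | r , refl ← ≤⇒∃+ v₂ | i , refl ← ≤⇒∃- p′ | j , refl ← ≤⇒∃+ q′ =
    ((tt , l , r , tt) , (i , j , tt)) , (u , v) , m , refl
  areas : ∀ l r i j → suc l N.+ suc r N.+ (suc (i N.+ j) N.+ 0)
          ≡ 3 N.+ (l N.+ (r N.+ 0)) N.+ (i N.+ (j N.+ 0)) N.+ 0
  areas = NS.solve-∀
  heights : ∀ i j → suc (i N.+ j) ≡ 1 N.+ (i N.+ (j N.+ 0)) N.+ 0
  heights = NS.solve-∀

-- The last column ends at t = t₁ - (p + 1), so the lower component has at least the two rows t and
-- t₁; this gives q⁴t. The parameters `p`, `l`, `r` lengthen components and only `i` lengthens the
-- last column.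
family-ι : Family (monoC 4 1 1 ⊗ powC QC 3 ⊗ QTC) (ℕ × ℕ) MarkedPair (λ _ → 0) (TwoCol Rι)
family-ι = record
  { place      = place
  ; length≡    = λ _ _ _ _ → refl
  ; trivial    = λ _ → _
  ; sound      = λ { b n ((_ , l , r , p , _) , i) (u , v) (u<v , s≤s v<n) →
      let t₁ = b Z.+ + u ; t = t₁ Z.- + suc p ; t<t₁ = x-1-n<x t₁ p in
      (ZP.≤-trans (x-n≤x t l) (ZP.<⇒≤ t<t₁) , inner-gap b u<v , x≤x+n (b Z.+ + suc v) r)
      , x-n≤x t i
      , (x≤x+n b u , +-offset-≤ b v<n)
      , x-n≤x t l , t<t₁ }
  ; injective  = λ { b n ((_ , l , r , p , _) , i) ((_ , l′ , r′ , p′ , _) , i′) (u , v) (u′ , v′) e →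
      injective b l r p i u v l′ r′ p′ i′ u′ v′ (cols-injective e) }
  ; surjective = λ { b n (dup _ _ _ _ ∷ simp _ _ ∷ []) ((v₁ , gap , v₂) , v , (p , q) , p′ , q′) →
      surjective b n gap v₂ v p q p′ q′ }
  ; area≡      = λ { b n ((_ , l , r , p , _) , i) (u , v) →
      let t = b Z.+ + u Z.- + suc p in
      trans (cong₂ N._+_
               (cong₂ (λ x y → suc x N.+ suc y) (lower-size (b Z.+ + u) p l) (distance {b Z.+ + suc v} r refl))
               (cong (λ x → suc x N.+ 0) (distance {t Z.- + i} i (sym (i-n+n t (+ i))))))
            (areas l r p i) }
  ; height≡    = λ { b n ((_ , l , r , p , _) , i) (u , v) →
      let t = b Z.+ + u Z.- + suc p in
      trans (cong suc (distance {t Z.- + i} i (sym (i-n+n t (+ i))))) (cong suc (sym (NP.+-identityʳ i))) }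
  ; duplex≡    = λ _ _ _ _ → refl
  }
  where
  place : ℤ → ℤ → Obj (monoC 4 1 1 ⊗ powC QC 3 ⊗ QTC) → ℕ × ℕ → List Col
  place b t ((_ , l , r , p , _) , i) (u , v) =
    dup (b Z.+ + u Z.- + suc p Z.- + l) (b Z.+ + u) (b Z.+ + suc v) (b Z.+ + suc v Z.+ + r)
    ∷ simp (b Z.+ + u Z.- + suc p Z.- + i) (b Z.+ + u Z.- + suc p) ∷ []
  lower-size : ∀ x p l → Z.∣ x Z.- (x Z.- + suc p Z.- + l) ∣ ≡ suc p N.+ l
  lower-size x p l = distance {x Z.- + suc p Z.- + l} (suc p N.+ l) (rearrange x (+ suc p) (+ l))
    where
    rearrange : ∀ x p l → x ≡ x Z.- p Z.- l Z.+ (p Z.+ l)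
    rearrange = ZS.solve-∀
  injective : ∀ b l r p i u v l′ r′ p′ i′ u′ v′ →
    let t₁ = b Z.+ + u ; t₁′ = b Z.+ + u′ ; t = t₁ Z.- + suc p ; t′ = t₁′ Z.- + suc p′ in
    t Z.- + l ≡ t′ Z.- + l′ × t₁ ≡ t₁′ × b Z.+ + suc v ≡ b Z.+ + suc v′ ×
    b Z.+ + suc v Z.+ + r ≡ b Z.+ + suc v′ Z.+ + r′ × t Z.- + i ≡ t′ Z.- + i′ × t ≡ t′ →
    (((tt , l , r , p , tt) , i) , (u , v)) ≡ (((tt , l′ , r′ , p′ , tt) , i′) , (u′ , v′))
  injective b l r p i u v l′ r′ p′ i′ u′ v′ (e₁ , e₂ , e₃ , e₄ , e₅ , e₆)
    with refl ← +-offset-injective b {u} {u′} e₂ | refl ← +-offset-injective b {suc v} {suc v′} e₃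
    with refl ← -‿offset-injective (b Z.+ + u) {suc p} {suc p′} e₆
       | refl ← +-offset-injective (b Z.+ + suc v) {r} {r′} e₄
    with refl ← -‿offset-injective (b Z.+ + u Z.- + suc p) {l} {l′} e₁
       | refl ← -‿offset-injective (b Z.+ + u Z.- + suc p) {i} {i′} e₅ = refl
  surjective : ∀ b′ n {b₁ t₁ b₂ t₂ b t} → t₁ Z.+ Z.1ℤ Z.< b₂ → b₂ Z.≤ t₂ → b Z.≤ t →
    b′ Z.≤ t₁ → b₂ Z.≤ b′ Z.+ + n → b₁ Z.≤ t → t Z.< t₁ →
    ∃[ u ] ∃[ w ] (MarkedPair (suc n) w × place b′ (b′ Z.+ + n) u w ≡ dup b₁ t₁ b₂ t₂ ∷ simp b t ∷ [])
  surjective b′ n gap v₂ v p q p′ q′ with inner-surjective b′ n gap p q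
  ... | u , w , m , refl , refl
    with l , refl ← ≤⇒∃- p′ | r , refl ← ≤⇒∃+ v₂ | i , refl ← ≤⇒∃- v
    with p , refl ← <⇒∃- q′ =
    ((tt , l , r , p , tt) , i) , (u , w) , m , refl
  areas : ∀ l r p i → suc (suc p N.+ l) N.+ suc r N.+ (suc i N.+ 0)
          ≡ 4 N.+ (l N.+ (r N.+ (p N.+ 0))) N.+ i N.+ 0
  areas = NS.solve-∀

-- The column grows from the pivot cell, `i` down and `j` up, without regard to t′; hence A₁
-- unmarked.
family-β : Family (monoC 1 1 0 ⊗ powC QTC 2) ⊤ Unmarked (λ _ → 0) (OneCol Rβ)
family-β = record
  { place      = λ { b t (_ , (i , j , _)) _ → simp (b Z.- + i) (b Z.+ + j) ∷ [] }
  ; length≡    = λ _ _ _ _ → refl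
  ; trivial    = λ _ → _
  ; sound      = λ { b n (_ , (i , j , _)) _ _ →
      ZP.≤-trans (x-n≤x b i) (x≤x+n b j) , x-n≤x b i , x≤x+n b j }
  ; injective  = λ { b n (_ , (i , j , _)) (_ , (i′ , j′ , _)) _ _ e →
      injective b i j i′ j′ (cong headBottom e) (cong headTop e) }
  ; surjective = λ { b n (simp _ _ ∷ []) (_ , p , q) → surjective p q }
  ; area≡      = λ { b n (_ , (i , j , _)) _ → trans (cong (λ x → suc x N.+ 0) (spread b i j)) (sums i j) }
  ; height≡    = λ { b n (_ , (i , j , _)) _ → trans (cong suc (trans (spread b i j) (sym (NP.+-identityʳ _)))) (sums i j) }
  ; duplex≡    = λ _ _ _ _ → refl
  }
  where
  spread : ∀ x i j → Z.∣ x Z.+ + j Z.- (x Z.- + i) ∣ ≡ i N.+ j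
  spread x i j = distance {x Z.- + i} (i N.+ j) (rearrange x (+ i) (+ j))
    where
    rearrange : ∀ x i j → x Z.+ j ≡ x Z.- i Z.+ (i Z.+ j)
    rearrange = ZS.solve-∀
  sums : ∀ i j → suc (i N.+ j) N.+ 0 ≡ 1 N.+ (i N.+ (j N.+ 0)) N.+ 0
  sums = NS.solve-∀
  injective : ∀ b i j i′ j′ → b Z.- + i ≡ b Z.- + i′ → b Z.+ + j ≡ b Z.+ + j′ →
              ((tt , (i , j , tt)) , tt) ≡ ((tt , (i′ , j′ , tt)) , tt)
  injective b i j i′ j′ e e′
    with refl ← -‿offset-injective b {i} {i′} e | refl ← +-offset-injective b {j} {j′} e′ = refl
  surjective : ∀ {b′ b t} → b Z.≤ b′ → b′ Z.≤ t →
    ∃[ u ] ∃[ w ] (⊤ × _≡_ {A = List Col} (simp (b′ Z.- + proj₁ (proj₂ u)) (b′ Z.+ + proj₁ (proj₂ (proj₂ u))) ∷ []) (simp b t ∷ []))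
  surjective p q with i , refl ← ≤⇒∃- p | j , refl ← ≤⇒∃+ q = (tt , (i , j , tt)) , tt , tt , refl

-- The mark puts the bottom of the new column into one of the h - 1 rows from b′ + 1 to t′; its
-- length is free.
family-γ : Family (monoC 1 1 0 ⊗ QTC) ℕ Marked (λ _ → 0) (OneCol Rγ)
family-γ = record
  { place      = λ { b t (_ , i) u → simp (b Z.+ + suc u) (b Z.+ + suc u Z.+ + i) ∷ [] }
  ; length≡    = λ _ _ _ _ → refl
  ; trivial    = λ _ → _
  ; sound      = λ { b n (_ , i) u (s≤s u<n) → x≤x+n (b Z.+ + suc u) i , x<x+1+n b u , +-offset-≤ b u<n }
  ; injective  = λ { b n (_ , i) (_ , i′) u u′ e → injective b i u i′ u′ (cong headBottom e) (cong headTop e) }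
  ; surjective = λ { b n (simp _ _ ∷ []) (v , p , q) → surjective b n v p q }
  ; area≡      = λ { b n (_ , i) u → cong (λ x → suc x N.+ 0) (distance {b Z.+ + suc u} i refl) }
  ; height≡    = λ { b n (_ , i) u → cong suc (trans (distance {b Z.+ + suc u} i refl) (sym (NP.+-identityʳ i))) }
  ; duplex≡    = λ _ _ _ _ → refl
  }
  where
  injective : ∀ b i u i′ u′ → b Z.+ + suc u ≡ b Z.+ + suc u′ → b Z.+ + suc u Z.+ + i ≡ b Z.+ + suc u′ Z.+ + i′ →
              ((tt , i) , u) ≡ ((tt , i′) , u′)
  injective b i u i′ u′ e e′ with refl ← +-offset-injective b {suc u} {suc u′} e
    with refl ← +-offset-injective (b Z.+ + suc u) {i} {i′} e′ = refl
  surjective : ∀ b′ n {b t} → b Z.≤ t → b′ Z.< b → b Z.≤ b′ Z.+ + n →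
    ∃[ u ] ∃[ w ] (Marked (suc n) w ×
      _≡_ {A = List Col} (simp (b′ Z.+ + suc w) (b′ Z.+ + suc w Z.+ + proj₂ u) ∷ []) (simp b t ∷ []))
  surjective b′ n v p q with i , refl ← ≤⇒∃+ v with u , refl ← <⇒∃+ p =
    (tt , i) , u , s≤s (+-offset-≤⁻ b′ q) , refl

-- Polyominoes with a single simplex column

-- Normalisation puts the lowest cell of the first column at 0. In `Double` this fixes t₁ as `+ l`,
-- leaving the lengths and the hole free.
Single Double : List Col → Set
Single cs = ∃[ n ] cs ≡ simp Z.0ℤ (+ n) ∷ []
Double cs = ∃[ l ] ∃[ r ] ∃[ i ] ∃[ g ] ∃[ j ] cs ≡ bridgeCols (+ l) (+ l Z.+ + suc (suc g)) l r i j

single-⊨ : polyC Single ⊨ mono 1 1 0 ⊛ invOneMinusQT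
single-⊨ n h d = count-map (λ (_ , n) → simp Z.0ℤ (+ n) ∷ [])
  (λ { {_ , n} (_ , refl , refl , refl) →
       (n , refl) , single-area n
       , cong suc (distance {Z.0ℤ} n refl) , refl })
  (λ { _ _ refl → refl })
  (λ { ((n , refl) , refl , refl , refl) →
       (tt , n) , (_ , sym (single-area n)
                  , sym (cong suc (distance {Z.0ℤ} n refl)) , refl) , refl })
  (⊗-⊨ (mono-⊨ 1 1 0) QT-⊨ n h d)
  where
  single-area : ∀ n → area (simp Z.0ℤ (+ n) ∷ []) ≡ suc n
  single-area n = trans (cong (λ x → suc x N.+ 0) (distance {Z.0ℤ} n refl)) (NP.+-identityʳ (suc n))

coefficient-⊨ : ∀ a b c k k′ → coefficientC a b c k k′ ⊨ mono a b c ⊛ pow invOneMinusQ k ⊛ pow invOneMinusQT k′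
coefficient-⊨ a b c k k′ = ⊗-⊨ (⊗-⊨ (mono-⊨ a b c) (pow-⊨ Q-⊨ k)) (pow-⊨ QT-⊨ k′)

double-⊨ : polyC Double ⊨ mono 5 3 1 ⊛ pow invOneMinusQ 2 ⊛ pow invOneMinusQT 3
double-⊨ n h d = count-map place
  (λ { {(_ , l , r , _) , (i , g , j , _)} (_ , refl , refl , refl) →
       (l , r , i , g , j , refl) , areas l r i g j , heights l r i g j , refl })
  (λ { {(_ , l , r , _) , (i , g , j , _)} {(_ , l′ , r′ , _) , (i′ , g′ , j′ , _)} _ _ e → injective l r i g j l′ r′ i′ g′ j′ e })
  (λ { ((l , r , i , g , j , refl) , refl , refl , refl) →
       ((tt , l , r , tt) , (i , g , j , tt)) , (_ , sym (areas l r i g j) , sym (heights l r i g j) , refl) , refl })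
  (coefficient-⊨ 5 3 1 2 3 n h d)
  where
  place : Obj (coefficientC 5 3 1 2 3) → List Col
  place ((_ , l , r , _) , (i , g , j , _)) = bridgeCols (+ l) (+ l Z.+ + suc (suc g)) l r i j
  areas : ∀ l r i g j → area (bridgeCols (+ l) (+ l Z.+ + suc (suc g)) l r i j)
          ≡ 5 N.+ (l N.+ (r N.+ 0)) N.+ (i N.+ (g N.+ (j N.+ 0)))
  areas l r i g j = trans (bridge-area (+ l) _ (suc (suc g)) l r i j refl) (sums l r i g j)
    where
    sums : ∀ l r i g j → suc l N.+ suc r N.+ (suc (i N.+ suc (suc g) N.+ j) N.+ 0)
           ≡ 5 N.+ (l N.+ (r N.+ 0)) N.+ (i N.+ (g N.+ (j N.+ 0)))
    sums = NS.solve-∀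
  heights : ∀ l r i g j → lastHeight (bridgeCols (+ l) (+ l Z.+ + suc (suc g)) l r i j)
            ≡ 3 N.+ (i N.+ (g N.+ (j N.+ 0)))
  heights l r i g j = trans (bridge-height (+ l) _ (suc (suc g)) l r i j refl) (sums i g j)
    where
    sums : ∀ i g j → suc (i N.+ suc (suc g) N.+ j) ≡ 3 N.+ (i N.+ (g N.+ (j N.+ 0)))
    sums = NS.solve-∀
  injective : ∀ l r i g j l′ r′ i′ g′ j′ →
    bridgeCols (+ l) (+ l Z.+ + suc (suc g)) l r i j ≡ bridgeCols (+ l′) (+ l′ Z.+ + suc (suc g′)) l′ r′ i′ j′ →
    ((tt , l , r , tt) , (i , g , j , tt)) ≡ ((tt , l′ , r′ , tt) , (i′ , g′ , j′ , tt))
  injective l r i g j l′ r′ i′ g′ j′ e with bridge-injective {+ l} {_} {l} {r} {i} {j} {+ l′} {_} {l′} {r′} {i′} {j′} e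
  ... | refl , e₂ , refl with refl ← +-offset-injective (+ l) {suc (suc g)} {suc (suc g′)} e₂ = refl

class-α : ∀ {cs} → InCls Sα cs ⇔ (Single cs ⊎ Double cs)
class-α = mk⇔ (λ (s , only) → to′ (shape s) s only) [ from-single , from-double ]′
  where
  to′ : ∀ {cs} → Shape cs → InS cs → OnlySimpIsLast cs → Single cs ⊎ Double cs
  to′ single ((v ∷ [] , refl , _) , _) _ with n , refl ← ≤⇒∃+ v = inj₁ (n , refl)
  -- With no column to the left, neither component can touch `pre`, so both must meet the last
  -- column.
  to′ (double {b₁} {t₁} {b₂} {t₂} {b} {t}) (((v₁ , gap , v₂) ∷ v ∷ [] , refl , conn , _) , _) _ =
    go v₁ gap (bridge-surjective v₁ v₂
      ( proj₂ (overlap⇒ (lower-meets-last [] b₁ t₁ b₂ t₂ b t gap v₁ v₂ v conn λ { (_ , _ , () , _) }))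
      , proj₁ (overlap⇒ (upper-meets-last [] b₁ t₁ b₂ t₂ b t gap v₁ v₂ v conn λ { (_ , _ , () , _) }))))
    where
    go : ∀ {t₁ b₂ t₂ b t} → Z.0ℤ Z.≤ t₁ → t₁ Z.+ Z.1ℤ Z.< b₂ →
         ∃[ l ] ∃[ r ] ∃[ i ] ∃[ j ] bridgeCols t₁ b₂ l r i j ≡ dup Z.0ℤ t₁ b₂ t₂ ∷ simp b t ∷ [] →
         Single (dup Z.0ℤ t₁ b₂ t₂ ∷ simp b t ∷ []) ⊎ Double (dup Z.0ℤ t₁ b₂ t₂ ∷ simp b t ∷ [])
    go {t₁} v₁ gap (l , r , i , j , e) with cols-injective e | gap⇒∃+ {t₁} gap
    ... | e₁ , _ | g , refl with trans (sym (ZP.+-identityˡ (+ l))) (trans (cong (Z._+ + l) (sym e₁)) (i-n+n t₁ (+ l)))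
    ... | refl = inj₂ (l , r , i , g , j , sym e)
  to′ (snoc₁ {b = b} {t} ends) s only = ⊥-elim (twoSimplex (simp b t ∷ []) ends (s≤s z≤n) only)
  to′ (snoc₂ {b₁ = b₁} {t₁} {b₂} {t₂} {b} {t} ends) s only =
    ⊥-elim (twoSimplex (dup b₁ t₁ b₂ t₂ ∷ simp b t ∷ []) ends (s≤s (s≤s z≤n)) only)
  from-single : ∀ {cs} → Single cs → InCls Sα cs
  from-single (n , refl) = (((Z.+≤+ z≤n ∷ []) , refl , conn , tt) , tt) , refl
    where
    conn : Connected (simp Z.0ℤ (+ n) ∷ [])
    conn (zero , y) (zero , y′) (_ , refl , i) (_ , refl , i′) = vertical (λ k → _ , refl , k) i i′
  from-double : ∀ {cs} → Double cs → InCls Sα cs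
  from-double (l , r , i , g , j , refl)
    with (vD , v , br) ← bridge-sound (λ _ _ _ t₁ b₂ _ b t → Bridging t₁ b₂ b t) Z.0ℤ Z.0ℤ
                           (+ l) (+ l Z.+ + suc (suc g)) l r i j (gap-+ (+ l) g) id
    with SL , SU ← bridge vD v (proj₁ br) (proj₂ br) =
    (((vD ∷ v ∷ []) , ZP.+-inverseʳ (+ l)
      , connected-⁺ [] _ _ _ _ _ _ (1 , + l Z.- + i)
          (λ { (_ , () , _) })
          (reaches-adjacent (lower-segment [] (+ l Z.- + l) (+ l) b₂ (b₂ Z.+ + r) (+ l Z.- + i) (b₂ Z.+ + j)) (inj₂ refl) (overlap-sym SL) reach-last)
          (reaches-adjacent (upper-segment [] (+ l Z.- + l) (+ l) b₂ (b₂ Z.+ + r) (+ l Z.- + i) (b₂ Z.+ + j)) (inj₂ refl) (overlap-sym SU) reach-last)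
          reach-last
      , (λ ()) , tt) , tt) , refl
    where
    b₂ = + l Z.+ + suc (suc g)
    full = bridgeCols (+ l) b₂ l r i j
    reach-last : Reaches full (1 , + l Z.- + i) 1 (+ l Z.- + i) (b₂ Z.+ + j)
    reach-last k = vertical {full} {1} {+ l Z.- + i} {b₂ Z.+ + j} (λ k → _ , refl , k)
      k (ZP.≤-refl , ZP.≤-trans (proj₁ k) (proj₂ k))

-- Disjoint unions and the formulas with signs

⊨-cong : ∀ {P Q f} → (∀ {cs} → P cs ⇔ Q cs) → polyC P ⊨ f → polyC Q ⊨ f
⊨-cong e P-f n h d = count-cong (λ (p , s) → to e p , s) (λ (q , s) → from e q , s) (P-f n h d)

⊨-⊎ : ∀ {P Q f g} → (∀ {cs} → P cs → Q cs → ⊥) → polyC P ⊨ f → polyC Q ⊨ g →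
      polyC (λ cs → P cs ⊎ Q cs) ⊨ f ⊕ g
⊨-⊎ disj P-f Q-g n h d =
  count-cong
    (λ { (inj₁ (p , s)) → inj₁ p , s ; (inj₂ (q , s)) → inj₂ q , s })
    (λ { (inj₁ p , s) → inj₁ (p , s) ; (inj₂ q , s) → inj₂ (q , s) })
    (count-⊎ (λ (p , _) (q , _) → disj p q) (P-f n h d) (Q-g n h d))

fam-disjoint : ∀ {R R′ : TwoColRel} →
  (∀ {b′ t′ b₁ t₁ b₂ t₂ b t} → R b′ t′ b₁ t₁ b₂ t₂ b t → R′ b′ t′ b₁ t₁ b₂ t₂ b t → ⊥) →
  ∀ {cs} → Fam (TwoCol R) cs → Fam (TwoCol R′) cs → ⊥
fam-disjoint disj (fam {pre} ends _ _ {dup _ _ _ _ ∷ simp _ _ ∷ []} (_ , _ , r) refl)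
                  (fam {pre′} ends′ _ _ {dup _ _ _ _ ∷ simp _ _ ∷ []} (_ , _ , r′) e)
  with refl , refl ← ++-injective pre pre′ refl e
  with refl , refl ← endsIn-unique ends ends′ = disj r r′

-- Subtraction has no direct meaning for classes. A signed formula enters as an additive equation
-- between counts and is solved for one term by `⊕-solve`.
split-⊨ : ∀ (R R₁ R₂ : TwoColRel) →
  (∀ {b′ t′ b₁ t₁ b₂ t₂ b t} → b′ Z.≤ t′ → t₁ Z.< b₂ →
     R b′ t′ b₁ t₁ b₂ t₂ b t → R₁ b′ t′ b₁ t₁ b₂ t₂ b t ⊎ R₂ b′ t′ b₁ t₁ b₂ t₂ b t) →
  (∀ {b′ t′ b₁ t₁ b₂ t₂ b t} → b′ Z.≤ t′ → t₁ Z.< b₂ →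
     R₁ b′ t′ b₁ t₁ b₂ t₂ b t → R b′ t′ b₁ t₁ b₂ t₂ b t) →
  (∀ {b′ t′ b₁ t₁ b₂ t₂ b t} → b′ Z.≤ t′ → t₁ Z.< b₂ →
     R₂ b′ t′ b₁ t₁ b₂ t₂ b t → R b′ t′ b₁ t₁ b₂ t₂ b t) →
  (∀ {b′ t′ b₁ t₁ b₂ t₂ b t} → R₁ b′ t′ b₁ t₁ b₂ t₂ b t → R₂ b′ t′ b₁ t₁ b₂ t₂ b t → ⊥) →
  ∀ {f g k} → polyC (Fam (TwoCol R₁)) ⊨ f → polyC (Fam (TwoCol R₂)) ⊨ g → polyC (Fam (TwoCol R)) ⊨ k →
  f ⊕ g ≐ k
split-⊨ R R₁ R₂ split in₁ in₂ disj R₁-f R₂-g =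
  ⊨-unique (⊨-cong (mk⇔ [ fam-map (weaken R₁ in₁) , fam-map (weaken R₂ in₂) ]′ split′)
    (⊨-⊎ (fam-disjoint {R₁} {R₂} disj) R₁-f R₂-g))
  where
  weaken : ∀ (R′ : TwoColRel) →
    (∀ {b′ t′ b₁ t₁ b₂ t₂ b t} → b′ Z.≤ t′ → t₁ Z.< b₂ →
       R′ b′ t′ b₁ t₁ b₂ t₂ b t → R b′ t′ b₁ t₁ b₂ t₂ b t) →
    ∀ {b t e} → b Z.≤ t → TwoCol R′ b t e → TwoCol R b t e
  weaken R′ f {e = dup _ _ _ _ ∷ simp _ _ ∷ []} v (vD , v′ , r) = vD , v′ , f v (lower<upper vD) r
  split′ : ∀ {cs} → Fam (TwoCol R) cs → Fam (TwoCol R₁) cs ⊎ Fam (TwoCol R₂) cs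
  split′ (fam ends s v {dup _ _ _ _ ∷ simp _ _ ∷ []} (vD , v′ , r) refl) with split v (lower<upper vD) r
  ... | inj₁ r₁ = inj₁ (fam ends s v (vD , v′ , r₁) refl)
  ... | inj₂ r₂ = inj₂ (fam ends s v (vD , v′ , r₂) refl)

Pε : ℤ → ℤ → ℤ → ℤ → Set
Pε b′ t′ t₁ b₂ = t₁ Z.< b′ × b′ Z.< b₂

Rμθ : TwoColRel
Rμθ b′ t′ b₁ t₁ b₂ t₂ b t = (b′ Z.≤ t₁ × b₂ Z.≤ t′) × b Z.≤ b₂ × b₂ Z.≤ t

family-ζ : Family (coefficientC 5 3 1 3 3) ⊤ Unmarked (λ _ → 0) (TwoCol Rζ)
family-ζ = family-mirror {R = Rδ} {Rζ}
  (λ σ ((p , q) , r , s) → (flip-≤ σ q , flip-≤ σ p) , flip-≤ σ s , flip-≤ σ r)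
  (λ σ ((p , q) , r , s) → (flip-≤ σ q , flip-≤ σ p) , flip-≤ σ s , flip-≤ σ r)
  family-δ

family-ε : Family (coefficientC 5 3 1 2 4) ⊤ Unmarked (λ _ → 0) (TwoCol (BridgeOver Pε))
family-ε = family-mirror {R = BridgeOver Pη} {BridgeOver Pε}
  (λ σ ((p , q) , r , s) → (flip-< σ q , flip-< σ p) , flip-≤ σ s , flip-≤ σ r)
  (λ σ ((p , q) , r , s) → (flip-< σ q , flip-< σ p) , flip-≤ σ s , flip-≤ σ r)
  (family-bridge holes-η)

family-λ : Family (monoC 4 1 1 ⊗ powC QC 3 ⊗ QTC) (ℕ × ℕ) MarkedPair (λ _ → 0) (TwoCol Rλ)
family-λ = family-mirror {R = Rι} {Rλ}
  (λ σ ((p , q) , r , s) → (flip-≤ σ q , flip-≤ σ p) , flip-< σ s , flip-≤ σ r)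
  (λ σ ((p , q) , r , s) → (flip-≤ σ q , flip-≤ σ p) , flip-≤ σ s , flip-< σ r)
  family-ι

family-μθ : Family (coefficientC 3 1 1 2 2) (ℕ × ℕ) MarkedPair (λ _ → 0) (TwoCol Rμθ)
family-μθ = family-mirror {R = Rκθ} {Rμθ}
  (λ σ ((p , q) , r , s) → (flip-≤ σ q , flip-≤ σ p) , flip-≤ σ s , flip-≤ σ r)
  (λ σ ((p , q) , r , s) → (flip-≤ σ q , flip-≤ σ p) , flip-≤ σ s , flip-≤ σ r)
  family-κθ

module _ {f g k : Series} where

  -- The case distinction is whether the lower component reaches row b′. If it does not, both ends
  -- of the hole lie outside [b′, t′].
  split-η : polyC (Fam (TwoCol Rη)) ⊨ f → polyC (Fam (TwoCol (BridgeOver Pouter))) ⊨ g →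
            polyC (Fam (TwoCol (BridgeOver Pη))) ⊨ k → f ⊕ g ≐ k
  split-η = split-⊨ (BridgeOver Pη) Rη (BridgeOver Pouter)
    (λ {b′} {t′} {b₁} {t₁} v lt → split b′ t₁)
    (λ v lt → proj₁)
    (λ v lt ((p , q) , br) → (ZP.<-≤-trans p v , q) , br)
    (λ (_ , ge) ((p , _) , _) → ZP.<⇒≱ p ge)
    where
    split : ∀ b′ t₁ {t′ b₂ b t} → (t₁ Z.< t′ × t′ Z.< b₂) × b Z.≤ t₁ × b₂ Z.≤ t →
            (((t₁ Z.< t′ × t′ Z.< b₂) × b Z.≤ t₁ × b₂ Z.≤ t) × b′ Z.≤ t₁)
            ⊎ ((t₁ Z.< b′ × t′ Z.< b₂) × b Z.≤ t₁ × b₂ Z.≤ t)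
    split b′ t₁ r@((p , q) , br) with b′ ZP.≤? t₁
    ... | yes le = inj₁ (r , le)
    ... | no gt = inj₂ ((ZP.≰⇒> gt , q) , br)

  -- `Pouter` is symmetric under reflection, so the term removed here is the very one removed for η.
  split-ε : polyC (Fam (TwoCol Rε)) ⊨ f → polyC (Fam (TwoCol (BridgeOver Pouter))) ⊨ g →
            polyC (Fam (TwoCol (BridgeOver Pε))) ⊨ k → f ⊕ g ≐ k
  split-ε = split-⊨ (BridgeOver Pε) Rε (BridgeOver Pouter)
    (λ {b′} {t′} {b₁} {t₁} {b₂} v lt → split t′ b₂)
    (λ v lt → proj₁)
    (λ v lt ((p , q) , br) → (p , ZP.≤-<-trans v q) , br)
    (λ (_ , le) ((_ , q) , _) → ZP.<⇒≱ q le)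
    where
    split : ∀ t′ b₂ {b′ t₁ b t} → (t₁ Z.< b′ × b′ Z.< b₂) × b Z.≤ t₁ × b₂ Z.≤ t →
            (((t₁ Z.< b′ × b′ Z.< b₂) × b Z.≤ t₁ × b₂ Z.≤ t) × b₂ Z.≤ t′)
            ⊎ ((t₁ Z.< b′ × t′ Z.< b₂) × b Z.≤ t₁ × b₂ Z.≤ t)
    split t′ b₂ r@((p , q) , br) with b₂ ZP.≤? t′
    ... | yes le = inj₁ (r , le)
    ... | no gt = inj₂ ((p , ZP.≰⇒> gt) , br)

  -- The case distinction is whether b₂ lies within the third-last column. If it does, t₁ < t′ comes
  -- for free from t₁ < b₂.
  split-θη : polyC (Fam (TwoCol Rθ)) ⊨ f → polyC (Fam (TwoCol Rη)) ⊨ g →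
             polyC (Fam (TwoCol (BridgeOver Pθη))) ⊨ k → f ⊕ g ≐ k
  split-θη = split-⊨ (BridgeOver Pθη) Rθ Rη
    (λ {b′} {t′} {b₁} {t₁} {b₂} v lt → split t′ b₂)
    (λ v lt ((p , q) , br) → (p , ZP.<-≤-trans lt q) , br)
    (λ v lt (((p , q) , br) , ge) → (ge , p) , br)
    (λ ((_ , le) , _) (((_ , q) , _) , _) → ZP.<⇒≱ q le)
    where
    split : ∀ t′ b₂ {b′ t₁ b t} → (b′ Z.≤ t₁ × t₁ Z.< t′) × b Z.≤ t₁ × b₂ Z.≤ t →
            ((b′ Z.≤ t₁ × b₂ Z.≤ t′) × b Z.≤ t₁ × b₂ Z.≤ t)
            ⊎ (((t₁ Z.< t′ × t′ Z.< b₂) × b Z.≤ t₁ × b₂ Z.≤ t) × b′ Z.≤ t₁)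
    split t′ b₂ ((p , q) , br) with b₂ ZP.≤? t′
    ... | yes le = inj₁ ((p , le) , br)
    ... | no gt = inj₂ (((q , ZP.≰⇒> gt) , br) , p)

  -- A last column through row t₁ belongs to θ exactly when it reaches up to b₂.
  split-κθ : polyC (Fam (TwoCol Rκ)) ⊨ f → polyC (Fam (TwoCol Rθ)) ⊨ g →
             polyC (Fam (TwoCol Rκθ)) ⊨ k → f ⊕ g ≐ k
  split-κθ = split-⊨ Rκθ Rκ Rθ
    (λ {b′} {t′} {b₁} {t₁} {b₂} {t₂} {b} {t} v lt → split b₂ t)
    (λ v lt → proj₁)
    (λ v lt (p , q , r) → p , q , ZP.≤-trans (ZP.<⇒≤ lt) r)
    (λ (_ , lt) (_ , _ , ge) → ZP.<⇒≱ lt ge)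
    where
    split : ∀ b₂ t {b′ t′ t₁ b} → (b′ Z.≤ t₁ × b₂ Z.≤ t′) × b Z.≤ t₁ × t₁ Z.≤ t →
            (((b′ Z.≤ t₁ × b₂ Z.≤ t′) × b Z.≤ t₁ × t₁ Z.≤ t) × t Z.< b₂)
            ⊎ ((b′ Z.≤ t₁ × b₂ Z.≤ t′) × b Z.≤ t₁ × b₂ Z.≤ t)
    split b₂ t r@(p , q , _) with b₂ ZP.≤? t
    ... | yes le = inj₂ (p , q , le)
    ... | no gt = inj₁ (r , ZP.≰⇒> gt)

  -- Reflected case: the last column passes through row b₂ and belongs to θ when it reaches down to
  -- t₁. `Rθ` is its own reflection, so the same count is removed.
  split-μθ : polyC (Fam (TwoCol Rμ)) ⊨ f → polyC (Fam (TwoCol Rθ)) ⊨ g →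
             polyC (Fam (TwoCol Rμθ)) ⊨ k → f ⊕ g ≐ k
  split-μθ = split-⊨ Rμθ Rμ Rθ
    (λ {b′} {t′} {b₁} {t₁} {b₂} {t₂} {b} {t} v lt → split t₁ b)
    (λ v lt → proj₁)
    (λ v lt (p , q , r) → p , ZP.≤-trans q (ZP.<⇒≤ lt) , r)
    (λ (_ , lt) (_ , ge , _) → ZP.<⇒≱ lt ge)
    where
    split : ∀ t₁ b {b′ t′ b₂ t} → (b′ Z.≤ t₁ × b₂ Z.≤ t′) × b Z.≤ b₂ × b₂ Z.≤ t →
            (((b′ Z.≤ t₁ × b₂ Z.≤ t′) × b Z.≤ b₂ × b₂ Z.≤ t) × t₁ Z.< b)
            ⊎ ((b′ Z.≤ t₁ × b₂ Z.≤ t′) × b Z.≤ t₁ × b₂ Z.≤ t)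
    split t₁ b r@(p , _ , q) with b ZP.≤? t₁
    ... | yes le = inj₂ (p , le , q)
    ... | no gt = inj₁ (r , ZP.≰⇒> gt)

⊕-solve : ∀ {f g k : Series} → f ⊕ g ≐ k → f ≐ k ⊖ g
⊕-solve {f} {g} e n h d = trans (sym (i+n-n (f n h d) (g n h d))) (cong (Z._- g n h d) (e n h d))

theorem1 : (a : ℕ → ℕ → ℕ → ℕ) (aX : Cls → ℕ → ℕ → ℕ → ℕ) →
    (∀ n h d → IsCount (λ cs → InS cs × Stats cs n h d) (a n h d)) →
    (∀ X n h d → IsCount (λ cs → InCls X cs × Stats cs n h d) (aX X n h d)) →
    let A₁ = GF₁ a
        B₁ = GFB₁ a
        C₁ = GFC₁ a
        Aqt = GFqt a
        Q = invOneMinusQ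
        QT = invOneMinusQT
        Aof = λ X → GF (aX X)
    in (Aof Sα ≐ mono 1 1 0 ⊛ QT ⊕ mono 5 3 1 ⊛ pow Q 2 ⊛ pow QT 3)
     × (Aof Sβ ≐ mono 1 1 0 ⊛ pow QT 2 ⊛ A₁)
     × (Aof Sγ ≐ mono 1 1 0 ⊛ QT ⊛ B₁)
     × (Aof Sδ ≐ mono 5 3 1 ⊛ pow Q 3 ⊛ pow QT 3 ⊛ A₁)
     × (Aof Sζ ≐ mono 5 3 1 ⊛ pow Q 3 ⊛ pow QT 3 ⊛ A₁)
     × (Aof Sε ≐ mono 5 3 1 ⊛ pow Q 2 ⊛ pow QT 4 ⊛ A₁
                 ⊖ mono 4 2 1 ⊛ pow Q 2 ⊛ pow QT 4 ⊛ Aqt)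
     × (Aof Sη ≐ mono 5 3 1 ⊛ pow Q 2 ⊛ pow QT 4 ⊛ A₁
                 ⊖ mono 4 2 1 ⊛ pow Q 2 ⊛ pow QT 4 ⊛ Aqt)
     × (Aof Sθ ≐ mono 5 3 1 ⊛ pow Q 2 ⊛ pow QT 3 ⊛ B₁
                 ⊖ mono 5 3 1 ⊛ pow Q 2 ⊛ pow QT 4 ⊛ A₁
                 ⊕ mono 4 2 1 ⊛ pow Q 2 ⊛ pow QT 4 ⊛ Aqt)
     × (Aof Sι ≐ mono 4 1 1 ⊛ pow Q 3 ⊛ QT ⊛ C₁)
     × (Aof Sλ ≐ mono 4 1 1 ⊛ pow Q 3 ⊛ QT ⊛ C₁)
     × (Aof Sκ ≐ mono 3 1 1 ⊛ pow Q 2 ⊛ pow QT 2 ⊛ C₁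
                 ⊖ mono 5 3 1 ⊛ pow Q 2 ⊛ pow QT 3 ⊛ B₁
                 ⊕ mono 5 3 1 ⊛ pow Q 2 ⊛ pow QT 4 ⊛ A₁
                 ⊖ mono 4 2 1 ⊛ pow Q 2 ⊛ pow QT 4 ⊛ Aqt)
     × (Aof Sμ ≐ mono 3 1 1 ⊛ pow Q 2 ⊛ pow QT 2 ⊛ C₁
                 ⊖ mono 5 3 1 ⊛ pow Q 2 ⊛ pow QT 3 ⊛ B₁
                 ⊕ mono 5 3 1 ⊛ pow Q 2 ⊛ pow QT 4 ⊛ A₁
                 ⊖ mono 4 2 1 ⊛ pow Q 2 ⊛ pow QT 4 ⊛ Aqt)
theorem1 a aX HA HX =
  ⊨-unique (of Sα) (⊨-cong (mk⇔ (from class-α) (to class-α))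
    (⊨-⊎ (λ { (_ , refl) (_ , _ , _ , _ , _ , ()) }) single-⊨ double-⊨))
  , ⊨-unique (fam-of Sβ class-β) (family-⊨ family-β (⊗-⊨ (mono-⊨ 1 1 0) (pow-⊨ QT-⊨ 2)) (GF₁-⊨ HA))
  , ⊨-unique (fam-of Sγ class-γ) (family-⊨ family-γ (⊗-⊨ (mono-⊨ 1 1 0) QT-⊨) (GFB₁-⊨ HA))
  , ⊨-unique (fam-of Sδ class-δ) (family-⊨ family-δ (coefficient-⊨ 5 3 1 3 3) (GF₁-⊨ HA))
  , ⊨-unique (fam-of Sζ class-ζ) (family-⊨ family-ζ (coefficient-⊨ 5 3 1 3 3) (GF₁-⊨ HA))
  , ⊕-solve (split-ε (fam-of Sε class-ε) outer (family-⊨ family-ε (coefficient-⊨ 5 3 1 2 4) (GF₁-⊨ HA)))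
  , η≐
  , θ≐
  , ⊨-unique (fam-of Sι class-ι) (family-⊨ family-ι ι-coefficient (GFC₁-⊨ HA))
  , ⊨-unique (fam-of Sλ class-λ) (family-⊨ family-λ ι-coefficient (GFC₁-⊨ HA))
  , minus-θ (split-κθ (fam-of Sκ class-κ) (fam-of Sθ class-θ)
      (family-⊨ family-κθ (coefficient-⊨ 3 1 1 2 2) (GFC₁-⊨ HA)))
  , minus-θ (split-μθ (fam-of Sμ class-μ) (fam-of Sθ class-θ)
      (family-⊨ family-μθ (coefficient-⊨ 3 1 1 2 2) (GFC₁-⊨ HA)))
  where
  Q = invOneMinusQ
  QT = invOneMinusQT
  of : ∀ X → polyC (InCls X) ⊨ GF (aX X)
  of X n h d = IsCount⇒Count (HX X n h d)
  fam-of : ∀ X {K} → (∀ {cs} → InCls X cs ⇔ Fam K cs) → polyC (Fam K) ⊨ GF (aX X)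
  fam-of X e = ⊨-cong e (of X)
  ι-coefficient = ⊗-⊨ (⊗-⊨ (mono-⊨ 4 1 1) (pow-⊨ Q-⊨ 3)) QT-⊨
  outer : polyC (Fam (TwoCol (BridgeOver Pouter))) ⊨ mono 4 2 1 ⊛ pow Q 2 ⊛ pow QT 4 ⊛ GFqt a
  outer = family-⊨ (family-bridge holes-outer) (coefficient-⊨ 4 2 1 2 4) (GFqt-⊨ HA)
  η≐ : GF (aX Sη) ≐ mono 5 3 1 ⊛ pow Q 2 ⊛ pow QT 4 ⊛ GF₁ a ⊖ mono 4 2 1 ⊛ pow Q 2 ⊛ pow QT 4 ⊛ GFqt a
  η≐ = ⊕-solve (split-η (fam-of Sη class-η) outer
    (family-⊨ (family-bridge holes-η) (coefficient-⊨ 5 3 1 2 4) (GF₁-⊨ HA)))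
  θ≐ : GF (aX Sθ) ≐ mono 5 3 1 ⊛ pow Q 2 ⊛ pow QT 3 ⊛ GFB₁ a
                    ⊖ mono 5 3 1 ⊛ pow Q 2 ⊛ pow QT 4 ⊛ GF₁ a
                    ⊕ mono 4 2 1 ⊛ pow Q 2 ⊛ pow QT 4 ⊛ GFqt a
  θ≐ n h d =
    trans (⊕-solve {GF (aX Sθ)} {GF (aX Sη)} (split-θη (fam-of Sθ class-θ) (fam-of Sη class-η)
             (family-⊨ (family-bridge holes-θη) (coefficient-⊨ 5 3 1 2 3) (GFB₁-⊨ HA))) n h d)
      (trans (cong (λ z → B Z.- z) (η≐ n h d)) (expand B A O))
    where
    B = (mono 5 3 1 ⊛ pow Q 2 ⊛ pow QT 3 ⊛ GFB₁ a) n h d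
    A = (mono 5 3 1 ⊛ pow Q 2 ⊛ pow QT 4 ⊛ GF₁ a) n h d
    O = (mono 4 2 1 ⊛ pow Q 2 ⊛ pow QT 4 ⊛ GFqt a) n h d
    expand : ∀ x y z → x Z.- (y Z.- z) ≡ x Z.- y Z.+ z
    expand = ZS.solve-∀
  minus-θ : ∀ {f k} → f ⊕ GF (aX Sθ) ≐ k →
            f ≐ k ⊖ mono 5 3 1 ⊛ pow Q 2 ⊛ pow QT 3 ⊛ GFB₁ a
                  ⊕ mono 5 3 1 ⊛ pow Q 2 ⊛ pow QT 4 ⊛ GF₁ a
                  ⊖ mono 4 2 1 ⊛ pow Q 2 ⊛ pow QT 4 ⊛ GFqt a
  minus-θ {f} {k} e n h d =
    trans (⊕-solve {f} {GF (aX Sθ)} {k} e n h d)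
      (trans (cong (λ z → k n h d Z.- z) (θ≐ n h d)) (expand (k n h d) B A O))
    where
    B = (mono 5 3 1 ⊛ pow Q 2 ⊛ pow QT 3 ⊛ GFB₁ a) n h d
    A = (mono 5 3 1 ⊛ pow Q 2 ⊛ pow QT 4 ⊛ GF₁ a) n h d
    O = (mono 4 2 1 ⊛ pow Q 2 ⊛ pow QT 4 ⊛ GFqt a) n h d
    expand : ∀ c x y z → c Z.- (x Z.- y Z.+ z) ≡ c Z.- x Z.+ y Z.- z
    expand = ZS.solve-∀
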